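{- Let $k\geq 3$ and assume that $k$-SUM can be solved in time $T_{k\mathrm{SUM}}(n)$. For any problem $P$ in $\mathsf{FOP}_{\mathbb{Z}}(\exists^k)$, there exists some constant $c$ such that $P$ can be solved in time $O(T_{k\mathrm{SUM}}(n)\log^c n)$.
   Context: $k$-SUM: given sets $A_1,\dots,A_k$ of $n$ integers each, decide whether there exist $a_1\in A_1,\dots,a_k\in A_k$ with $\sum_{i=1}^k a_i=0$. Model-checking problems: let $x_1=(x_1[1],\dots,x_1[d_1]),\dots,x_k=(x_k[1],\dots,x_k[d_k])$ be vectors of quantified variables, $t_1,\dots,t_l$ free variables, and $\psi$ a quantifier-free linear integer arithmetic formula (Boolean combination of linear equalities and inequalities with fixed integer coefficients) over the variables $x_i[j]$ and $t_1,\dots,t_l$. For $\phi:=Q_1x_1\dots Q_kx_k:\psi$ with $Q_i\in\{\exists,\forall\}$, the problem $\mathsf{FOP}_{\mathbb{Z}}(\phi)$ is: given finite sets $A_1\subseteq\mathbb{Z}^{d_1},\dots,A_k\subseteq\mathbb{Z}^{d_k}$ and $\hat t_1,\dots,\hat t_l\in\mathbb{Z}$, decide whether $Q_1x_1\in A_1\dots Q_kx_k\in A_k:\psi[(t_1,\dots,t_l)\backslash(\hat t_1,\dots,\hat t_l)]$ holds, i.e. $\psi$ with each $t_i$ replaced by $\hat t_i$. The formula $\phi$ (hence $k$, the $d_i$ and $l$) is fixed. $\mathsf{FOP}_{\mathbb{Z}}(\exists^k)$ is the class of all problems $\mathsf{FOP}_{\mathbb{Z}}(\phi)$ where $\phi$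 has exactly $k$ quantifiers, all existential. Input size: $n:=\max_i|A_i|$. Throughout, all input numbers (of all problems) lie in a polynomially sized universe $\{ -U,\dots,U\}$ with $U\le n^{c'}$ for some constant $c'$. -}

module Defs where

open import Data.Bool.Base using (if_then_else_; _∧_)
open import Data.Fin.Base using (Fin; zero; suc)
open import Data.Integer.Base as ℤ using (ℤ; +_; -[1+_]; 0ℤ; 1ℤ; ∣_∣)
open import Data.Integer.Properties as ℤ using ()
open import Data.List.Base as List using (List; []; _∷_; _++_; length; concatMap)
open import Data.List.Membership.Propositional using (_∈_)
open import Data.List.Relation.Unary.All using (All)
open import Data.List.Relation.Unary.Unique.Propositional using (Unique)
open import Data.Nat.Base using (ℕ; zero; suc; _+_; _*_; _^_; _≤_; _⊔_)
open import Data.Nat.Properties as ℕ using ()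
open import Data.Product.Base using (Σ-syntax; ∃-syntax; _×_)
open import Data.Sum.Base using (_⊎_)
open import Data.Vec.Base as Vec using (Vec; lookup; toList)
import Data.Vec.Relation.Unary.All as Vec
open import Data.Vec.Functional using (foldr)
open import Function.Base using (_∘_)
open import Relation.Binary.PropositionalEquality.Core using (_≡_)
open import Relation.Nullary.Decidable.Core using (does)
open import Relation.Nullary.Negation.Core using (¬_)

open import Algebra.Properties.Monoid.Sum ℤ.+-0-monoid public using (sum)

------------------------------------------------------------------------
-- Machine model: a unit-cost RAM on O(log n)-bit words, programmed in a
-- structured language.  A program is a fixed finite text, so it uses
-- finitely many registers and finitely many random-access arrays.
-- Structured control costs only a constant factor over jumps, since a
-- jump program is one loop around a case distinction on its program
-- counter; likewise several arrays can be interleaved into one memory.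

data Op : Set where
  add sub mul div : Op

data Exp : Set where
  con   : ℤ → Exp
  reg   : ℕ → Exp
  _[_]  : ℕ → Exp → Exp
  _⟨_⟩_ : Exp → Op → Exp → Exp

infixr 5 _︔_

data Cmd : Set where
  skip           : Cmd
  _≔_            : ℕ → Exp → Cmd
  _[_]≔_         : ℕ → Exp → Exp → Cmd
  _︔_            : Cmd → Cmd → Cmd
  if>0_then_else_ : Exp → Cmd → Cmd → Cmd
  while>0_loop_   : Exp → Cmd → Cmd

record State : Set where
  constructor state
  field
    register : ℕ → ℤ
    array    : ℕ → ℤ → ℤ

open State public

setRegister : ℕ → ℤ → State → State
setRegister r v σ .register s = if does (s ℕ.≟ r) then v else register σ s
setRegister r v σ .array      = array σ

setArray : ℕ → ℤ → ℤ → State → State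
setArray a i v σ .register  = register σ
setArray a i v σ .array b j =
  if does (b ℕ.≟ a) ∧ does (j ℤ.≟ i) then v else array σ b j

-- Euclidean division (the floor, for a positive divisor), made total.
quotient : ℤ → ℤ → ℤ
quotient i (+ zero)      = 0ℤ
quotient i j@(+ suc _)   = i ℤ./ j
quotient i j@(-[1+ _ ])  = i ℤ./ j

apply : Op → ℤ → ℤ → ℤ
apply add = ℤ._+_
apply sub = ℤ._-_
apply mul = ℤ._*_
apply div = quotient

eval : State → Exp → ℤ
eval σ (con z)       = z
eval σ (reg r)       = register σ r
eval σ (a [ e ])     = array σ a (eval σ e)
eval σ (e ⟨ o ⟩ f)   = apply o (eval σ e) (eval σ f)

cost : Exp → ℕ
cost (con z)     = 1
cost (reg r)     = 1
cost (a [ e ])   = 1 + cost e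
cost (e ⟨ o ⟩ f) = 1 + cost e + cost f

-- Every value arising in the evaluation, addresses included, is at most
-- W in absolute value.
Fits : ℕ → State → Exp → Set
Fits W σ e@(con _)     = ∣ eval σ e ∣ ≤ W
Fits W σ e@(reg _)     = ∣ eval σ e ∣ ≤ W
Fits W σ e@(_ [ i ])   = Fits W σ i × ∣ eval σ e ∣ ≤ W
Fits W σ e@(f ⟨ _ ⟩ g) = Fits W σ f × Fits W σ g × ∣ eval σ e ∣ ≤ W

-- W ⊢ p , σ ⇓ τ after t: started in σ, the program p halts in τ after
-- exactly t steps, and all values it computes with are bounded by W
-- (a run exceeding W has no derivation).
infix 4 _⊢_,_⇓_after_

data _⊢_,_⇓_after_ (W : ℕ) : Cmd → State → State → ℕ → Set where

  ⇓skip : ∀ {σ} → W ⊢ skip , σ ⇓ σ after 1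

  ⇓≔ : ∀ {σ r e} → Fits W σ e →
       W ⊢ r ≔ e , σ ⇓ setRegister r (eval σ e) σ after (1 + cost e)

  ⇓[]≔ : ∀ {σ a i e} → Fits W σ i → Fits W σ e →
         W ⊢ a [ i ]≔ e , σ ⇓ setArray a (eval σ i) (eval σ e) σ
           after (1 + cost i + cost e)

  ⇓︔ : ∀ {σ τ υ p q s t} →
       W ⊢ p , σ ⇓ τ after s → W ⊢ q , τ ⇓ υ after t →
       W ⊢ p ︔ q , σ ⇓ υ after (s + t)

  ⇓then : ∀ {σ τ e p q t} → Fits W σ e → 0ℤ ℤ.< eval σ e →
          W ⊢ p , σ ⇓ τ after t →
          W ⊢ if>0 e then p else q , σ ⇓ τ after (1 + cost e + t)

  ⇓else : ∀ {σ τ e p q t} → Fits W σ e → eval σ e ℤ.≤ 0ℤ →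
          W ⊢ q , σ ⇓ τ after t →
          W ⊢ if>0 e then p else q , σ ⇓ τ after (1 + cost e + t)

  ⇓stop : ∀ {σ e p} → Fits W σ e → eval σ e ℤ.≤ 0ℤ →
          W ⊢ while>0 e loop p , σ ⇓ σ after (1 + cost e)

  ⇓loop : ∀ {σ τ υ e p s t} → Fits W σ e → 0ℤ ℤ.< eval σ e →
          W ⊢ p , σ ⇓ τ after s → W ⊢ while>0 e loop p , τ ⇓ υ after t →
          W ⊢ while>0 e loop p , σ ⇓ υ after (1 + cost e + s + t)

nth : {A : Set} → A → List A → ℕ → A
nth z []       n       = z
nth z (x ∷ xs) zero    = x
nth z (x ∷ xs) (suc n) = nth z xs n

contents : List ℤ → ℤ → ℤ
contents xs (+ n)    = nth 0ℤ xs n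
contents xs -[1+ _ ] = 0ℤ

-- Memory outside the input is zero.
load : List ℤ → List (List ℤ) → State
load rs as .register = nth 0ℤ rs
load rs as .array    = contents ∘ nth [] as

------------------------------------------------------------------------
-- Decision problems and running times

record Problem : Set₁ where
  field
    Instance : Set
    size     : Instance → ℕ
    -- All input numbers lie in {-U,…,U}.
    Within   : Instance → (U : ℕ) → Set
    input    : Instance → State
    Yes      : Instance → Set

-- The answer is left in register 0.
Answers : Set → State → Set
Answers Y σ = (register σ 0 ≡ 1ℤ × Y) ⊎ (register σ 0 ≡ 0ℤ × ¬ Y)

-- P can be solved in time O(T(n)), n being the size, on inputs over a
-- polynomially sized universe.  The exponent c′ of the universe is an
-- arbitrary constant, on which the program p, the exponent w of the word
-- bound and the constants C, n₀ of the O-notation may depend.  The shift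
-- n + 2 gives room for constants in words when n ≤ 1.
SolvableIn : Problem → (ℕ → ℕ) → Set
SolvableIn P T =
  ∀ (c′ : ℕ) →
  ∃[ p ] ∃[ w ] ∃[ C ] ∃[ n₀ ]
  (∀ (x : Instance) → Within x (size x ^ c′) →
   ∃[ σ ] ∃[ t ]
     (size x + 2) ^ w ⊢ p , input x ⇓ σ after t
     × Answers (Yes x) σ
     × (n₀ ≤ size x → t ≤ C * T (size x)))
  where open Problem P

record FiniteSet (X : Set) : Set where
  field
    elements : List X
    unique   : Unique elements

open FiniteSet public

card : {X : Set} → FiniteSet X → ℕ
card A = length (elements A)

infix 4 _∈ˢ_

_∈ˢ_ : {X : Set} → X → FiniteSet X → Set
x ∈ˢ A = x ∈ elements A

------------------------------------------------------------------------
-- k-SUM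

record SumInstance (k : ℕ) : Set where
  field
    n      : ℕ
    A      : Fin k → FiniteSet ℤ
    card≡n : ∀ i → card (A i) ≡ n

kSUM : ℕ → Problem
kSUM k = record
  { Instance = SumInstance k
  ; size     = n
  ; Within   = λ x U → ∀ i → All (λ a → ∣ a ∣ ≤ U) (elements (A x i))
  ; input    = λ x → load (+ n x ∷ []) (List.tabulate (elements ∘ A x))
  ; Yes      = λ x → Σ[ a ∈ (Fin k → ℤ) ] (∀ i → a i ∈ˢ A x i) × sum a ≡ 0ℤ
  }
  where open SumInstance

------------------------------------------------------------------------
-- Model checking for linear integer arithmetic

data Quantifier : Set where
  exists forall′ : Quantifier

Assignment : {k : ℕ} → (Fin k → ℕ) → Set
Assignment d = ∀ i → Vec ℤ (d i)

-- ∑ᵢⱼ coeff i [j] · xᵢ[j] + ∑ₛ param [s] · tₛ + const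
record Linear {k : ℕ} (d : Fin k → ℕ) (l : ℕ) : Set where
  field
    coeff : ∀ i → Vec ℤ (d i)
    param : Vec ℤ l
    const : ℤ

infixr 6 _∧′_
infixr 5 _∨′_

data QuantifierFree {k : ℕ} (d : Fin k → ℕ) (l : ℕ) : Set where
  _≐_ _≼_ _≺_ : Linear d l → Linear d l → QuantifierFree d l
  ¬′_         : QuantifierFree d l → QuantifierFree d l
  _∧′_ _∨′_   : QuantifierFree d l → QuantifierFree d l → QuantifierFree d l

-- φ = Q₁x₁ … Q_k x_k : ψ, with xᵢ of dimension d i and l free variables.
record Formula (k : ℕ) : Set where
  field
    d : Fin k → ℕ
    l : ℕ
    Q : Fin k → Quantifier
    ψ : QuantifierFree d l

_·_ : {m : ℕ} → Vec ℤ m → Vec ℤ m → ℤ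
u · v = sum λ j → lookup u j ℤ.* lookup v j

module _ {k l : ℕ} {d : Fin k → ℕ} (t : Vec ℤ l) (x : Assignment d) where

  value : Linear d l → ℤ
  value a = sum (λ i → coeff i · x i) ℤ.+ param · t ℤ.+ const
    where open Linear a

  ⟦_⟧ : QuantifierFree d l → Set
  ⟦ a ≐ b ⟧   = value a ≡ value b
  ⟦ a ≼ b ⟧   = value a ℤ.≤ value b
  ⟦ a ≺ b ⟧   = value a ℤ.< value b
  ⟦ ¬′ ψ ⟧    = ¬ ⟦ ψ ⟧
  ⟦ ψ ∧′ χ ⟧  = ⟦ ψ ⟧ × ⟦ χ ⟧
  ⟦ ψ ∨′ χ ⟧  = ⟦ ψ ⟧ ⊎ ⟦ χ ⟧

quantify : {X : Set} → Quantifier → FiniteSet X → (X → Set) → Set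
quantify exists  A B = ∃[ x ] x ∈ˢ A × B x
quantify forall′ A B = ∀ x → x ∈ˢ A → B x

extend : {k : ℕ} {d : Fin (suc k) → ℕ} →
         Vec ℤ (d zero) → Assignment (d ∘ suc) → Assignment d
extend x xs zero    = x
extend x xs (suc i) = xs i

Prefixed : {k : ℕ} {d : Fin k → ℕ} → (Fin k → Quantifier) →
           (∀ i → FiniteSet (Vec ℤ (d i))) → (Assignment d → Set) → Set
Prefixed {zero}  Q A B = B λ ()
Prefixed {suc k} Q A B =
  quantify (Q zero) (A zero) λ x →
    Prefixed (Q ∘ suc) (A ∘ suc) (B ∘ extend x)

record ModelInstance {k : ℕ} (φ : Formula k) : Set where
  open Formula φ
  field
    A : ∀ i → FiniteSet (Vec ℤ (d i))
    t : Vec ℤ l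

-- Registers hold ∣A₁∣, …, ∣A_k∣, t₁, …, t_l, and array i holds the vectors
-- of the i-th set one after the other.
FOPℤ : {k : ℕ} → Formula k → Problem
FOPℤ φ = record
  { Instance = ModelInstance φ
  ; size     = λ x → foldr _⊔_ 0 (card ∘ A x)
  ; Within   = λ x U →
      (∀ i → All (Vec.All (λ a → ∣ a ∣ ≤ U)) (elements (A x i)))
      × Vec.All (λ s → ∣ s ∣ ≤ U) (t x)
  ; input    = λ x →
      load (List.tabulate (λ i → + card (A x i)) ++ toList (t x))
           (List.tabulate (λ i → concatMap toList (elements (A x i))))
  ; Yes      = λ x → Prefixed Q (A x) (λ y → ⟦_⟧ (t x) y ψ)
  }
  where open Formula φ; open ModelInstance

-- The class of the problems FOPℤ(φ) with φ having exactly k quantifiers,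
-- all of them existential.
data FOPℤ∃^ (k : ℕ) : Problem → Set₁ where
  fop : (φ : Formula k) → (∀ i → Formula.Q φ i ≡ exists) → FOPℤ∃^ k (FOPℤ φ)

{-# OPTIONS --safe #-}

-- ψ is put in disjunctive normal form with atoms S > 0, where S = ∑ᵢ yᵢ and
-- yᵢ depends on xᵢ only.  With sᵦ = ∑ᵢ ⌊yᵢ / 2ᵇ⌋, one has S > 0 iff sᵦ = v for
-- some b < B = O(log n) and 1 ≤ v ≤ 2k: a positive sᵦ forces S > 0, and at the
-- last b with sᵦ > 0 only the k remainders contribute.  A conjunction of such
-- equalities becomes one equality by reading them as digits in a large base,
-- so P is a disjunction of polylogarithmically many instances of k-SUM.
-- Those need sets of exactly n distinct integers: repeated and missing elements
-- are replaced by huge dummies, detected by direct addressing in linear time.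
-- Linear time is affordable, since a k-SUM program has to read all its input.

module Submission where

open import Defs
open import Data.Bool.Base using (Bool; true; false; if_then_else_; _∧_)
open import Data.Bool.Properties using (∧-zeroʳ)
open import Data.Empty using (⊥; ⊥-elim)
open import Data.Fin.Base as Fin using (Fin; zero; suc; toℕ; fromℕ<)
open import Data.Fin.Properties as Fin using (toℕ<n; toℕ-injective; toℕ-fromℕ<; ¬∀⟶∃¬; injective⇒≤)
open import Data.Integer.Base as ℤ using (ℤ; +_; -[1+_]; 0ℤ; 1ℤ; ∣_∣)
open import Data.Integer.DivMod as ℤ using ()
open import Data.Integer.Properties as ℤ using ()
open import Data.Integer.Tactic.RingSolver as ℤ-solver using ()
open import Data.List.Base as List using
  (List; []; _∷_; _++_; length; concatMap; cartesianProductWith; applyUpTo)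
import Data.List.Membership.DecPropositional as DecMembership
open import Data.List.Membership.Propositional using (_∈_; _∉_) renaming (find to Any-find)
open import Data.List.Membership.Propositional.Properties
import Data.List.Properties as List
open import Data.List.Relation.Unary.All as All using (All; []; _∷_)
import Data.List.Relation.Unary.All.Properties as All
open import Data.List.Relation.Unary.Any as Any using (Any; here; there)
import Data.List.Relation.Unary.Any.Properties as Any
import Data.List.Relation.Unary.Unique.Propositional.Properties as Unique
open import Data.Nat.Base
open import Data.Nat.DivMod as ℕ using ()
open import Data.Nat.Divisibility using (divides)
open import Data.Nat.Logarithm using (⌊log₂_⌋; ⌊log₂⌋-mono-≤; ⌊log₂[2^n]⌋≡n)
open import Data.Nat.Properties as ℕ using ()
open import Data.Nat.Tactic.RingSolver as ℕ-solver using ()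
open import Data.Product.Base using (Σ-syntax; ∃-syntax; ∃; _×_; _,_; proj₁; proj₂)
open import Data.Product.Function.NonDependent.Propositional using (_×-⇔_)
open import Data.Sum.Base using (_⊎_; inj₁; inj₂)
open import Data.Sum.Function.Propositional using (_⊎-⇔_)
open import Data.Unit.Base using (⊤; tt)
open import Data.Vec.Base as Vec using (Vec; []; _∷_; lookup; toList)
open import Data.Vec.Functional using (foldr)
import Data.Vec.Properties as VecProp
import Data.Vec.Relation.Unary.All as VecAll
import Data.Vec.Relation.Unary.All.Properties as VecAll
open import Function.Base using (_∘_; id)
open import Function.Bundles using (_⇔_; mk⇔; module Equivalence)
open import Function.Construct.Composition using (_⇔-∘_)
open import Function.Related.TypeIsomorphisms using (¬-cong-⇔)
open import Relation.Binary.Definitions using (tri<; tri≈; tri>)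
open import Relation.Binary.PropositionalEquality hiding ([_])
open import Relation.Nullary.Decidable using
  (Dec; yes; no; does; dec-true; dec-false; decidable-stable; ¬?; _×-dec_; _⊎-dec_)
open import Relation.Nullary.Negation.Core using (¬_; contradiction)
open import Algebra.Properties.Semiring.Sum ℤ.+-*-semiring
  using (sum-cong-≗; sum-replicate-zero; ∑-distrib-+; *-distribˡ-sum)

-- Bounds on the values of expressions

-- The k-SUM program is a black box: it may write anywhere, and its text depends on the exponent of
-- the universe. Each call therefore gets memory of its own. The number of calls is at most a power
-- of `n + 2`, so stretching addresses by that factor stays within words of O(log n) bits. The
-- exponents must be fixed in the right order. Bounds on forms, entries and dummies are read off the
-- syntax of `φ` and from `c′`; they determine the universe for which the k-SUM program is
-- requested; only the bounds on memory and words may then depend on that program. The exponent of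
-- the logarithm comes even before `c′`, so it is built from the lengths of the jobs alone, and `c′`
-- affects the number of bits only through a constant factor. Two further points shape the proof.
-- The universe `n ^ c` is degenerate for `n ≤ 1`, which needs a separate treatment. And correctness
-- is required for all sizes but time only beyond a threshold, so time bounds are conditional
-- throughout. The linear lower bound on k-SUM is an adversary argument on derivations of the
-- operational semantics.

n<2^n : ∀ n → n < 2 ^ n
n<2^n zero    = ℕ.≤-refl
n<2^n (suc n) = ℕ.≤-trans (ℕ.+-mono-≤ (ℕ.m^n>0 2 n) (n<2^n n))
  (ℕ.≤-reflexive (cong (λ m → 2 ^ n + m) (sym (ℕ.+-identityʳ _))))

module _ {N : ℕ} (2≤N : 2 ≤ N) where

  private instance
    N≢0 : NonZero N
    N≢0 = >-nonZero (ℕ.≤-trans (s≤s z≤n) 2≤N)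

  ^-mono : ∀ {x y} → x ≤ y → N ^ x ≤ N ^ y
  ^-mono = ℕ.^-monoʳ-≤ N

  n<N^n : ∀ n → n < N ^ n
  n<N^n n = ℕ.≤-trans (n<2^n n) (ℕ.^-monoˡ-≤ n 2≤N)

  -- One additional factor `N ≥ 2` pays for the two summands. Crude exponents suffice, because only
  -- their independence of the instance matters.
  ^-+-bound : ∀ {a b} x y → a ≤ N ^ x → b ≤ N ^ y → a + b ≤ N ^ suc (x + y)
  ^-+-bound {a} {b} x y a≤ b≤ = begin
    a + b                     ≤⟨ ℕ.+-mono-≤ (ℕ.≤-trans a≤ (^-mono (ℕ.m≤m+n x y)))
                                            (ℕ.≤-trans b≤ (^-mono (ℕ.m≤n+m y x))) ⟩
    N ^ (x + y) + N ^ (x + y) ≡⟨ cong (λ m → N ^ (x + y) + m) (sym (ℕ.+-identityʳ _)) ⟩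
    2 * N ^ (x + y)           ≤⟨ ℕ.*-monoˡ-≤ (N ^ (x + y)) 2≤N ⟩
    N ^ suc (x + y)           ∎
    where open ℕ.≤-Reasoning

  ^-*-bound : ∀ {a b} x y → a ≤ N ^ x → b ≤ N ^ y → a * b ≤ N ^ (x + y)
  ^-*-bound x y a≤ b≤ = subst (_ ≤_) (sym (ℕ.^-distribˡ-+-* N x y)) (ℕ.*-mono-≤ a≤ b≤)

-- The floor of a negative number rounds away from zero when there is a remainder. A remainder
-- excludes the divisor 1, and for divisors from 2 on the truncated quotient is strictly smaller,
-- which leaves room for the extra unit.
∣i/ℕn∣≤∣i∣ : ∀ i n .{{_ : NonZero n}} → ∣ i ℤ./ℕ n ∣ ≤ ∣ i ∣
∣i/ℕn∣≤∣i∣ (+ m)    n = ℕ.m/n≤m m n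
∣i/ℕn∣≤∣i∣ -[1+ m ] n with suc m ℕ.% n in eq
... | zero  = ℕ.≤-trans (ℕ.≤-reflexive (ℤ.∣-i∣≡∣i∣ (+ (suc m ℕ./ n)))) (ℕ.m/n≤m (suc m) n)
∣i/ℕn∣≤∣i∣ -[1+ m ] 1             | suc r =
  contradiction (trans (sym (ℕ.n%1≡0 (suc m))) eq) λ ()
∣i/ℕn∣≤∣i∣ -[1+ m ] n@(suc (suc _)) | suc r = ℕ.m/n<m (suc m) n (s≤s (s≤s z≤n))

∣quotient∣≤ : ∀ i j → ∣ quotient i j ∣ ≤ ∣ i ∣
∣quotient∣≤ i (+ zero)  = z≤n
∣quotient∣≤ i (+ suc n) = begin
  ∣ 1ℤ ℤ.* (i ℤ./ℕ suc n) ∣ ≡⟨ cong ∣_∣ (ℤ.*-identityˡ (i ℤ./ℕ suc n)) ⟩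
  ∣ i ℤ./ℕ suc n ∣          ≤⟨ ∣i/ℕn∣≤∣i∣ i (suc n) ⟩
  ∣ i ∣                     ∎
  where open ℕ.≤-Reasoning
∣quotient∣≤ i -[1+ n ] = begin
  ∣ ℤ.-1ℤ ℤ.* (i ℤ./ℕ suc n) ∣ ≡⟨ cong ∣_∣ (ℤ.-1*i≡-i (i ℤ./ℕ suc n)) ⟩
  ∣ ℤ.- (i ℤ./ℕ suc n) ∣       ≡⟨ ℤ.∣-i∣≡∣i∣ (i ℤ./ℕ suc n) ⟩
  ∣ i ℤ./ℕ suc n ∣             ≤⟨ ∣i/ℕn∣≤∣i∣ i (suc n) ⟩
  ∣ i ∣                        ∎
  where open ℕ.≤-Reasoning

-- Only the values that are read from memory are constrained; all intermediate values are then
-- controlled by `degree`.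
Leaves : ℕ → State → Exp → Set
Leaves W σ (con _)       = ⊤
Leaves W σ (reg r)       = ∣ register σ r ∣ ≤ W
Leaves W σ (a [ e ])     = Leaves W σ e × ∣ array σ a (eval σ e) ∣ ≤ W
Leaves W σ (e ⟨ _ ⟩ f)   = Leaves W σ e × Leaves W σ f

record Small (W : ℕ) (σ : State) : Set where
  constructor _,_
  field
    register≤ : ∀ r → ∣ register σ r ∣ ≤ W
    array≤    : ∀ a j → ∣ array σ a j ∣ ≤ W

open Small public

small⇒leaves : ∀ {W σ} → Small W σ → ∀ e → Leaves W σ e
small⇒leaves sm (con _)     = tt
small⇒leaves sm (reg r)     = register≤ sm r
small⇒leaves sm (a [ e ])   = small⇒leaves sm e , array≤ sm a _
small⇒leaves sm (e ⟨ _ ⟩ f) = small⇒leaves sm e , small⇒leaves sm f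

-- An exponent of `N` dominating the value when the leaves are at most `N ^ v`. It is purely
-- syntactic, hence the same for all instances. An array access also counts the degree of its
-- address, since addresses have to fit into words too.
degree : ℕ → Exp → ℕ
degree v (con z)     = ∣ z ∣
degree v (reg r)     = v
degree v (a [ e ])   = v + degree v e
degree v (e ⟨ _ ⟩ f) = suc (degree v e + degree v f)

module _ {N : ℕ} (2≤N : 2 ≤ N) where

  apply-bound : ∀ o x y p q → ∣ x ∣ ≤ N ^ p → ∣ y ∣ ≤ N ^ q →
                ∣ apply o x y ∣ ≤ N ^ suc (p + q)
  apply-bound add x y p q x≤ y≤ = ℕ.≤-trans (ℤ.∣i+j∣≤∣i∣+∣j∣ x y) (^-+-bound 2≤N p q x≤ y≤)
  apply-bound sub x y p q x≤ y≤ = ℕ.≤-trans (ℤ.∣i-j∣≤∣i∣+∣j∣ x y) (^-+-bound 2≤N p q x≤ y≤)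
  apply-bound mul x y p q x≤ y≤ = ℕ.≤-trans (ℕ.≤-reflexive (ℤ.abs-* x y))
    (ℕ.≤-trans (^-*-bound 2≤N p q x≤ y≤) (^-mono 2≤N (ℕ.n≤1+n (p + q))))
  apply-bound div x y p q x≤ y≤ = ℕ.≤-trans (∣quotient∣≤ x y)
    (ℕ.≤-trans x≤ (^-mono 2≤N {x = p} (ℕ.m≤n⇒m≤1+n (ℕ.m≤m+n p q))))

  eval-bound : ∀ {v σ} e → Leaves (N ^ v) σ e → ∣ eval σ e ∣ ≤ N ^ degree v e
  eval-bound         (con z)     _         = ℕ.<⇒≤ (n<N^n 2≤N ∣ z ∣)
  eval-bound     (reg r)     r≤        = r≤
  eval-bound {v} (a [ e ])   (_ , a≤)  = ℕ.≤-trans a≤ (^-mono 2≤N (ℕ.m≤m+n v _))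
  eval-bound {v} {σ} (e ⟨ o ⟩ f) (e≤ , f≤) =
    apply-bound o _ _ (degree v e) (degree v f) (eval-bound {v} {σ} e e≤) (eval-bound {v} {σ} f f≤)

  leaves⇒fits : ∀ {v w σ} e → Leaves (N ^ v) σ e → degree v e ≤ w → Fits (N ^ w) σ e
  leaves⇒fits {v} {w} {σ} e@(con z)     le d≤ = ℕ.≤-trans (eval-bound {v} {σ} e le) (^-mono 2≤N d≤)
  leaves⇒fits {v} {w} {σ} e@(reg r)     le d≤ = ℕ.≤-trans (eval-bound {v} {σ} e le) (^-mono 2≤N d≤)
  leaves⇒fits {v} {w} {σ} e@(a [ i ])   le d≤ =
    leaves⇒fits {v} {σ = σ} i (proj₁ le) (ℕ.≤-trans (ℕ.m≤n+m _ v) d≤) ,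
    ℕ.≤-trans (eval-bound {v} {σ} e le) (^-mono 2≤N d≤)
  leaves⇒fits {v} {w} {σ} e@(f ⟨ o ⟩ g) le d≤ =
    leaves⇒fits {v} {σ = σ} f (proj₁ le) (ℕ.≤-trans (ℕ.m≤n⇒m≤1+n (ℕ.m≤m+n _ _)) d≤) ,
    leaves⇒fits {v} {σ = σ} g (proj₂ le) (ℕ.≤-trans (ℕ.m≤n⇒m≤1+n (ℕ.m≤n+m _ (degree v f))) d≤) ,
    ℕ.≤-trans (eval-bound {v} {σ} e le) (^-mono 2≤N d≤)

fits⇒bound : ∀ {W σ} e → Fits W σ e → ∣ eval σ e ∣ ≤ W
fits⇒bound (con _)     b           = b
fits⇒bound (reg _)     b           = b
fits⇒bound (_ [ _ ])   (_ , b)     = b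
fits⇒bound (_ ⟨ _ ⟩ _) (_ , _ , b) = b

fits-mono : ∀ {W W′ σ} → W ≤ W′ → ∀ e → Fits W σ e → Fits W′ σ e
fits-mono le (con _)     b           = ℕ.≤-trans b le
fits-mono le (reg _)     b           = ℕ.≤-trans b le
fits-mono le (_ [ i ])   (f , b)     = fits-mono le i f , ℕ.≤-trans b le
fits-mono le (e ⟨ _ ⟩ f) (x , y , b) = fits-mono le e x , fits-mono le f y , ℕ.≤-trans b le

-- Memory updates, pointwise equality of states, residue classes

setArray-hit : ∀ a i v σ → array (setArray a i v σ) a i ≡ v
setArray-hit a i v σ
  rewrite dec-true (a ℕ.≟ a) refl | dec-true (i ℤ.≟ i) refl = refl

setArray-miss : ∀ a i v σ {b j} → b ≢ a ⊎ j ≢ i →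
                array (setArray a i v σ) b j ≡ array σ b j
setArray-miss a i v σ {b} {j} (inj₁ b≢a) rewrite dec-false (b ℕ.≟ a) b≢a = refl
setArray-miss a i v σ {b} {j} (inj₂ j≢i)
  rewrite dec-false (j ℤ.≟ i) j≢i | ∧-zeroʳ (does (b ℕ.≟ a)) = refl

if-elim : {A : Set} (P : A → Set) (b : Bool) {x y : A} → P x → P y → P (if b then x else y)
if-elim P true  px py = px
if-elim P false px py = py

setArray-small : ∀ {W σ} a i v → ∣ v ∣ ≤ W → Small W σ → Small W (setArray a i v σ)
setArray-small {W} a i v v≤ sm = register≤ sm , λ b j →
  if-elim (λ u → ∣ u ∣ ≤ W) (does (b ℕ.≟ a) ∧ does (j ℤ.≟ i)) v≤ (array≤ sm b j)

setRegister-small : ∀ {W σ} r v → ∣ v ∣ ≤ W → Small W σ → Small W (setRegister r v σ)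
setRegister-small {W} r v v≤ sm =
  (λ s → if-elim (λ u → ∣ u ∣ ≤ W) (does (s ℕ.≟ r)) v≤ (register≤ sm s)) , array≤ sm

i<j⇒0<j-i : ∀ {i j} → i ℤ.< j → 0ℤ ℤ.< j ℤ.- i
i<j⇒0<j-i i<j = ℤ.≰⇒> λ j-i≤0 → ℤ.<⇒≱ i<j (ℤ.i-j≤0⇒i≤j j-i≤0)

0<j-i⇒i<j : ∀ {i j} → 0ℤ ℤ.< j ℤ.- i → i ℤ.< j
0<j-i⇒i<j 0<j-i = ℤ.≰⇒> λ j≤i → ℤ.<⇒≱ 0<j-i (ℤ.i≤j⇒i-j≤0 j≤i)

infix 4 _≋_

record _≋_ (σ τ : State) : Set where
  constructor _,_
  field
    register≡ : ∀ r → register σ r ≡ register τ r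
    array≡    : ∀ a j → array σ a j ≡ array τ a j

open _≋_ public

∣i∣*n<n⇒i≡0 : ∀ i n → ∣ i ∣ * n < n → i ≡ 0ℤ
∣i∣*n<n⇒i≡0 i n lt with ∣ i ∣ in eq
... | zero  = ℤ.∣i∣≡0⇒i≡0 eq
... | suc k = contradiction lt (ℕ.≤⇒≯ (ℕ.m≤m+n n (k * n)))

-- The difference `m′ - m` is a multiple of `M` of magnitude below `M`, hence 0. This makes the
-- interleaved memory collision-free, both between calls and within one call; `j` is an integer
-- because simulated addresses may be negative.
residue-unique : ∀ {M m m′} j j′ → m < M → m′ < M →
                 j ℤ.* + M ℤ.+ + m ≡ j′ ℤ.* + M ℤ.+ + m′ → j ≡ j′ × m ≡ m′
residue-unique {M} {m} {m′} j j′ m<M m′<M eq = j≡j′ , m≡m′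
  where
  shift : (j ℤ.- j′) ℤ.* + M ≡ + m′ ℤ.- + m
  shift = begin
    (j ℤ.- j′) ℤ.* + M                                        ≡⟨ lhs j j′ (+ M) (+ m) ⟩
    (j ℤ.* + M ℤ.+ + m) ℤ.- (j′ ℤ.* + M) ℤ.- + m              ≡⟨ cong
      (λ z → z ℤ.- (j′ ℤ.* + M) ℤ.- + m) eq ⟩
    (j′ ℤ.* + M ℤ.+ + m′) ℤ.- (j′ ℤ.* + M) ℤ.- + m            ≡⟨ rhs (j′ ℤ.* + M) (+ m′) (+ m) ⟩
    + m′ ℤ.- + m                                              ∎
    where
    open ≡-Reasoning
    lhs : ∀ a b c d → (a ℤ.- b) ℤ.* c ≡ (a ℤ.* c ℤ.+ d) ℤ.- (b ℤ.* c) ℤ.- d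
    lhs = ℤ-solver.solve-∀
    rhs : ∀ a b c → (a ℤ.+ b) ℤ.- a ℤ.- c ≡ b ℤ.- c
    rhs = ℤ-solver.solve-∀
  j-j′≡0 : j ℤ.- j′ ≡ 0ℤ
  j-j′≡0 = ∣i∣*n<n⇒i≡0 (j ℤ.- j′) M (begin-strict
    ∣ j ℤ.- j′ ∣ * M         ≡⟨ sym (ℤ.abs-* (j ℤ.- j′) (+ M)) ⟩
    ∣ (j ℤ.- j′) ℤ.* + M ∣   ≡⟨ cong ∣_∣ (trans shift (ℤ.m-n≡m⊖n m′ m)) ⟩
    ∣ m′ ℤ.⊖ m ∣             ≤⟨ ℤ.∣m⊝n∣≤m⊔n m′ m ⟩
    m′ ⊔ m                   <⟨ ℕ.⊔-pres-<m m′<M m<M ⟩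
    M                        ∎)
    where open ℕ.≤-Reasoning
  j≡j′ : j ≡ j′
  j≡j′ = ℤ.i-j≡0⇒i≡j j j′ j-j′≡0
  m≡m′ : m ≡ m′
  m≡m′ = ℤ.+-injective (sym (ℤ.i-j≡0⇒i≡j (+ m′) (+ m)
           (trans (sym shift) (cong (ℤ._* + M) j-j′≡0))))

-- Running p in fresh memory, without ever erasing any: call number m < M
-- keeps register r in cell m of its own array, and cell j of an array in
-- cell j * M + m.  Registers 3 and 4 hold M and m.

module Simulation (K : ℕ) where

  -- Arrays up to `K` belong to the surrounding program. Beyond them, parity separates simulated
  -- registers from simulated arrays.
  regAt arrAt : ℕ → ℕ
  regAt r = suc K + 2 * r
  arrAt a = suc K + suc (2 * a)

  place : Exp → Exp
  place e = (e ⟨ mul ⟩ reg 3) ⟨ add ⟩ reg 4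

  simE : Exp → Exp
  simE (con z)     = con z
  simE (reg r)     = regAt r [ reg 4 ]
  simE (a [ e ])   = arrAt a [ place (simE e) ]
  simE (e ⟨ o ⟩ f) = simE e ⟨ o ⟩ simE f

  simC : Cmd → Cmd
  simC skip                   = skip
  simC (r ≔ e)                = regAt r [ reg 4 ]≔ simE e
  simC (a [ i ]≔ e)           = arrAt a [ place (simE i) ]≔ simE e
  simC (p ︔ q)                = simC p ︔ simC q
  simC (if>0 e then p else q) = if>0 simE e then simC p else simC q
  simC (while>0 e loop p)     = while>0 simE e loop simC p

  view : ℕ → ℕ → State → State
  view M m τ .register r = array τ (regAt r) (+ m)
  view M m τ .array a j  = array τ (arrAt a) (j ℤ.* + M ℤ.+ + m)

  regAt-injective : ∀ {r s} → regAt r ≡ regAt s → r ≡ s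
  regAt-injective eq = ℕ.*-cancelˡ-≡ _ _ 2 (ℕ.+-cancelˡ-≡ (suc K) _ _ eq)

  arrAt-injective : ∀ {a b} → arrAt a ≡ arrAt b → a ≡ b
  arrAt-injective eq = ℕ.*-cancelˡ-≡ _ _ 2 (ℕ.suc-injective (ℕ.+-cancelˡ-≡ (suc K) _ _ eq))

  regAt≢arrAt : ∀ {r a} → regAt r ≢ arrAt a
  regAt≢arrAt {r} {a} eq = ℕ.even≢odd r a (ℕ.+-cancelˡ-≡ (suc K) _ _ eq)

  ≤K⇒≢regAt : ∀ {b r} → b ≤ K → b ≢ regAt r
  ≤K⇒≢regAt b≤K refl = ℕ.m+1+n≰m K (subst (_≤ K) (sym (ℕ.+-suc K _)) b≤K)

  ≤K⇒≢arrAt : ∀ {b a} → b ≤ K → b ≢ arrAt a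
  ≤K⇒≢arrAt b≤K refl = ℕ.m+1+n≰m K (subst (_≤ K) (sym (ℕ.+-suc K _)) b≤K)

  -- What call `m` leaves alone. This protects the data of the surrounding program, and also the
  -- zeros in the residue classes that later calls take for their initial memory.
  record Frame (M m : ℕ) (τ τ′ : State) : Set where
    constructor _,_
    field
      registers : ∀ r → register τ′ r ≡ register τ r
      cells     : ∀ b i → b ≤ K ⊎ (∀ j → i ≢ j ℤ.* + M ℤ.+ + m) →
                  array τ′ b i ≡ array τ b i

  open Frame public

  frame-refl : ∀ {M m τ} → Frame M m τ τ
  frame-refl = (λ _ → refl) , λ _ _ _ → refl

  frame-trans : ∀ {M m τ τ′ τ″} → Frame M m τ τ′ → Frame M m τ′ τ″ → Frame M m τ τ″
  frame-trans f g = (λ r → trans (registers g r) (registers f r)) ,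
                    λ b i out → trans (cells g b i out) (cells f b i out)

  record Simulates (M m : ℕ) (τ σ : State) : Set where
    constructor simulates
    field
      M≡    : register τ 3 ≡ + M
      m≡    : register τ 4 ≡ + m
      view≋ : view M m τ ≋ σ

  open Simulates public

  frame-simulates : ∀ {M m τ τ′ σ σ′} → Simulates M m τ σ → Frame M m τ τ′ →
                    view M m τ′ ≋ σ′ → Simulates M m τ′ σ′
  frame-simulates s f v = simulates (trans (registers f 3) (M≡ s)) (trans (registers f 4) (m≡ s)) v

  module _ {M m : ℕ} (m<M : m < M) where

    private instance
      M≢0 : NonZero M
      M≢0 = >-nonZero (ℕ.≤-trans (s≤s z≤n) m<M)

    eval-place : ∀ {τ} e {j} → register τ 3 ≡ + M → register τ 4 ≡ + m →
                 eval τ e ≡ j → eval τ (place e) ≡ j ℤ.* + M ℤ.+ + m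
    eval-place e M≡ m≡ e≡ = cong₂ ℤ._+_ (cong₂ ℤ._*_ e≡ M≡) m≡

    simE-eval : ∀ {τ σ} → Simulates M m τ σ → ∀ e → eval τ (simE e) ≡ eval σ e
    simE-eval s (con z)             = refl
    simE-eval {τ} s (reg r)         = trans (cong (array τ (regAt r)) (m≡ s)) (register≡ (view≋ s) r)
    simE-eval {τ} {σ} s (a [ e ])   = trans
      (cong (array τ (arrAt a)) (eval-place (simE e) (M≡ s) (m≡ s) (simE-eval s e)))
      (array≡ (view≋ s) a (eval σ e))
    simE-eval s (e ⟨ o ⟩ f)         = cong₂ (apply o) (simE-eval s e) (simE-eval s f)

    module _ {W W′ : ℕ} (W≤W′ : W * M + M ≤ W′) where

      W≤ : W ≤ W′
      W≤ = ℕ.≤-trans (ℕ.m≤m*n W M) (ℕ.≤-trans (ℕ.m≤m+n (W * M) M) W≤W′)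

      M≤ : M ≤ W′
      M≤ = ℕ.≤-trans (ℕ.m≤n+m M (W * M)) W≤W′

      m≤ : ∀ {τ} → register τ 4 ≡ + m → ∣ register τ 4 ∣ ≤ W′
      m≤ eq = subst (λ z → ∣ z ∣ ≤ W′) (sym eq) (ℕ.≤-trans (ℕ.<⇒≤ m<M) M≤)

      -- An address of magnitude at most `W` is stretched to at most `W * M + m`; hence the
      -- assumption on `W′`.
      fits-place : ∀ {τ} e → register τ 3 ≡ + M → register τ 4 ≡ + m →
                   ∣ eval τ e ∣ ≤ W → Fits W′ τ e → Fits W′ τ (place e)
      fits-place {τ} e M≡ m≡ e≤ fits =
        (fits , subst (λ z → ∣ z ∣ ≤ W′) (sym M≡) M≤ ,
         ℕ.≤-trans (subst (_≤ W * M) (sym abs) (ℕ.*-monoˡ-≤ M e≤))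
                   (ℕ.≤-trans (ℕ.m≤m+n (W * M) M) W≤W′)) ,
        m≤ {τ} m≡ ,
        ℕ.≤-trans (ℤ.∣i+j∣≤∣i∣+∣j∣ (eval τ e ℤ.* register τ 3) (register τ 4))
          (ℕ.≤-trans (ℕ.+-mono-≤ (subst (_≤ W * M) (sym abs) (ℕ.*-monoˡ-≤ M e≤))
                                 (subst (λ z → ∣ z ∣ ≤ M) (sym m≡) (ℕ.<⇒≤ m<M)))
                     W≤W′)
        where
        abs : ∣ eval τ e ℤ.* register τ 3 ∣ ≡ ∣ eval τ e ∣ * M
        abs = trans (cong (λ z → ∣ eval τ e ℤ.* z ∣) M≡) (ℤ.abs-* (eval τ e) (+ M))

      simE-bound : ∀ {τ σ} → Simulates M m τ σ → ∀ e → Fits W σ e → ∣ eval τ (simE e) ∣ ≤ W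
      simE-bound s e fits = subst (λ z → ∣ z ∣ ≤ W) (sym (simE-eval s e)) (fits⇒bound e fits)

      simE-fits : ∀ {τ σ} → Simulates M m τ σ → ∀ e → Fits W σ e → Fits W′ τ (simE e)
      simE-fits s e@(con z) fits = ℕ.≤-trans fits W≤
      simE-fits {τ} s e@(reg r) fits = m≤ {τ} (m≡ s) , ℕ.≤-trans (simE-bound s e fits) W≤
      simE-fits s e@(a [ i ]) fits@(i-fits , _) =
        fits-place (simE i) (M≡ s) (m≡ s) (simE-bound s i i-fits) (simE-fits s i i-fits) ,
        ℕ.≤-trans (simE-bound s e fits) W≤
      simE-fits s e@(f ⟨ o ⟩ g) fits@(f-fits , g-fits , _) =
        simE-fits s f f-fits , simE-fits s g g-fits , ℕ.≤-trans (simE-bound s e fits) W≤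

    -- The worst case is an array access: `place` adds two operations and two registers, so the cost
    -- is `5 + c` instead of `1 + c`.
    simE-cost : ∀ e → cost (simE e) ≤ 5 * cost e
    simE-cost (con z)     = s≤s z≤n
    simE-cost (reg r)     = s≤s (s≤s z≤n)
    simE-cost (a [ e ])   = ℕ.≤-trans
      (ℕ.≤-reflexive (trans (count (cost (simE e))) refl))
      (subst (5 + cost (simE e) ≤_) (sym (ℕ.*-suc 5 (cost e))) (ℕ.+-monoʳ-≤ 5 (simE-cost e)))
      where
      count : ∀ c → 1 + (1 + (1 + c + 1) + 1) ≡ 5 + c
      count = ℕ-solver.solve-∀
    simE-cost (e ⟨ o ⟩ f) = ℕ.≤-trans
      (s≤s (ℕ.+-mono-≤ (simE-cost e) (simE-cost f)))
      (ℕ.≤-trans (ℕ.m≤n+m _ 4) (ℕ.≤-reflexive (count (cost e) (cost f))))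
      where
      count : ∀ c d → 4 + (1 + (5 * c + 5 * d)) ≡ 5 * (1 + c + d)
      count = ℕ-solver.solve-∀

    test-cost : ∀ e → 1 + cost (simE e) ≤ 5 * (1 + cost e)
    test-cost e = subst (1 + cost (simE e) ≤_) (sym (ℕ.*-suc 5 (cost e)))
                    (ℕ.+-mono-≤ (s≤s (z≤n {4})) (simE-cost e))

    write-register : ∀ {τ σ} r v → register τ 4 ≡ + m → view M m τ ≋ σ →
                     view M m (setArray (regAt r) (+ m) v τ) ≋ setRegister r v σ
    write-register {τ} {σ} r v m≡ τ≋σ = registers′ , arrays′
      where
      registers′ : ∀ s → array (setArray (regAt r) (+ m) v τ) (regAt s) (+ m) ≡ register
        (setRegister r v σ) s
      registers′ s with s ℕ.≟ r
      ... | yes refl rewrite dec-true (s ℕ.≟ s) refl = setArray-hit (regAt s) (+ m) v τ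
      ... | no s≢r rewrite dec-false (s ℕ.≟ r) s≢r = trans
        (setArray-miss (regAt r) (+ m) v τ (inj₁ (s≢r ∘ regAt-injective))) (register≡ τ≋σ s)
      arrays′ : ∀ a j → array (setArray (regAt r) (+ m) v τ) (arrAt a) (j ℤ.* + M ℤ.+ + m) ≡ array σ a j
      arrays′ a j = trans (setArray-miss (regAt r) (+ m) v τ (inj₁ (regAt≢arrAt {r} {a} ∘ sym)))
        (array≡ τ≋σ a j)

    write-array : ∀ {τ σ} a i v → view M m τ ≋ σ →
                  view M m (setArray (arrAt a) (i ℤ.* + M ℤ.+ + m) v τ) ≋ setArray a i v σ
    write-array {τ} {σ} a i v τ≋σ = registers′ , arrays′
      where
      k = i ℤ.* + M ℤ.+ + m
      registers′ : ∀ r → array (setArray (arrAt a) k v τ) (regAt r) (+ m) ≡ register σ r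
      registers′ r = trans (setArray-miss (arrAt a) k v τ (inj₁ (regAt≢arrAt {r} {a})))
        (register≡ τ≋σ r)
      arrays′ : ∀ b j → array (setArray (arrAt a) k v τ) (arrAt b) (j ℤ.* + M ℤ.+ + m) ≡ array
        (setArray a i v σ) b j
      arrays′ b j = go (b ℕ.≟ a) (j ℤ.≟ i)
        where
        miss : b ≢ a ⊎ j ≢ i → array (setArray (arrAt a) k v τ) (arrAt b)
          (j ℤ.* + M ℤ.+ + m) ≡ array (setArray a i v σ) b j
        miss ne = trans (setArray-miss (arrAt a) k v τ (out ne))
                        (trans (array≡ τ≋σ b j) (sym (setArray-miss a i v σ ne)))
          where
          out : b ≢ a ⊎ j ≢ i → arrAt b ≢ arrAt a ⊎ j ℤ.* + M ℤ.+ + m ≢ k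
          out (inj₁ b≢a) = inj₁ (b≢a ∘ arrAt-injective)
          out (inj₂ j≢i) = inj₂ (j≢i ∘ proj₁ ∘ residue-unique j i m<M m<M)
        go : Dec (b ≡ a) → Dec (j ≡ i) → array (setArray (arrAt a) k v τ) (arrAt b)
          (j ℤ.* + M ℤ.+ + m) ≡ array (setArray a i v σ) b j
        go (yes refl) (yes refl) = trans (setArray-hit (arrAt a) k v τ) (sym (setArray-hit a i v σ))
        go (no b≢a)   _          = miss (inj₁ b≢a)
        go (yes _)    (no j≢i)   = miss (inj₂ j≢i)

    frame-write : ∀ {τ} b j v → (∀ {c} → c ≤ K → c ≢ b) →
                  Frame M m τ (setArray b (j ℤ.* + M ℤ.+ + m) v τ)
    frame-write {τ} b j v high = (λ _ → refl) , λ where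
      c i (inj₁ c≤K) → setArray-miss b _ v τ (inj₁ (high c≤K))
      c i (inj₂ out) → setArray-miss b _ v τ (inj₂ (out j))

    frame-write-register : ∀ {τ} r v → Frame M m τ (setArray (regAt r) (+ m) v τ)
    -- Cell `m` is `0 * M + m`, so it lies in the residue class of call `m` as well.
    frame-write-register {τ} r v = subst (λ i → Frame M m τ (setArray (regAt r) i v τ))
      (ℤ.+-identityˡ (+ m)) (frame-write (regAt r) 0ℤ v (≤K⇒≢regAt {r = r}))

    module _ {W W′ V : ℕ} (W≤W′ : W * M + M ≤ W′) (W≤V : W ≤ V) where

      private
        Result : Cmd → State → State → ℕ → Set
        Result p τ σ′ t = ∃[ τ′ ] ∃[ t′ ] (W′ ⊢ simC p , τ ⇓ τ′ after t′) × t′ ≤ 5 * t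
                          × Simulates M m τ′ σ′ × Frame M m τ τ′ × Small V τ′

        test-fits : ∀ {τ σ} → Simulates M m τ σ → ∀ e → Fits W σ e → Fits W′ τ (simE e)
        test-fits = simE-fits W≤W′

      -- Addresses may grow up to `W′`, but everything stored is a value computed by the original
      -- program, hence at most `W`. So `W ≤ V` keeps the contents of memory below `V`.
      simulate : ∀ {p σ σ′ t τ} → W ⊢ p , σ ⇓ σ′ after t → Simulates M m τ σ → Small V τ →
                 Result p τ σ′ t
      simulate {τ = τ} ⇓skip s sm = τ , 1 , ⇓skip , s≤s z≤n , s , frame-refl , sm
      simulate {τ = τ} (⇓≔ {σ} {r} {e} fits) s sm =
        τ′ , _ , run , time , frame-simulates s frame view≋′ , frame ,
        setArray-small (regAt r) (+ m) v (subst (λ z → ∣ z ∣ ≤ V) (sym (simE-eval s e))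
          (ℕ.≤-trans (fits⇒bound e fits) W≤V)) sm
        where
        v  = eval τ (simE e)
        τ′ = setArray (regAt r) (+ m) v τ
        frame = frame-write-register {τ} r v
        view≋′ : view M m τ′ ≋ setRegister r (eval σ e) σ
        view≋′ = subst (λ z → view M m τ′ ≋ setRegister r z σ) (simE-eval s e)
                   (write-register {τ} {σ} r v (m≡ s) (view≋ s))
        run : W′ ⊢ simC (r ≔ e) , τ ⇓ τ′ after (2 + cost (simE e))
        run = subst (λ i → W′ ⊢ simC (r ≔ e) , τ ⇓ setArray (regAt r) i v τ after (2 + cost (simE e)))
                (m≡ s) (⇓[]≔ (m≤ {W} W≤W′ {τ} (m≡ s)) (test-fits s e fits))
        time : 2 + cost (simE e) ≤ 5 * (1 + cost e)
        time = subst (2 + cost (simE e) ≤_) (sym (ℕ.*-suc 5 (cost e)))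
                 (ℕ.+-mono-≤ (s≤s (s≤s (z≤n {3}))) (simE-cost e))
      simulate {τ = τ} (⇓[]≔ {σ} {a} {i} {e} i-fits fits) s sm =
        τ′ , _ , run , time , frame-simulates s frame view≋′ , frame ,
        setArray-small (arrAt a) k v (subst (λ z → ∣ z ∣ ≤ V) (sym (simE-eval s e))
          (ℕ.≤-trans (fits⇒bound e fits) W≤V)) sm
        where
        v  = eval τ (simE e)
        k  = eval σ i ℤ.* + M ℤ.+ + m
        τ′ = setArray (arrAt a) k v τ
        frame = frame-write {τ} (arrAt a) (eval σ i) v (≤K⇒≢arrAt {a = a})
        view≋′ : view M m τ′ ≋ setArray a (eval σ i) (eval σ e) σ
        view≋′ = subst (λ z → view M m τ′ ≋ setArray a (eval σ i) z σ) (simE-eval s e)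
                   (write-array {τ} {σ} a (eval σ i) v (view≋ s))
        run : W′ ⊢ simC (a [ i ]≔ e) , τ ⇓ τ′ after (1 + cost (place (simE i)) + cost (simE e))
        run = subst (λ j → W′ ⊢ simC (a [ i ]≔ e) , τ ⇓ setArray (arrAt a) j v τ
                             after (1 + cost (place (simE i)) + cost (simE e)))
                (eval-place (simE i) (M≡ s) (m≡ s) (simE-eval s i))
                (⇓[]≔ (fits-place W≤W′ (simE i) (M≡ s) (m≡ s) (simE-bound W≤W′ s i i-fits)
                  (test-fits s i i-fits))
                      (test-fits s e fits))
        time : 1 + cost (place (simE i)) + cost (simE e) ≤ 5 * (1 + cost i + cost e)
        time = begin
          1 + cost (place (simE i)) + cost (simE e) ≡⟨ count₁ (cost (simE i)) (cost (simE e)) ⟩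
          5 + (cost (simE i) + cost (simE e))       ≤⟨ ℕ.+-monoʳ-≤ 5
            (ℕ.+-mono-≤ (simE-cost i) (simE-cost e)) ⟩
          5 + (5 * cost i + 5 * cost e)             ≡⟨ count₂ (cost i) (cost e) ⟩
          5 * (1 + cost i + cost e)                 ∎
          where
          open ℕ.≤-Reasoning
          count₁ : ∀ c d → 1 + (1 + (1 + c + 1) + 1) + d ≡ 5 + (c + d)
          count₁ = ℕ-solver.solve-∀
          count₂ : ∀ c d → 5 + (5 * c + 5 * d) ≡ 5 * (1 + c + d)
          count₂ = ℕ-solver.solve-∀
      simulate (⇓︔ {s = s₁} {t = t₁} d d′) s sm
        with τ′ , t′ , run , time , s′ , f , sm′ ← simulate d s sm
        with τ″ , t″ , run′ , time′ , s″ , f′ , sm″ ← simulate d′ s′ sm′ =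
        τ″ , t′ + t″ , ⇓︔ run run′ ,
        subst (t′ + t″ ≤_) (sym (ℕ.*-distribˡ-+ 5 s₁ t₁)) (ℕ.+-mono-≤ time time′) ,
        s″ , frame-trans f f′ , sm″
      simulate (⇓then {e = e} {t = t₁} fits pos d) s sm
        with τ′ , t′ , run , time , s′ , f , sm′ ← simulate d s sm =
        τ′ , _ , ⇓then (test-fits s e fits) (subst (0ℤ ℤ.<_) (sym (simE-eval s e)) pos) run ,
        subst (1 + cost (simE e) + t′ ≤_) (sym (ℕ.*-distribˡ-+ 5 (1 + cost e) t₁))
          (ℕ.+-mono-≤ (test-cost e) time) ,
        s′ , f , sm′
      simulate (⇓else {e = e} {t = t₁} fits neg d) s sm
        with τ′ , t′ , run , time , s′ , f , sm′ ← simulate d s sm =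
        τ′ , _ , ⇓else (test-fits s e fits) (subst (ℤ._≤ 0ℤ) (sym (simE-eval s e)) neg) run ,
        subst (1 + cost (simE e) + t′ ≤_) (sym (ℕ.*-distribˡ-+ 5 (1 + cost e) t₁))
          (ℕ.+-mono-≤ (test-cost e) time) ,
        s′ , f , sm′
      simulate {τ = τ} (⇓stop {e = e} fits neg) s sm =
        τ , _ , ⇓stop (test-fits s e fits) (subst (ℤ._≤ 0ℤ) (sym (simE-eval s e)) neg) ,
        test-cost e , s , frame-refl , sm
      simulate (⇓loop {e = e} {s = s₁} {t = t₁} fits pos d d′) s sm
        with τ′ , t′ , run , time , s′ , f , sm′ ← simulate d s sm
        with τ″ , t″ , run′ , time′ , s″ , f′ , sm″ ← simulate d′ s′ sm′ =
        τ″ , _ , ⇓loop (test-fits s e fits) (subst (0ℤ ℤ.<_) (sym (simE-eval s e)) pos) run run′ ,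
        subst (1 + cost (simE e) + t′ + t″ ≤_) (sym (trans (ℕ.*-distribˡ-+ 5 (1 + cost e + s₁) t₁)
                            (cong (_+ 5 * t₁) (ℕ.*-distribˡ-+ 5 (1 + cost e) s₁))))
          (ℕ.+-mono-≤ (ℕ.+-mono-≤ (test-cost e) time) time′) ,
        s″ , frame-trans f f′ , sm″

-- Total correctness with a time bound

-- Sums take the place of maxima, so that a bound on the whole command projects to its parts. A loop
-- counts its body once, whatever the number of iterations, since every iteration starts again from
-- memory bounded by `N ^ v`.
degreeC : ℕ → Cmd → ℕ
degreeC v skip                   = 0
degreeC v (r ≔ e)                = degree v e
degreeC v (a [ i ]≔ e)           = degree v i + degree v e
degreeC v (p ︔ q)                = degreeC v p + degreeC v q
degreeC v (if>0 e then p else q) = degree v e + (degreeC v p + degreeC v q)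
degreeC v (while>0 e loop p)     = degree v e + degreeC v p

-- Timed will say that n is at least a threshold, below which no time bound is known.
module Logic {N : ℕ} (2≤N : 2 ≤ N) (Timed : Set) (v w : ℕ) where

  -- Two exponents are kept apart: stored values stay below `N ^ v`, intermediate ones below
  -- `N ^ w`. Re-establishing the former after every command keeps bounds from growing along loops.
  -- The derivation and the postcondition do not wait for `Timed`, only the time bound does.
  record Run (p : Cmd) (σ : State) (t : ℕ) (Q : State → Set) : Set where
    constructor ran
    field
      {final}    : State
      {steps}    : ℕ
      derivation : N ^ w ⊢ p , σ ⇓ final after steps
      steps≤     : Timed → steps ≤ t
      small      : Small (N ^ v) final
      post       : Q final

  fits : ∀ {σ} e → degree v e ≤ w → Small (N ^ v) σ → Fits (N ^ w) σ e
  fits {σ} e d sm = leaves⇒fits 2≤N {v} {w} {σ} e (small⇒leaves sm e) d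

  run-mono : ∀ {p σ t t′ Q Q′} → t ≤ t′ → (∀ {τ} → Q τ → Q′ τ) → Run p σ t Q → Run p σ t′ Q′
  run-mono t≤t′ Q⇒Q′ (ran d s≤t sm q) = ran d (λ τ → ℕ.≤-trans (s≤t τ) t≤t′) sm (Q⇒Q′ q)

  run-skip : ∀ {σ Q} → Small (N ^ v) σ → Q σ → Run skip σ 1 Q
  run-skip sm q = ran ⇓skip (λ _ → ℕ.≤-refl) sm q

  run-≔ : ∀ {σ Q r e} z → degree v e ≤ w → Small (N ^ v) σ → eval σ e ≡ z → ∣ z ∣ ≤ N ^ v →
          Q (setRegister r z σ) → Run (r ≔ e) σ (1 + cost e) Q
  run-≔ {r = r} {e} _ d sm refl z≤ q =
    ran (⇓≔ (fits e d sm)) (λ _ → ℕ.≤-refl) (setRegister-small r _ z≤ sm) q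

  run-[]≔ : ∀ {σ Q a i e} j z → degree v i + degree v e ≤ w → Small (N ^ v) σ →
            eval σ i ≡ j → eval σ e ≡ z → ∣ z ∣ ≤ N ^ v →
            Q (setArray a j z σ) → Run (a [ i ]≔ e) σ (1 + cost i + cost e) Q
  run-[]≔ {a = a} {i} {e} _ _ d sm refl refl z≤ q =
    ran (⇓[]≔ (fits i (ℕ.m+n≤o⇒m≤o (degree v i) d) sm) (fits e (ℕ.m+n≤o⇒n≤o (degree v i) d) sm))
        (λ _ → ℕ.≤-refl) (setArray-small a _ _ z≤ sm) q

  run-︔ : ∀ {p q σ s t R Q} → Run p σ s R →
          (∀ {τ} → Small (N ^ v) τ → R τ → Run q τ t Q) → Run (p ︔ q) σ (s + t) Q
  run-︔ (ran d s≤ sm r) f with ran d′ t≤ sm′ q ← f sm r =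
    ran (⇓︔ d d′) (λ τ → ℕ.+-mono-≤ (s≤ τ) (t≤ τ)) sm′ q

  run-if : ∀ {p q e σ t Q} → degree v e ≤ w → Small (N ^ v) σ →
           (0ℤ ℤ.< eval σ e → Run p σ t Q) → (eval σ e ℤ.≤ 0ℤ → Run q σ t Q) →
           Run (if>0 e then p else q) σ (1 + cost e + t) Q
  run-if {e = e} {σ} deg sm f g with 0ℤ ℤ.<? eval σ e
  ... | yes pos with ran d t≤ sm′ q ← f pos =
    ran (⇓then (fits e deg sm) pos d) (λ τ → ℕ.+-monoʳ-≤ (1 + cost e) (t≤ τ)) sm′ q
  ... | no ¬pos with ran d t≤ sm′ q ← g (ℤ.≮⇒≥ ¬pos) =
    ran (⇓else (fits e deg sm) (ℤ.≮⇒≥ ¬pos) d) (λ τ → ℕ.+-monoʳ-≤ (1 + cost e) (t≤ τ)) sm′ q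

  -- The index of the invariant is the number of iterations still to come, so it serves both as
  -- termination measure and as the factor in the time bound.
  run-while : ∀ {p e t} (I : ℕ → State → Set) → degree v e ≤ w →
              (∀ {j σ} → Small (N ^ v) σ → I (suc j) σ → 0ℤ ℤ.< eval σ e × Run p σ t (I j)) →
              (∀ {σ} → I 0 σ → eval σ e ℤ.≤ 0ℤ) →
              ∀ j {σ} → Small (N ^ v) σ → I j σ →
              Run (while>0 e loop p) σ (1 + cost e + j * (1 + cost e + t)) (I 0)
  run-while {e = e} I deg step stop zero sm i =
    ran (⇓stop (fits e deg sm) (stop i)) (λ _ → ℕ.m≤m+n _ 0) sm i
  run-while {e = e} {t} I deg step stop (suc j) sm i
    with pos , ran d s≤ sm′ i′ ← step sm i
    with ran d′ t≤ sm″ i″ ← run-while {t = t} I deg step stop j sm′ i′ =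
    ran (⇓loop (fits e deg sm) pos d d′)
        (λ τ → ℕ.≤-trans (ℕ.+-mono-≤ (ℕ.+-monoʳ-≤ (1 + cost e) (s≤ τ)) (t≤ τ))
                   (ℕ.≤-reflexive (shift (1 + cost e + t) (1 + cost e) (j * (1 + cost e + t)))))
        sm″ i″
    where
    shift : ∀ a b c → a + (b + c) ≡ b + (a + c)
    shift = ℕ-solver.solve-∀

-- k-SUM on families of injective functions

sumInstance : ∀ {k n} (f : Fin k → Fin n → ℤ) →
              (∀ i {s t} → f i s ≡ f i t → s ≡ t) → SumInstance k
sumInstance {n = n} f inj = record
  { n      = n
  ; A      = λ i → record { elements = List.tabulate (f i) ; unique = Unique.tabulate⁺ (inj i) }
  ; card≡n = λ i → List.length-tabulate (f i)
  }

nth-tabulate-cong : ∀ {A : Set} {z : A} {n} (f g : Fin n → A) t → (∀ s → toℕ s ≡ t → f s ≡ g s) →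
                    nth z (List.tabulate f) t ≡ nth z (List.tabulate g) t
nth-tabulate-cong {n = zero}  f g t       eq = refl
nth-tabulate-cong {n = suc n} f g zero    eq = eq zero refl
nth-tabulate-cong {n = suc n} f g (suc t) eq =
  nth-tabulate-cong (f ∘ suc) (g ∘ suc) t λ s s≡t → eq (suc s) (cong suc s≡t)

sum-pos : ∀ {k} (a : Fin (suc k) → ℤ) → (∀ i → 0ℤ ℤ.< a i) → 0ℤ ℤ.< sum a
sum-pos {zero}  a pos = subst (0ℤ ℤ.<_) (sym (ℤ.+-identityʳ (a zero))) (pos zero)
sum-pos {suc k} a pos = ℤ.+-mono-< (pos zero) (sum-pos (a ∘ suc) (pos ∘ suc))

sum-ones : ∀ k → sum {k} (λ _ → 1ℤ) ≡ + k
sum-ones zero    = refl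
sum-ones (suc k) = cong (λ z → 1ℤ ℤ.+ z) (sum-ones k)

-- A run that does not read some cell cannot depend on it

record Agree (j : ℤ) (σ τ : State) : Set where
  constructor _,_
  field
    registers : ∀ r → register τ r ≡ register σ r
    arrays    : ∀ a i → i ≢ j → array τ a i ≡ array σ a i

-- Only addresses are recorded, not the arrays. This matches `Agree j`, which lets cell `j` differ
-- in every array at once.
readsE : State → Exp → List ℤ
readsE σ (con z)     = []
readsE σ (reg r)     = []
readsE σ (a [ e ])   = eval σ e ∷ readsE σ e
readsE σ (e ⟨ o ⟩ f) = readsE σ e ++ readsE σ f

reads : ∀ {W p σ τ t} → W ⊢ p , σ ⇓ τ after t → List ℤ
reads ⇓skip                                = []
reads {σ = σ} (⇓≔ {e = e} _)               = readsE σ e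
reads {σ = σ} (⇓[]≔ {i = i} {e = e} _ _)   = readsE σ i ++ readsE σ e
reads (⇓︔ d d′)                            = reads d ++ reads d′
reads {σ = σ} (⇓then {e = e} _ _ d)        = readsE σ e ++ reads d
reads {σ = σ} (⇓else {e = e} _ _ d)        = readsE σ e ++ reads d
reads {σ = σ} (⇓stop {e = e} _ _)          = readsE σ e
reads {σ = σ} (⇓loop {e = e} _ _ d d′)     = (readsE σ e ++ reads d) ++ reads d′

length-++-≤ : ∀ {A : Set} {m n} (xs ys : List A) → length xs ≤ m → length ys ≤ n →
              length (xs ++ ys) ≤ m + n
length-++-≤ {m = m} {n} xs ys p q =
  subst (_≤ m + n) (sym (List.length-++ xs)) (ℕ.+-mono-≤ p q)

readsE≤cost : ∀ {σ} e → length (readsE σ e) ≤ cost e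
readsE≤cost (con z)     = z≤n
readsE≤cost (reg r)     = z≤n
readsE≤cost (a [ e ])   = s≤s (readsE≤cost e)
readsE≤cost {σ} (e ⟨ o ⟩ f) =
  ℕ.m≤n⇒m≤1+n (length-++-≤ (readsE σ e) (readsE σ f) (readsE≤cost e) (readsE≤cost f))

reads≤time : ∀ {W p σ τ t} (d : W ⊢ p , σ ⇓ τ after t) → length (reads d) ≤ t
reads≤time ⇓skip                                = z≤n
reads≤time (⇓≔ {e = e} _)                       = ℕ.m≤n⇒m≤1+n (readsE≤cost e)
reads≤time {σ = σ} (⇓[]≔ {i = i} {e = e} _ _)   =
  ℕ.m≤n⇒m≤1+n (length-++-≤ (readsE σ i) (readsE σ e) (readsE≤cost i) (readsE≤cost e))
reads≤time (⇓︔ d d′)                            =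
  length-++-≤ (reads d) (reads d′) (reads≤time d) (reads≤time d′)
reads≤time {σ = σ} (⇓then {e = e} _ _ d)        =
  ℕ.m≤n⇒m≤1+n (length-++-≤ (readsE σ e) (reads d) (readsE≤cost e) (reads≤time d))
reads≤time {σ = σ} (⇓else {e = e} _ _ d)        =
  ℕ.m≤n⇒m≤1+n (length-++-≤ (readsE σ e) (reads d) (readsE≤cost e) (reads≤time d))
reads≤time (⇓stop {e = e} _ _)                  = ℕ.m≤n⇒m≤1+n (readsE≤cost e)
reads≤time {σ = σ} (⇓loop {e = e} _ _ d d′)     =
  ℕ.m≤n⇒m≤1+n (length-++-≤ (readsE σ e ++ reads d) (reads d′)
    (length-++-≤ (readsE σ e) (reads d) (readsE≤cost e) (reads≤time d)) (reads≤time d′))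

module _ {j : ℤ} where

  agree-eval : ∀ {σ τ} → Agree j σ τ → ∀ e → j ∉ readsE σ e → eval τ e ≡ eval σ e
  agree-eval g (con z)               j∉ = refl
  agree-eval g (reg r)               j∉ = Agree.registers g r
  agree-eval {σ} {τ} g (a [ e ])     j∉ = trans
    (cong (array τ a) (agree-eval g e (j∉ ∘ there)))
    (Agree.arrays g a (eval σ e) (j∉ ∘ here ∘ sym))
  agree-eval {σ} g (e ⟨ o ⟩ f)       j∉ = cong₂ (apply o)
    (agree-eval g e (j∉ ∘ ∈-++⁺ˡ)) (agree-eval g f (j∉ ∘ ∈-++⁺ʳ (readsE σ e)))

  agree-setRegister : ∀ {σ τ} r {u v} → u ≡ v → Agree j σ τ →
                      Agree j (setRegister r v σ) (setRegister r u τ)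
  agree-setRegister r {v = v} refl (regs , arrs) =
    (λ s → cong (if does (s ℕ.≟ r) then v else_) (regs s)) , arrs

  agree-setArray : ∀ {σ τ} a {i i′ u v} → i′ ≡ i → u ≡ v → Agree j σ τ →
                   Agree j (setArray a i v σ) (setArray a i′ u τ)
  agree-setArray a {i} {v = v} refl refl (regs , arrs) =
    regs , λ b l l≢j → cong (if does (b ℕ.≟ a) ∧ does (l ℤ.≟ i) then v else_) (arrs b l l≢j)

  -- As all tests evaluate alike, both runs take the same branches and the mixed cases are absurd.
  -- The second run is given, since the program is known to halt on both inputs.
  agree-run : ∀ {W p σ τ t σ′ τ′ t′} (d : W ⊢ p , σ ⇓ τ after t) → j ∉ reads d →
              Agree j σ σ′ → W ⊢ p , σ′ ⇓ τ′ after t′ → Agree j τ τ′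
  agree-run ⇓skip j∉ g ⇓skip = g
  agree-run (⇓≔ {r = r} {e} _) j∉ g (⇓≔ _) = agree-setRegister r (agree-eval g e j∉) g
  agree-run {σ = σ} (⇓[]≔ {a = a} {i} {e} _ _) j∉ g (⇓[]≔ _ _) =
    agree-setArray a (agree-eval g i (j∉ ∘ ∈-++⁺ˡ)) (agree-eval g e (j∉ ∘ ∈-++⁺ʳ (readsE σ i))) g
  agree-run (⇓︔ d d₂) j∉ g (⇓︔ d′ d₂′) =
    agree-run d₂ (j∉ ∘ ∈-++⁺ʳ (reads d)) (agree-run d (j∉ ∘ ∈-++⁺ˡ) g d′) d₂′
  agree-run {σ = σ} (⇓then {e = e} _ _ d) j∉ g (⇓then _ _ d′) =
    agree-run d (j∉ ∘ ∈-++⁺ʳ (readsE σ e)) g d′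
  agree-run {σ = σ} (⇓then {e = e} _ pos d) j∉ g (⇓else _ neg d′) =
    contradiction pos (ℤ.≤⇒≯ (subst (ℤ._≤ 0ℤ) (agree-eval g e (j∉ ∘ ∈-++⁺ˡ)) neg))
  agree-run {σ = σ} (⇓else {e = e} _ neg d) j∉ g (⇓then _ pos d′) =
    contradiction (subst (0ℤ ℤ.<_) (agree-eval g e (j∉ ∘ ∈-++⁺ˡ)) pos) (ℤ.≤⇒≯ neg)
  agree-run {σ = σ} (⇓else {e = e} _ _ d) j∉ g (⇓else _ _ d′) =
    agree-run d (j∉ ∘ ∈-++⁺ʳ (readsE σ e)) g d′
  agree-run (⇓stop _ _) j∉ g (⇓stop _ _) = g
  agree-run (⇓stop {e = e} _ neg) j∉ g (⇓loop _ pos _ _) =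
    contradiction (subst (0ℤ ℤ.<_) (agree-eval g e j∉) pos) (ℤ.≤⇒≯ neg)
  agree-run {σ = σ} (⇓loop {e = e} _ pos d d₂) j∉ g (⇓stop _ neg) =
    contradiction pos (ℤ.≤⇒≯ (subst (ℤ._≤ 0ℤ) (agree-eval g e (j∉ ∘ ∈-++⁺ˡ ∘ ∈-++⁺ˡ)) neg))
  agree-run {σ = σ} (⇓loop {e = e} _ _ d d₂) j∉ g (⇓loop _ _ d′ d₂′) =
    agree-run d₂ (j∉ ∘ ∈-++⁺ʳ (readsE σ e ++ reads d))
      (agree-run d (j∉ ∘ ∈-++⁺ˡ ∘ ∈-++⁺ʳ (readsE σ e)) g d′) d₂′

-- Pigeonhole: if every position below `n` occurred in `xs`, the indices of the occurrences would
-- inject `Fin n` into `Fin (length xs)`.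
unread : ∀ n (xs : List ℤ) → length xs < n → ∃[ j ] + toℕ {n} j ∉ xs
unread n xs short = ¬∀⟶∃¬ n (λ j → + toℕ j ∈ xs) (λ j → + toℕ j ∈? xs) λ all →
  ℕ.<⇒≱ short (injective⇒≤ {f = λ j → Any.index (all j)} λ {i} {j} eq →
    toℕ-injective (ℤ.+-injective (trans (Any.lookup-index (all i))
      (trans (cong (List.lookup xs) eq) (sym (Any.lookup-index (all j)))))))
  where open DecMembership ℤ._≟_ using (_∈?_)

-- With A₁ = ⋯ = A_k = {1,…,n} there is no solution, but replacing any element
-- of A₁ by 1 - k creates one; so every element of A₁ has to be read.

module _ (k n : ℕ) where

  private
    positive : Fin (2 + k) → Fin n → ℤ
    positive _ t = + suc (toℕ t)

    positive-injective : ∀ i {s t} → positive i s ≡ positive i t → s ≡ t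
    positive-injective _ eq = toℕ-injective (ℕ.suc-injective (ℤ.+-injective eq))

    planted : Fin n → Fin (2 + k) → Fin n → ℤ
    planted j zero    t = if does (t Fin.≟ j) then -[1+ k ] else + suc (toℕ t)
    planted j (suc i) t = + suc (toℕ t)

    planted-injective : ∀ j i {s t} → planted j i s ≡ planted j i t → s ≡ t
    planted-injective j (suc i) eq = positive-injective zero eq
    planted-injective j zero {s} {t} eq with s Fin.≟ j | t Fin.≟ j
    ... | yes refl | yes refl = refl
    ... | no _     | no _     = positive-injective zero eq

    unplanted : SumInstance (2 + k)
    unplanted = sumInstance positive positive-injective

    plant : Fin n → SumInstance (2 + k)
    plant j = sumInstance (planted j) (planted-injective j)

    positive≤ : ∀ t → suc (toℕ {n} t) ≤ n ^ 1
    positive≤ t = subst (suc (toℕ t) ≤_) (sym (ℕ.*-identityʳ n)) (toℕ<n t)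

    -- The universe exponent is 1, so the planted element `-[1+ k ]` is admissible only for large
    -- enough `n`; this is the source of the assumption `suc k ≤ n`.
    planted≤ : suc k ≤ n → ∀ j i t → ∣ planted j i t ∣ ≤ n ^ 1
    planted≤ k<n j zero t with t Fin.≟ j
    ... | yes _ = subst (suc k ≤_) (sym (ℕ.*-identityʳ n)) k<n
    ... | no _  = positive≤ t
    planted≤ k<n j (suc i) t = positive≤ t

    unplanted-no : ¬ Problem.Yes (kSUM (2 + k)) unplanted
    unplanted-no (a , a∈ , sum≡0) = ℤ.<-irrefl (sym sum≡0) (sum-pos a λ i → pos i)
      where
      pos : ∀ i → 0ℤ ℤ.< a i
      pos i with _ , eq ← ∈-tabulate⁻ (a∈ i) rewrite eq = ℤ.+<+ (s≤s z≤n)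

    plant-yes : ∀ j → Problem.Yes (kSUM (2 + k)) (plant j)
    plant-yes j = a , a∈ , a-sum
      where
      a : Fin (2 + k) → ℤ
      a zero    = -[1+ k ]
      a (suc _) = 1ℤ
      -- The index `j` of the planted element shows that the other sets are nonempty, so they
      -- contain 1.
      one∈ : ∀ {m} → Fin m → 1ℤ ∈ List.tabulate {n = m} (λ t → + suc (toℕ t))
      one∈ zero    = here refl
      one∈ (suc _) = here refl
      a∈ : ∀ i → a i ∈ List.tabulate (planted j i)
      a∈ zero    = subst (_∈ List.tabulate (planted j zero))
        (cong (if_then -[1+ k ] else + suc (toℕ j)) (dec-true (j Fin.≟ j) refl))
        (∈-tabulate⁺ {f = planted j zero} j)
      a∈ (suc i) = one∈ j
      a-sum : sum a ≡ 0ℤ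
      a-sum = trans (cong (λ z → -[1+ k ] ℤ.+ z) (sum-ones (suc k))) (ℤ.+-inverseˡ (+ suc k))

    plant-agree : ∀ j → Agree (+ toℕ j) (Problem.input (kSUM (2 + k)) unplanted)
                                        (Problem.input (kSUM (2 + k)) (plant j))
    plant-agree j = (λ _ → refl) , cells
      where
      cells : ∀ a i → i ≢ + toℕ j → array (Problem.input (kSUM (2 + k)) (plant j)) a i
                                  ≡ array (Problem.input (kSUM (2 + k)) unplanted) a i
      cells (suc a) i        i≢j = refl
      cells zero    -[1+ _ ] i≢j = refl
      cells zero    (+ t)    i≢j = nth-tabulate-cong (planted j zero) (positive zero) t λ s s≡t →
        cong (if_then -[1+ k ] else + suc (toℕ s))
          (dec-false (s Fin.≟ j) λ s≡j → i≢j (cong +_ (trans (sym s≡t) (cong toℕ s≡j))))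

  reads-all : ∀ {p W b} → suc k ≤ n →
    (∀ (x : SumInstance (2 + k)) → SumInstance.n x ≡ n → Problem.Within (kSUM (2 + k)) x (n ^ 1) →
     ∃[ σ ] ∃[ t ] W ⊢ p , Problem.input (kSUM (2 + k)) x ⇓ σ after t
       × Answers (Problem.Yes (kSUM (2 + k)) x) σ × t ≤ b) →
    n ≤ b
  reads-all k<n solve
    with σ , t , d , answer , t≤b ← solve unplanted refl (λ i → All.tabulate⁺ positive≤)
    with n ℕ.≤? t
  ... | yes n≤t = ℕ.≤-trans n≤t t≤b
  ... | no n≰t
    with j , j∉ ← unread n (reads d) (ℕ.≤-<-trans (reads≤time d) (ℕ.≰⇒> n≰t))
    with σ′ , t′ , d′ , answer′ , _ ← solve (plant j) refl (λ i → All.tabulate⁺ (planted≤ k<n j i)) =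
    ⊥-elim (clash answer answer′)
    where
    clash : Answers (Problem.Yes (kSUM (2 + k)) unplanted) σ →
            Answers (Problem.Yes (kSUM (2 + k)) (plant j)) σ′ → ⊥
    clash (inj₁ (_ , yes-)) _                   = unplanted-no yes-
    clash _                 (inj₂ (_ , no-))    = no- (plant-yes j)
    clash (inj₂ (σ₀≡0 , _)) (inj₁ (σ₀′≡1 , _))  =
      contradiction (trans (sym σ₀′≡1)
        (trans (Agree.registers (agree-run d j∉ (plant-agree j) d′) 0) σ₀≡0)) λ ()

-- Lets the linear work of writing down an instance be charged to the k-SUM call itself. Any
-- universe exponent large enough for the adversary's instances would do; 1 is enough.
kSUM-linear : ∀ k T → SolvableIn (kSUM (2 + k)) T → ∃[ C ] ∃[ n₀ ] (∀ n → n₀ ≤ n → n ≤ C * T n)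
kSUM-linear k T solvable with p , w , C , n₀ , solve ← solvable 1 =
  C , n₀ + suc k , λ n n₀≤n → reads-all k n {p} {(n + 2) ^ w} (ℕ.m+n≤o⇒n≤o n₀ n₀≤n) λ where
    x refl within → let σ , t , d , answer , time = solve x within in
      σ , t , d , answer , time (ℕ.m+n≤o⇒m≤o n₀ n₀≤n)

-- From the universe n ^ c to (n + 2) ^ c, which is large also for n ≤ 1

weaken : ∀ {W W′ p σ τ t} → W ≤ W′ → W ⊢ p , σ ⇓ τ after t → W′ ⊢ p , σ ⇓ τ after t
weaken le ⇓skip                         = ⇓skip
weaken le (⇓≔ {e = e} f)                = ⇓≔ (fits-mono le e f)
weaken le (⇓[]≔ {i = i} {e = e} f g)    = ⇓[]≔ (fits-mono le i f) (fits-mono le e g)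
weaken le (⇓︔ d d′)                     = ⇓︔ (weaken le d) (weaken le d′)
weaken le (⇓then {e = e} f pos d)       = ⇓then (fits-mono le e f) pos (weaken le d)
weaken le (⇓else {e = e} f neg d)       = ⇓else (fits-mono le e f) neg (weaken le d)
weaken le (⇓stop {e = e} f neg)         = ⇓stop (fits-mono le e f) neg
weaken le (⇓loop {e = e} f pos d d′)    = ⇓loop (fits-mono le e f) pos (weaken le d) (weaken le d′)

nth-tabulate : ∀ {A : Set} {z : A} {n} (f : Fin n → A) i → nth z (List.tabulate f) (toℕ i) ≡ f i
nth-tabulate f zero    = refl
nth-tabulate f (suc i) = nth-tabulate (f ∘ suc) i

nth-all : ∀ {A : Set} {P : A → Set} {z xs} → P z → All P xs → ∀ n → P (nth z xs n)
nth-all pz []         n       = pz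
nth-all pz (px ∷ pxs) zero    = px
nth-all pz (px ∷ pxs) (suc n) = nth-all pz pxs n

contents-all : ∀ {P : ℤ → Set} {xs} → P 0ℤ → All P xs → ∀ j → P (contents xs j)
contents-all p0 pxs (+ n)    = nth-all p0 pxs n
contents-all p0 pxs -[1+ _ ] = p0

load-small : ∀ {W rs as} → All (λ z → ∣ z ∣ ≤ W) rs → All (All (λ z → ∣ z ∣ ≤ W)) as →
             Small W (load rs as)
load-small rs≤ as≤ = nth-all z≤n rs≤ , λ a → contents-all z≤n (nth-all [] as≤ a)

module _ {k : ℕ} (x : SumInstance k) where

  open SumInstance x

  input-array : ∀ i j → array (Problem.input (kSUM k) x) (toℕ i) j ≡ contents (elements (A i)) j
  input-array i j = cong (λ xs → contents xs j) (nth-tabulate (elements ∘ A) i)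

  sumInput-small : ∀ {W} → n ≤ W → Problem.Within (kSUM k) x W → Small W (Problem.input (kSUM k) x)
  sumInput-small n≤W within = load-small (n≤W ∷ []) (All.tabulate⁺ within)

sumE : ℕ → ℕ → Exp
sumE zero    a = con 0ℤ
sumE (suc k) a = (a [ con 0ℤ ]) ⟨ add ⟩ sumE k (suc a)

eval-sumE : ∀ {σ} k a → eval σ (sumE k a) ≡ sum {k} (λ i → array σ (toℕ i + a) 0ℤ)
eval-sumE zero    a = refl
eval-sumE {σ} (suc k) a = cong (λ z → array σ a 0ℤ ℤ.+ z) (trans (eval-sumE {σ} k (suc a))
  (sum-cong-≗ {k} λ i → cong (λ b → array σ b 0ℤ) (ℕ.+-suc (toℕ i) a)))

isZero : Exp → Cmd
isZero e = if>0 e then (0 ≔ con 0ℤ) else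
          (if>0 (con 0ℤ ⟨ sub ⟩ e) then (0 ≔ con 0ℤ) else (0 ≔ con 1ℤ))

withSmall : ℕ → Cmd → Cmd
withSmall k p = if>0 (reg 0 ⟨ sub ⟩ con 1ℤ) then p else (if>0 reg 0 then isZero (sumE k 0) else skip)

only : ∀ {xs : List ℤ} → length xs ≡ 1 → nth 0ℤ xs 0 ∈ xs × (∀ {a} → a ∈ xs → a ≡ nth 0ℤ xs 0)
only {x ∷ []} refl = here refl , λ where (here eq) → eq

empty-no : ∀ {k} (x : SumInstance (suc k)) → SumInstance.n x ≡ 0 → ¬ Problem.Yes (kSUM (suc k)) x
empty-no x n≡0 (a , a∈ , _) = none (trans (SumInstance.card≡n x zero) n≡0) (a∈ zero)
  where
  none : ∀ {xs : List ℤ} {a} → length xs ≡ 0 → a ∉ xs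
  none {[]} _ ()

singleton-yes : ∀ {k} (x : SumInstance k) → SumInstance.n x ≡ 1 →
                let S = eval (Problem.input (kSUM k) x) (sumE k 0) in
                (S ≡ 0ℤ → Problem.Yes (kSUM k) x) × (Problem.Yes (kSUM k) x → S ≡ 0ℤ)
singleton-yes {k} x n≡1 = (λ S≡0 → a , (λ i → proj₁ (only≡ i)) , trans (sym S≡sum) S≡0) ,
  λ (b , b∈ , sum≡0) → trans S≡sum (trans (sym (sum-cong-≗ {k} λ i → proj₂ (only≡ i) (b∈ i))) sum≡0)
  where
  open SumInstance x
  a : Fin k → ℤ
  a i = nth 0ℤ (elements (A i)) 0
  only≡ : ∀ i → a i ∈ elements (A i) × (∀ {b} → b ∈ elements (A i) → b ≡ a i)
  only≡ i = only (trans (card≡n i) n≡1)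
  S≡sum : eval (Problem.input (kSUM k) x) (sumE k 0) ≡ sum a
  S≡sum = trans (eval-sumE k 0) (sum-cong-≗ {k} λ i →
    trans (cong (λ b → array (Problem.input (kSUM k) x) b 0ℤ) (ℕ.+-identityʳ (toℕ i)))
      (input-array x i 0ℤ))

n+2≤n*n : ∀ {n} → 2 ≤ n → n + 2 ≤ n * n
n+2≤n*n {n} 2≤n = begin
  n + 2  ≤⟨ ℕ.+-monoʳ-≤ n 2≤n ⟩
  n + n  ≡⟨ cong (λ m → n + m) (sym (ℕ.+-identityʳ n)) ⟩
  2 * n  ≤⟨ ℕ.*-monoˡ-≤ n 2≤n ⟩
  n * n  ∎
  where open ℕ.≤-Reasoning

[n+2]^c≤n^2c : ∀ {n} c → 2 ≤ n → (n + 2) ^ c ≤ n ^ (2 * c)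
[n+2]^c≤n^2c {n} c 2≤n = ℕ.≤-trans (ℕ.^-monoˡ-≤ c (n+2≤n*n 2≤n))
  (ℕ.≤-reflexive (trans (cong (λ m → (n * m) ^ c) (sym (ℕ.*-identityʳ n))) (ℕ.^-*-assoc n 2 c)))

2≤n+2 : ∀ n → 2 ≤ n + 2
2≤n+2 n = ℕ.m≤n+m 2 n

n≤[n+2]^1+c : ∀ n c → n ≤ (n + 2) ^ suc c
n≤[n+2]^1+c n c = ℕ.≤-trans (ℕ.m≤m+n n 2)
  (ℕ.≤-trans (ℕ.≤-reflexive (sym (ℕ.*-identityʳ (n + 2)))) (^-mono (2≤n+2 n) (s≤s (z≤n {c}))))

SolvesWide : ∀ k (T : ℕ → ℕ) (c : ℕ) → Cmd → (w C n₀ : ℕ) → Set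
SolvesWide k T c p w C n₀ =
  ∀ (x : SumInstance k) → let n = SumInstance.n x in Problem.Within (kSUM k) x ((n + 2) ^ c) →
  ∃[ σ ] ∃[ t ] (n + 2) ^ w ⊢ p , Problem.input (kSUM k) x ⇓ σ after t
    × Answers (Problem.Yes (kSUM k) x) σ × (n₀ ≤ n → t ≤ C * T n)

time>0 : ∀ {W p σ τ t} → W ⊢ p , σ ⇓ τ after t → 1 ≤ t
time>0 ⇓skip           = s≤s z≤n
time>0 (⇓≔ _)          = s≤s z≤n
time>0 (⇓[]≔ _ _)      = s≤s z≤n
time>0 (⇓︔ d _)        = ℕ.≤-trans (time>0 d) (ℕ.m≤m+n _ _)
time>0 (⇓then _ _ _)   = s≤s z≤n
time>0 (⇓else _ _ _)   = s≤s z≤n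
time>0 (⇓stop _ _)     = s≤s z≤n
time>0 (⇓loop _ _ _ _) = s≤s z≤n

module _ {N : ℕ} (2≤N : 2 ≤ N) (v w : ℕ) where

  open Logic 2≤N ⊤ v w

  run-isZero : ∀ {e σ Y} → degreeC v (isZero e) ≤ w → Small (N ^ v) σ →
               (eval σ e ≡ 0ℤ → Y) → (Y → eval σ e ≡ 0ℤ) →
                 Run (isZero e) σ (1 + cost e + (1 + (2 + cost e) + 2)) (Answers Y)
  run-isZero {e} {σ} {Y} deg sm yes⇐ yes⇒ =
    run-if (ℕ.m+n≤o⇒m≤o dₑ deg) sm
      (λ pos → answer0 (λ y → ℤ.<-irrefl (sym (yes⇒ y)) pos) (ℕ.m≤n+m 2 (1 + (2 + cost e)))) λ e≤0 →
    run-if (ℕ.m+n≤o⇒m≤o (suc dₑ) else-deg) sm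
      (λ pos → answer0 (λ y → ℤ.<-irrefl (sym (cong (λ z → 0ℤ ℤ.- z) (yes⇒ y))) pos) ℕ.≤-refl)
      λ -e≤0 → run-mono ℕ.≤-refl id (run-≔ 1ℤ (ℕ.m+n≤o⇒n≤o (suc dₑ) else-deg) sm refl
        (ℕ.m^n>0 N {{>-nonZero (ℕ.≤-trans (s≤s z≤n) 2≤N)}} v)
        (inj₁ (refl , yes⇐ (ℤ.≤-antisym e≤0 (ℤ.i-j≤0⇒i≤j -e≤0)))))
    where
    dₑ = degree v e
    else-deg : suc dₑ + 1 ≤ w
    else-deg = ℕ.m+n≤o⇒n≤o dₑ deg
    answer0 : ¬ Y → ∀ {t} → 2 ≤ t → Run (0 ≔ con 0ℤ) σ t (Answers Y)
    answer0 ¬y 2≤t = run-mono 2≤t id (run-≔ 0ℤ z≤n sm refl z≤n (inj₂ (refl , ¬y)))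

-- The exponent doubles because `n + 2 ≤ n * n` for `n ≥ 2`. The test on the size costs 4 steps, and
-- a run takes at least one, whence the factor 5. The 2 added to the threshold removes the small
-- sizes from the time bound.
kSUM-wide : ∀ k T → SolvableIn (kSUM (suc k)) T → ∀ c →
            ∃[ p ] ∃[ w ] ∃[ C ] ∃[ n₀ ] SolvesWide (suc k) T c p w C n₀
kSUM-wide k T solvable c with p , w , C , n₀ , solve ← solvable (2 * c) =
  p′ , w′ , 5 * C , n₀ + 2 , λ x within → result x within (SumInstance.n x ℕ.≤? 1)
  where
  p′ = withSmall (suc k) p
  w′ = w + degreeC (suc c) p′
  small-w : degreeC (suc c) p′ ≤ w′
  small-w = ℕ.m≤n+m _ w
  test = reg 0 ⟨ sub ⟩ con 1ℤ
  S = sumE (suc k) 0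
  d₁ = degree (suc c) test
  test-w : d₁ ≤ w′
  test-w = ℕ.m+n≤o⇒m≤o d₁ small-w
  else-w : suc c + (degreeC (suc c) (isZero S) + 0) ≤ w′
  else-w = ℕ.m+n≤o⇒n≤o (degreeC (suc c) p) (ℕ.m+n≤o⇒n≤o d₁ small-w)
  result : (x : SumInstance (suc k)) → let open SumInstance x in
           Problem.Within (kSUM (suc k)) x ((n + 2) ^ c) → Dec (n ≤ 1) →
           ∃[ σ ] ∃[ t ] (n + 2) ^ w′ ⊢ p′ , Problem.input (kSUM (suc k)) x ⇓ σ after t
             × Answers (Problem.Yes (kSUM (suc k)) x) σ × (n₀ + 2 ≤ n → t ≤ 5 * C * T n)
  result x within n≤1? = by-size n≤1?
    where
    open SumInstance x
    Yes = Problem.Yes (kSUM (suc k)) x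
    N = n + 2
    σ₀ = Problem.input (kSUM (suc k)) x
    open Logic (2≤n+2 n) ⊤ (suc c) w′
    sm : Small (N ^ suc c) σ₀
    sm = sumInput-small x (n≤[n+2]^1+c n c) λ i →
      All.map (λ a≤ → ℕ.≤-trans a≤ (^-mono (2≤n+2 n) (ℕ.n≤1+n c))) (within i)
    by-size : Dec (n ≤ 1) →
      ∃[ σ ] ∃[ t ] N ^ w′ ⊢ p′ , σ₀ ⇓ σ after t × Answers Yes σ × (n₀ + 2 ≤ n → t ≤ 5 * C * T n)
    by-size (no n≰1)
      with σ , t , d , answer , time ← solve x
        (λ i → All.map (λ a≤ → ℕ.≤-trans a≤ ([n+2]^c≤n^2c c (ℕ.≰⇒> n≰1))) (within i)) =
      σ , _ , ⇓then (fits {σ₀} test test-w sm) (i<j⇒0<j-i {+ 1} {+ n} (ℤ.+<+ (ℕ.≰⇒> n≰1)))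
                    (weaken (^-mono (2≤n+2 n) (ℕ.m≤m+n w _)) d) ,
      answer , λ n₀≤n → (begin
        4 + t            ≤⟨ ℕ.+-monoˡ-≤ t (ℕ.*-monoʳ-≤ 4 (time>0 d)) ⟩
        4 * t + t        ≡⟨ ℕ.+-comm (4 * t) t ⟩
        5 * t            ≤⟨ ℕ.*-monoʳ-≤ 5 (time (ℕ.m+n≤o⇒m≤o n₀ n₀≤n)) ⟩
        5 * (C * T n)    ≡⟨ sym (ℕ.*-assoc 5 C (T n)) ⟩
        5 * C * T n      ∎)
      where open ℕ.≤-Reasoning
    by-size (yes n≤1) = Run.final run , _ ,
      ⇓else (fits {σ₀} test test-w sm) (ℤ.i≤j⇒i-j≤0 {+ n} {+ 1} (ℤ.+≤+ n≤1))
        (Run.derivation run) , Run.post run ,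
      λ n₀≤n → contradiction (ℕ.m+n≤o⇒n≤o n₀ n₀≤n) (ℕ.≤⇒≯ n≤1)
      where
      run : Run (if>0 reg 0 then isZero S else skip) σ₀ _ (Answers Yes)
      run = run-if (ℕ.m+n≤o⇒m≤o (suc c) else-w) sm
        (λ pos → let n≡1 = ℕ.≤-antisym n≤1 (ℤ.drop‿+<+ pos) in run-mono (ℕ.m≤m+n _ 1) id
          (run-isZero (2≤n+2 n) (suc c) w′
          (ℕ.m+n≤o⇒m≤o (degreeC (suc c) (isZero S)) (ℕ.m+n≤o⇒n≤o (suc c) else-w)) sm
          (proj₁ (singleton-yes x n≡1)) (proj₂ (singleton-yes x n≡1))))
        (λ n≤0 → let n≡0 = ℕ.n≤0⇒n≡0 (ℤ.drop‿+≤+ n≤0) in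
          run-mono (s≤s z≤n) id (run-skip sm (inj₂ (cong +_ n≡0 , empty-no x n≡0))))

-- Inequalities as equalities of sums of prefixes

floor-remainder : ∀ y P .{{_ : NonZero P}} → ∃[ r ] y ≡ + P ℤ.* quotient y (+ P) ℤ.+ + r × r < P
floor-remainder y (suc p) = y ℤ.% + suc p ,
  trans (ℤ.a≡a%n+[a/n]*n y (+ suc p)) (swap (+ (y ℤ.% + suc p)) (y ℤ./ + suc p) (+ suc p)) ,
  ℤ.n%d<d y (+ suc p)
  where
  swap : ∀ a b c → a ℤ.+ b ℤ.* c ≡ c ℤ.* b ℤ.+ a
  swap = ℤ-solver.solve-∀

module _ {k : ℕ} (y : Fin k → ℤ) where

  prefixSum : ℕ → ℤ
  prefixSum P = sum λ i → quotient (y i) (+ P)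

-- The remainders of the summands add up to `r`; the inequality is not strict, so as to cover
-- `k = 0`.
sum-remainder : ∀ {k} (y : Fin k → ℤ) P .{{_ : NonZero P}} →
                ∃[ r ] sum y ≡ + P ℤ.* prefixSum y P ℤ.+ + r × r ≤ k * P
sum-remainder {zero}  y P = 0 , sym (trans (ℤ.+-identityʳ (+ P ℤ.* 0ℤ)) (ℤ.*-zeroʳ (+ P))) , z≤n
sum-remainder {suc k} y P
  with r , eq , r< ← floor-remainder (y zero) P
  with s , eq′ , s≤ ← sum-remainder (y ∘ suc) P =
  r + s , trans (cong₂ ℤ._+_ eq eq′)
    (regroup (+ P) (quotient (y zero) (+ P)) (prefixSum (y ∘ suc) P) (+ r) (+ s)) ,
  ℕ.+-mono-≤ (ℕ.<⇒≤ r<) s≤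
  where
  regroup : ∀ p a b c d → (p ℤ.* a ℤ.+ c) ℤ.+ (p ℤ.* b ℤ.+ d) ≡ p ℤ.* (a ℤ.+ b) ℤ.+ (c ℤ.+ d)
  regroup = ℤ-solver.solve-∀

sum-≤0 : ∀ {k} (a : Fin k → ℤ) → (∀ i → a i ℤ.≤ 0ℤ) → sum a ℤ.≤ 0ℤ
sum-≤0 {zero}  a a≤0 = ℤ.≤-refl
sum-≤0 {suc k} a a≤0 = ℤ.+-mono-≤ (a≤0 zero) (sum-≤0 (a ∘ suc) (a≤0 ∘ suc))

sum-sub : ∀ {k} (a b : Fin k → ℤ) → sum (λ i → a i ℤ.- b i) ≡ sum a ℤ.- sum b
sum-sub {zero}  a b = refl
sum-sub {suc k} a b = trans (cong (λ z → a zero ℤ.- b zero ℤ.+ z) (sum-sub (a ∘ suc) (b ∘ suc)))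
  (inter (a zero) (b zero) (sum (a ∘ suc)) (sum (b ∘ suc)))
  where
  inter : ∀ a b c d → (a ℤ.- b) ℤ.+ (c ℤ.- d) ≡ (a ℤ.+ c) ℤ.- (b ℤ.+ d)
  inter = ℤ-solver.solve-∀

∣sum∣≤ : ∀ {k} (a : Fin k → ℤ) {Y} → (∀ i → ∣ a i ∣ ≤ Y) → ∣ sum a ∣ ≤ k * Y
∣sum∣≤ {zero}  a a≤ = z≤n
∣sum∣≤ {suc k} a a≤ = ℕ.≤-trans (ℤ.∣i+j∣≤∣i∣+∣j∣ (a zero) (sum (a ∘ suc)))
  (ℕ.+-mono-≤ (a≤ zero) (∣sum∣≤ (a ∘ suc) (a≤ ∘ suc)))

quotient-1 : ∀ y → quotient y (+ 1) ≡ y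
quotient-1 y with floor-remainder y 1
... | zero  , eq , _      =
  sym (trans eq (trans (ℤ.+-identityʳ (+ 1 ℤ.* quotient y (+ 1))) (ℤ.*-identityˡ (quotient y (+ 1)))))
... | suc r , _  , s≤s ()

quotient-≤0 : ∀ y P .{{_ : NonZero P}} → y ℤ.< + P → quotient y (+ P) ℤ.≤ 0ℤ
quotient-≤0 y P@(suc _) y<P with r , eq , _ ← floor-remainder y P = ℤ.≮⇒≥ λ 0<q →
  ℤ.<⇒≱ y<P (begin
    + P                                 ≡⟨ sym (ℤ.*-identityʳ (+ P)) ⟩
    + P ℤ.* 1ℤ                          ≤⟨ ℤ.*-monoˡ-≤-nonNeg (+ P) (ℤ.i<j⇒suc[i]≤j 0<q) ⟩
    + P ℤ.* quotient y (+ P)            ≤⟨ ℤ.i≤i+j _ (+ r) ⟩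
    + P ℤ.* quotient y (+ P) ℤ.+ + r    ≡⟨ sym eq ⟩
    y                                   ∎)
  where open ℤ.≤-Reasoning

i≤∣i∣ : ∀ i → i ℤ.≤ + ∣ i ∣
i≤∣i∣ (+ n)    = ℤ.≤-refl
i≤∣i∣ -[1+ n ] = ℤ.-≤+

drop-point : (s : ℕ → ℤ) → 0ℤ ℤ.< s 0 → ∀ B → s B ℤ.≤ 0ℤ →
             ∃[ b ] b < B × 0ℤ ℤ.< s b × s (suc b) ℤ.≤ 0ℤ
drop-point s 0<s₀ zero    sB≤0 = contradiction 0<s₀ (ℤ.≤⇒≯ sB≤0)
drop-point s 0<s₀ (suc B) sB≤0 with 0ℤ ℤ.<? s B
... | yes 0<sB = B , ℕ.≤-refl , 0<sB , sB≤0
... | no ¬0<sB with b , b<B , p ← drop-point s 0<s₀ B (ℤ.≮⇒≥ ¬0<sB) = b , ℕ.m≤n⇒m≤1+n b<B , p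

-- For the last positive prefix sum, at position b say, dropping one more bit
-- leaves a sum ≤ 0, so only the remainders contribute and it is at most 2k.
positive⇒prefix : ∀ {k} (y : Fin k → ℤ) B → (∀ i → ∣ y i ∣ < 2 ^ B) → 0ℤ ℤ.< sum y →
                  ∃[ b ] b < B × ∃[ v ] 1 ≤ v × v ≤ 2 * k × prefixSum y (2 ^ b) ≡ + v
positive⇒prefix {k} y B y< 0<S
  with b , b<B , 0<sb , sb′≤0 ← drop-point (prefixSum y ∘ (2 ^_))
         (subst (0ℤ ℤ.<_) (sym (sum-cong-≗ (quotient-1 ∘ y))) 0<S) B
         -- At position `B` all quotients are 0 or -1, so the prefix sum is not positive there.
         (sum-≤0 _ λ i → quotient-≤0 (y i) (2 ^ B) {{ℕ.m^n≢0 2 B}}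
           (ℤ.≤-<-trans (i≤∣i∣ (y i)) (ℤ.+<+ (y< i))))
  = b , b<B , bounded (prefixSum y P) refl 0<sb
  where
  P = 2 ^ b
  instance
    P≢0 : NonZero P
    P≢0 = ℕ.m^n≢0 2 b
    2P≢0 : NonZero (2 * P)
    2P≢0 = ℕ.m^n≢0 2 (suc b)
  bounded : ∀ s → prefixSum y P ≡ s → 0ℤ ℤ.< s → ∃[ v ] 1 ≤ v × v ≤ 2 * k × s ≡ + v
  -- Both divisions are compared through `sum y`: it is at least `P * v`, and at most `k` remainders
  -- modulo `2 * P`. Cancelling `P` gives `v ≤ 2 * k`.
  bounded (+ v) s≡v (ℤ.+<+ 1≤v) = v , 1≤v , ℕ.*-cancelˡ-≤ P (ℤ.drop‿+≤+ (begin
    + (P * v)                                        ≡⟨ ℤ.pos-* P v ⟩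
    + P ℤ.* + v                                      ≡⟨ cong (λ z → + P ℤ.* z) (sym s≡v) ⟩
    + P ℤ.* prefixSum y P                            ≤⟨ ℤ.i≤i+j _ (+ r) ⟩
    + P ℤ.* prefixSum y P ℤ.+ + r                    ≡⟨ sym eq ⟩
    sum y                                            ≡⟨ eq′ ⟩
    + (2 * P) ℤ.* prefixSum y (2 * P) ℤ.+ + r′       ≤⟨ ℤ.+-mono-≤
      (ℤ.*-monoˡ-≤-nonNeg (+ (2 * P)) sb′≤0) (ℤ.+≤+ r′≤) ⟩
    + (2 * P) ℤ.* 0ℤ ℤ.+ + (k * (2 * P))             ≡⟨ cong₂ ℤ._+_ (ℤ.*-zeroʳ (+ (2 * P)))
      (cong +_ (shuffle k P)) ⟩
    0ℤ ℤ.+ + (P * (2 * k))                           ≡⟨ ℤ.+-identityˡ (+ (P * (2 * k))) ⟩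
    + (P * (2 * k))                                  ∎)) , refl
    where
    open ℤ.≤-Reasoning
    r   = proj₁ (sum-remainder y P)
    eq  = proj₁ (proj₂ (sum-remainder y P))
    r′  = proj₁ (sum-remainder y (2 * P))
    eq′ = proj₁ (proj₂ (sum-remainder y (2 * P)))
    r′≤ = proj₂ (proj₂ (sum-remainder y (2 * P)))
    shuffle : ∀ k P → k * (2 * P) ≡ P * (2 * k)
    shuffle = ℕ-solver.solve-∀

-- Rounding down only loses nonnegative remainders, so `sum y` is at least `2 ^ b * v ≥ 1`.
prefix⇒positive : ∀ {k} (y : Fin k → ℤ) b v → 1 ≤ v → prefixSum y (2 ^ b) ≡ + v → 0ℤ ℤ.< sum y
prefix⇒positive y b (suc v) _ s≡v = ℤ.<-≤-trans (ℤ.+<+ (s≤s z≤n)) (begin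
  1ℤ                                    ≤⟨ ℤ.+≤+ (ℕ.*-mono-≤ (ℕ.m^n>0 2 b) (s≤s (z≤n {v}))) ⟩
  + (2 ^ b * suc v)                     ≡⟨ ℤ.pos-* (2 ^ b) (suc v) ⟩
  + (2 ^ b) ℤ.* + suc v                 ≡⟨ cong (λ z → + (2 ^ b) ℤ.* z) (sym s≡v) ⟩
  + (2 ^ b) ℤ.* prefixSum y (2 ^ b)     ≤⟨ ℤ.i≤i+j _ (+ proj₁ rem) ⟩
  _                                     ≡⟨ sym (proj₁ (proj₂ rem)) ⟩
  sum y                                 ∎)
  where
  open ℤ.≤-Reasoning
  rem = sum-remainder y (2 ^ b) {{ℕ.m^n≢0 2 b}}

-- Several equalities as one

-- `a` is a multiple of `X` smaller than `X` in magnitude: the lowest digit vanishes even though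
-- digits carry signs.
a+X*b≡0 : ∀ {X} a b → ∣ a ∣ < X → a ℤ.+ + X ℤ.* b ≡ 0ℤ → a ≡ 0ℤ × b ≡ 0ℤ
a+X*b≡0 {X} a b a<X eq = a≡0 , b≡0
  where
  Xb≡-a : b ℤ.* + X ≡ ℤ.- a
  Xb≡-a = trans (isolate a b (+ X)) (trans (cong (ℤ._- a) eq) (ℤ.+-identityˡ (ℤ.- a)))
    where
    isolate : ∀ a b x → b ℤ.* x ≡ (a ℤ.+ x ℤ.* b) ℤ.- a
    isolate = ℤ-solver.solve-∀
  b≡0 : b ≡ 0ℤ
  b≡0 = ∣i∣*n<n⇒i≡0 b X (subst (_< X)
    (trans (sym (ℤ.∣-i∣≡∣i∣ a)) (trans (cong ∣_∣ (sym Xb≡-a)) (ℤ.abs-* b (+ X)))) a<X)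
  a≡0 : a ≡ 0ℤ
  a≡0 = trans (sym (trans (cong (λ z → a ℤ.+ + X ℤ.* z) b≡0)
    (trans (cong (λ z → a ℤ.+ z) (ℤ.*-zeroʳ (+ X))) (ℤ.+-identityʳ a)))) eq

-- An atom (f , v) stands for ∃ b < B : ∑ᵢ ⌊ yᵢ f / 2 ^ b ⌋ = v, and the digits
-- of q in base B are the choices of b for the atoms of a job.

module _ {F : Set} where

  Job : Set
  Job = List (F × ℕ)

  -- The right-hand side is charged to the first summand alone, so that it is subtracted exactly
  -- once.
  offset : ∀ {k} → Fin k → ℕ → ℕ
  offset zero    v = v
  offset (suc _) v = 0

  sum-offset : ∀ k v → sum {suc k} (λ i → + offset i v) ≡ + v
  sum-offset k v = trans (cong (λ z → + v ℤ.+ z) (sum-replicate-zero k)) (ℤ.+-identityʳ (+ v))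

  module _ (B X : ℕ) .{{_ : NonZero B}} where

    -- Horner form of a number with signed digits in base `X`, one digit per atom. It depends on the
    -- `i`-th vector only, which makes it an element of the `i`-th k-SUM set.
    entry : ∀ {k} → Fin k → (F → ℤ) → ℕ → Job → ℤ
    entry i y q []             = 0ℤ
    entry i y q ((f , v) ∷ js) =
      quotient (y f) (+ (2 ^ (q ℕ.% B))) ℤ.- + offset i v ℤ.+ + X ℤ.* entry i y (q ℕ./ B) js

    module _ {k : ℕ} (y : Fin (suc k) → F → ℤ) where

      AtomHolds : F × ℕ → Set
      AtomHolds (f , v) = ∃[ b ] b < B × prefixSum (λ i → y i f) (2 ^ b) ≡ + v

      Matches : ℕ → Job → Set
      Matches q []             = ⊤
      Matches q ((f , v) ∷ js) = prefixSum (λ i → y i f) (2 ^ (q ℕ.% B)) ≡ + v × Matches (q ℕ./ B) js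

      matches⇒holds : ∀ q js → Matches q js → All AtomHolds js
      matches⇒holds q []       _        = []
      matches⇒holds q (_ ∷ js) (eq , m) = (q ℕ.% B , ℕ.m%n<n q B , eq) ∷ matches⇒holds (q ℕ./ B) js m

      holds⇒matches : ∀ js → All AtomHolds js → ∃[ q ] q < B ^ length js × Matches q js
      holds⇒matches []             []                       = 0 , s≤s z≤n , tt
      holds⇒matches ((f , v) ∷ js) ((b , b<B , eq) ∷ holds)
        with q , q< , m ← holds⇒matches js holds =
        b + q * B ,
        ℕ.≤-trans (ℕ.+-monoˡ-≤ (q * B) b<B)
          (ℕ.≤-trans (ℕ.*-monoˡ-≤ B q<) (ℕ.≤-reflexive (ℕ.*-comm (B ^ length js) B))) ,
        trans (cong (λ c → prefixSum (λ i → y i f) (2 ^ c))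
          (trans (ℕ.[m+kn]%n≡m%n b q B) (ℕ.m<n⇒m%n≡m b<B))) eq ,
        subst (λ c → Matches c js) (sym digits) m
        where
        digits : (b + q * B) ℕ./ B ≡ q
        digits = trans (ℕ.+-distrib-/-∣ʳ b (divides q refl))
          (trans (cong (λ a → a + q * B ℕ./ B) (ℕ.m<n⇒m/n≡0 b<B)) (ℕ.m*n/n≡m q B))

      sum-entry : ∀ q f v js → sum (λ i → entry i (y i) q ((f , v) ∷ js)) ≡
        (prefixSum (λ i → y i f) (2 ^ (q ℕ.% B)) ℤ.- + v) ℤ.+ + X ℤ.* sum
          (λ i → entry i (y i) (q ℕ./ B) js)
      sum-entry q f v js = begin
        sum (λ i → (a i ℤ.- o i) ℤ.+ + X ℤ.* r i)
          ≡⟨ ∑-distrib-+ (λ i → a i ℤ.- o i) (λ i → + X ℤ.* r i) ⟩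
        sum (λ i → a i ℤ.- o i) ℤ.+ sum (λ i → + X ℤ.* r i)
          ≡⟨ cong₂ ℤ._+_ (sum-sub a o) (sym (*-distribˡ-sum (+ X) r)) ⟩
        (sum a ℤ.- sum o) ℤ.+ + X ℤ.* sum r
          ≡⟨ cong (λ z → (sum a ℤ.- z) ℤ.+ + X ℤ.* sum r) (sum-offset k v) ⟩
        (sum a ℤ.- + v) ℤ.+ + X ℤ.* sum r               ∎
        where
        open ≡-Reasoning
        a o r : Fin (suc k) → ℤ
        a i = quotient (y i f) (+ (2 ^ (q ℕ.% B)))
        o i = + offset i v
        r i = entry i (y i) (q ℕ./ B) js

      -- Summed over `i`, a digit is a prefix sum of magnitude at most `suc k * Y` minus some
      -- `v ≤ 2 * suc k`. A larger base admits no carries, so a vanishing total forces every digit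
      -- to vanish.
      entries⇒matches : ∀ {Y} → suc k * Y + 2 * suc k < X → ∀ q js →
        All (λ (f , v) → v ≤ 2 * suc k × ∀ i → ∣ y i f ∣ ≤ Y) js →
        sum (λ i → entry i (y i) q js) ≡ 0ℤ → Matches q js
      entries⇒matches XBig q []             _                  eq = tt
      entries⇒matches {Y} XBig q ((f , v) ∷ js) ((v≤ , y≤) ∷ ok) eq =
        ℤ.i-j≡0⇒i≡j s (+ v) (proj₁ both) , entries⇒matches XBig (q ℕ./ B) js ok (proj₂ both)
        where
        s = prefixSum (λ i → y i f) (2 ^ (q ℕ.% B))
        both = a+X*b≡0 {X} (s ℤ.- + v) (sum (λ i → entry i (y i) (q ℕ./ B) js))
          (ℕ.≤-<-trans (ℕ.≤-trans (ℤ.∣i-j∣≤∣i∣+∣j∣ s (+ v)) (ℕ.+-mono-≤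
            (∣sum∣≤ (λ i → quotient (y i f) (+ (2 ^ (q ℕ.% B)))) λ i →
              ℕ.≤-trans (∣quotient∣≤ (y i f) (+ (2 ^ (q ℕ.% B)))) (y≤ i)) v≤)) XBig)
          (trans (sym (sum-entry q f v js)) eq)

      matches⇒entries : ∀ q js → Matches q js → sum (λ i → entry i (y i) q js) ≡ 0ℤ
      matches⇒entries q []             _        = sum-replicate-zero (suc k)
      matches⇒entries q ((f , v) ∷ js) (eq , m) = trans (sum-entry q f v js)
        (trans (cong₂ (λ a b → a ℤ.+ + X ℤ.* b) (ℤ.i≡j⇒i-j≡0 eq) (matches⇒entries (q ℕ./ B) js m))
          (trans (ℤ.+-identityˡ (+ X ℤ.* 0ℤ)) (ℤ.*-zeroʳ (+ X))))

-- Disjunctive normal form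

·-sub : ∀ {m} (u v x : Vec ℤ m) → Vec.zipWith ℤ._-_ u v · x ≡ u · x ℤ.- v · x
·-sub []      []      []      = refl
·-sub (a ∷ u) (b ∷ v) (y ∷ x) = trans
  (cong (λ z → (a ℤ.- b) ℤ.* y ℤ.+ z) (·-sub u v x)) (regroup a b y (u · x) (v · x))
  where
  regroup : ∀ a b y s t → (a ℤ.- b) ℤ.* y ℤ.+ (s ℤ.- t) ≡ (a ℤ.* y ℤ.+ s) ℤ.- (b ℤ.* y ℤ.+ t)
  regroup = ℤ-solver.solve-∀

module _ {k l : ℕ} {d : Fin k → ℕ} where

  -- The summand `z` makes one kind of atom enough: over the integers `a ≤ b` means `b - a + 1 > 0`,
  -- and `a < b` means `b - a > 0`.
  diff : Linear d l → Linear d l → ℤ → Linear d l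
  diff a b z = record
    { coeff = λ i → Vec.zipWith ℤ._-_ (Linear.coeff b i) (Linear.coeff a i)
    ; param = Vec.zipWith ℤ._-_ (Linear.param b) (Linear.param a)
    ; const = Linear.const b ℤ.- Linear.const a ℤ.+ z
    }

  Clause DNF : Set
  Clause = List (Linear d l)
  DNF    = List Clause

  below atMost : Linear d l → Linear d l → DNF
  below a b   = (diff a b 0ℤ ∷ []) ∷ []
  atMost a b = (diff a b 1ℤ ∷ []) ∷ []

  _&_ : DNF → DNF → DNF
  _&_ = cartesianProductWith _++_

  -- The simultaneous recursion pushes negations down to the atoms. There they disappear, because
  -- negated comparisons are comparisons and a negated equality is a disjunction of two.
  dnf dnf¬ : QuantifierFree d l → DNF
  dnf (a ≐ b)   = atMost a b & atMost b a
  dnf (a ≼ b)   = atMost a b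
  dnf (a ≺ b)   = below a b
  dnf (¬′ ψ)    = dnf¬ ψ
  dnf (ψ ∧′ χ)  = dnf ψ & dnf χ
  dnf (ψ ∨′ χ)  = dnf ψ ++ dnf χ
  dnf¬ (a ≐ b)  = below a b ++ below b a
  dnf¬ (a ≼ b)  = below b a
  dnf¬ (a ≺ b)  = atMost b a
  dnf¬ (¬′ ψ)   = dnf ψ
  dnf¬ (ψ ∧′ χ) = dnf¬ ψ ++ dnf¬ χ
  dnf¬ (ψ ∨′ χ) = dnf¬ ψ & dnf¬ χ

  module _ (t : Vec ℤ l) (x : Assignment d) where

    value-diff : ∀ a b z → value t x (diff a b z) ≡ value t x b ℤ.- value t x a ℤ.+ z
    value-diff a b z = trans
      (cong₂ (λ u w → u ℤ.+ w ℤ.+ (const b ℤ.- const a ℤ.+ z))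
        (trans (sum-cong-≗ λ i → ·-sub (coeff b i) (coeff a i) (x i))
               (sum-sub (λ i → coeff b i · x i) (λ i → coeff a i · x i)))
        (·-sub (param b) (param a) t))
      (regroup (sum λ i → coeff b i · x i) (sum λ i → coeff a i · x i)
               (param b · t) (param a · t) (const b) (const a) z)
      where
      open Linear
      regroup : ∀ s s′ p p′ c c′ z → s ℤ.- s′ ℤ.+ (p ℤ.- p′) ℤ.+ (c ℤ.- c′ ℤ.+ z) ≡
                                     s ℤ.+ p ℤ.+ c ℤ.- (s′ ℤ.+ p′ ℤ.+ c′) ℤ.+ z
      regroup = ℤ-solver.solve-∀

    Positive : Linear d l → Set
    Positive f = 0ℤ ℤ.< value t x f

    Sat : DNF → Set
    Sat D = ∃[ c ] c ∈ D × All Positive c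

    sat-unit : ∀ {f} → Positive f ⇔ Sat ((f ∷ []) ∷ [])
    sat-unit = mk⇔ (λ p → _ , here refl , p ∷ []) λ { (_ , here refl , p ∷ []) → p }

    sat-below : ∀ a b → (value t x a ℤ.< value t x b) ⇔ Sat (below a b)
    sat-below a b = sat-unit ⇔-∘ mk⇔
      (λ a<b → subst (0ℤ ℤ.<_) (sym diff≡) (i<j⇒0<j-i a<b)) (λ p → 0<j-i⇒i<j (subst (0ℤ ℤ.<_) diff≡ p))
      where
      diff≡ : value t x (diff a b 0ℤ) ≡ value t x b ℤ.- value t x a
      diff≡ = trans (value-diff a b 0ℤ) (ℤ.+-identityʳ (value t x b ℤ.- value t x a))

    sat-atMost : ∀ a b → (value t x a ℤ.≤ value t x b) ⇔ Sat (atMost a b)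
    sat-atMost a b = sat-unit ⇔-∘ mk⇔
      (λ a≤b → subst (0ℤ ℤ.<_) (sym (value-diff a b 1ℤ))
        (ℤ.+-mono-≤-< (ℤ.i≤j⇒0≤j-i a≤b) (ℤ.+<+ (s≤s (z≤n {0})))))
      (λ p → ℤ.0≤i-j⇒j≤i (0<i+1⇒0≤i (value t x b ℤ.- value t x a)
        (subst (0ℤ ℤ.<_) (value-diff a b 1ℤ) p)))
      where
      0<i+1⇒0≤i : ∀ i → 0ℤ ℤ.< i ℤ.+ 1ℤ → 0ℤ ℤ.≤ i
      0<i+1⇒0≤i i p = ℤ.≮⇒≥ λ i<0 →
        ℤ.<⇒≱ p (subst (ℤ._≤ 0ℤ) (ℤ.+-comm 1ℤ i) (ℤ.i<j⇒suc[i]≤j i<0))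

    sat-& : ∀ D E → (Sat D × Sat E) ⇔ Sat (D & E)
    sat-& D E = mk⇔
      (λ ((c , c∈ , p) , (c′ , c′∈ , p′)) →
        c ++ c′ , ∈-cartesianProductWith⁺ _++_ c∈ c′∈ , All.++⁺ p p′)
      split
      where
      split : Sat (D & E) → Sat D × Sat E
      split (_ , c∈ , p) with c , c′ , c∈D , c′∈E , refl ← ∈-cartesianProductWith⁻ _++_ D E c∈ =
        (c , c∈D , All.++⁻ˡ c p) , (c′ , c′∈E , All.++⁻ʳ c p)

    sat-++ : ∀ D E → (Sat D ⊎ Sat E) ⇔ Sat (D ++ E)
    sat-++ D E = mk⇔ join split
      where
      join : Sat D ⊎ Sat E → Sat (D ++ E)
      join (inj₁ (c , c∈ , p)) = c , ∈-++⁺ˡ c∈ , p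
      join (inj₂ (c , c∈ , p)) = c , ∈-++⁺ʳ D c∈ , p
      split : Sat (D ++ E) → Sat D ⊎ Sat E
      split (c , c∈ , p) with ∈-++⁻ D c∈
      ... | inj₁ c∈D = inj₁ (c , c∈D , p)
      ... | inj₂ c∈E = inj₂ (c , c∈E , p)

    ⟦_⟧? : ∀ ψ → Dec (⟦_⟧ t x ψ)
    ⟦ a ≐ b ⟧?  = value t x a ℤ.≟ value t x b
    ⟦ a ≼ b ⟧?  = value t x a ℤ.≤? value t x b
    ⟦ a ≺ b ⟧?  = value t x a ℤ.<? value t x b
    ⟦ ¬′ ψ ⟧?   = ¬? ⟦ ψ ⟧?
    ⟦ ψ ∧′ χ ⟧? = ⟦ ψ ⟧? ×-dec ⟦ χ ⟧?
    ⟦ ψ ∨′ χ ⟧? = ⟦ ψ ⟧? ⊎-dec ⟦ χ ⟧?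

    ≡⇔≤≥ : ∀ {i j} → (i ≡ j) ⇔ (i ℤ.≤ j × j ℤ.≤ i)
    ≡⇔≤≥ = mk⇔ (λ { refl → ℤ.≤-refl , ℤ.≤-refl }) (λ (p , q) → ℤ.≤-antisym p q)

    ≢⇔<⊎> : ∀ {i j} → (i ≢ j) ⇔ (i ℤ.< j ⊎ j ℤ.< i)
    ≢⇔<⊎> {i} {j} = mk⇔ split λ { (inj₁ i<j) refl → ℤ.<-irrefl refl i<j ; (inj₂ j<i) refl →
      ℤ.<-irrefl refl j<i }
      where
      split : i ≢ j → i ℤ.< j ⊎ j ℤ.< i
      split i≢j with i ℤ.<? j
      ... | yes i<j = inj₁ i<j
      ... | no i≮j  = inj₂ (ℤ.≤∧≢⇒< (ℤ.≮⇒≥ i≮j) (i≢j ∘ sym))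

    ¬×⇔ : ∀ {A B : Set} → Dec A → (¬ (A × B)) ⇔ (¬ A ⊎ ¬ B)
    ¬×⇔ {A} {B} A? = mk⇔ (split A?) λ { (inj₁ ¬a) (a , _) → ¬a a ; (inj₂ ¬b) (_ , b) → ¬b b }
      where
      split : Dec A → ¬ (A × B) → ¬ A ⊎ ¬ B
      split (yes a) ¬ab = inj₂ λ b → ¬ab (a , b)
      split (no ¬a) _   = inj₁ ¬a

    ¬⊎⇔ : ∀ {A B : Set} → (¬ (A ⊎ B)) ⇔ (¬ A × ¬ B)
    ¬⊎⇔ = mk⇔ (λ ¬ab → ¬ab ∘ inj₁ , ¬ab ∘ inj₂)
      λ { (¬a , _) (inj₁ a) → ¬a a ; (_ , ¬b) (inj₂ b) → ¬b b }

    sat-dnf  : ∀ ψ → ⟦_⟧ t x ψ ⇔ Sat (dnf ψ)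
    sat-dnf¬ : ∀ ψ → (¬ ⟦_⟧ t x ψ) ⇔ Sat (dnf¬ ψ)
    sat-dnf (a ≐ b)   = sat-& (atMost a b) (atMost b a) ⇔-∘
      ((sat-atMost a b ×-⇔ sat-atMost b a) ⇔-∘ ≡⇔≤≥)
    sat-dnf (a ≼ b)   = sat-atMost a b
    sat-dnf (a ≺ b)   = sat-below a b
    sat-dnf (¬′ ψ)    = sat-dnf¬ ψ
    sat-dnf (ψ ∧′ χ)  = sat-& (dnf ψ) (dnf χ) ⇔-∘ (sat-dnf ψ ×-⇔ sat-dnf χ)
    sat-dnf (ψ ∨′ χ)  = sat-++ (dnf ψ) (dnf χ) ⇔-∘ (sat-dnf ψ ⊎-⇔ sat-dnf χ)
    sat-dnf¬ (a ≐ b)  = sat-++ (below a b) (below b a) ⇔-∘ ((sat-below a b ⊎-⇔ sat-below b a) ⇔-∘ ≢⇔<⊎>)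
    sat-dnf¬ (a ≼ b)  = sat-below b a ⇔-∘ mk⇔ ℤ.≰⇒> ℤ.<⇒≱
    sat-dnf¬ (a ≺ b)  = sat-atMost b a ⇔-∘ mk⇔ ℤ.≮⇒≥ ℤ.≤⇒≯
    sat-dnf¬ (¬′ ψ)   = sat-dnf ψ ⇔-∘ mk⇔ (decidable-stable ⟦ ψ ⟧?) (λ p ¬p → ¬p p)
    sat-dnf¬ (ψ ∧′ χ) = sat-++ (dnf¬ ψ) (dnf¬ χ) ⇔-∘ ((sat-dnf¬ ψ ⊎-⇔ sat-dnf¬ χ) ⇔-∘ ¬×⇔ ⟦ ψ ⟧?)
    sat-dnf¬ (ψ ∨′ χ) = sat-& (dnf¬ ψ) (dnf¬ χ) ⇔-∘ ((sat-dnf¬ ψ ×-⇔ sat-dnf¬ χ) ⇔-∘ ¬⊎⇔)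

  module _ (t : Vec ℤ l) {x y : Assignment d} (x≗y : ∀ i → x i ≡ y i) where

    value-cong : ∀ f → value t x f ≡ value t y f
    value-cong f = cong (λ s → s ℤ.+ param · t ℤ.+ const)
      (sum-cong-≗ λ i → cong (coeff i ·_) (x≗y i))
      where open Linear f

    -- Needed because `Prefixed` evaluates the formula at assignments rebuilt by `extend`, which
    -- agree with the original ones pointwise.
    ⟦⟧-cong : ∀ ψ → ⟦_⟧ t x ψ ⇔ ⟦_⟧ t y ψ
    ⟦⟧-cong (a ≐ b)  = mk⇔ (subst₂ _≡_ (value-cong a) (value-cong b))
                           (subst₂ _≡_ (sym (value-cong a)) (sym (value-cong b)))
    ⟦⟧-cong (a ≼ b)  = mk⇔ (subst₂ ℤ._≤_ (value-cong a) (value-cong b))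
                           (subst₂ ℤ._≤_ (sym (value-cong a)) (sym (value-cong b)))
    ⟦⟧-cong (a ≺ b)  = mk⇔ (subst₂ ℤ._<_ (value-cong a) (value-cong b))
                           (subst₂ ℤ._<_ (sym (value-cong a)) (sym (value-cong b)))
    ⟦⟧-cong (¬′ ψ)   = ¬-cong-⇔ (⟦⟧-cong ψ)
    ⟦⟧-cong (ψ ∧′ χ) = ⟦⟧-cong ψ ×-⇔ ⟦⟧-cong χ
    ⟦⟧-cong (ψ ∨′ χ) = ⟦⟧-cong ψ ⊎-⇔ ⟦⟧-cong χ

-- Existential prefixes

prefixed⇒ : ∀ {k} {d : Fin k → ℕ} {Q} (A : ∀ i → FiniteSet (Vec ℤ (d i))) {P : Assignment d → Set} →
            (∀ i → Q i ≡ exists) → Prefixed Q A P → ∃[ x ] (∀ i → x i ∈ˢ A i) × P x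
prefixed⇒ {zero}         A Q≡ p = _ , (λ ()) , p
prefixed⇒ {suc k} {Q = Q} A Q≡ p with Q zero | Q≡ zero
... | exists | refl
  with x , x∈ , q ← p
  with xs , xs∈ , r ← prefixed⇒ (A ∘ suc) (Q≡ ∘ suc) q =
  extend x xs , (λ { zero → x∈ ; (suc i) → xs∈ i }) , r

prefixed⇐ : ∀ {k} {d : Fin k → ℕ} {Q} (A : ∀ i → FiniteSet (Vec ℤ (d i))) {P : Assignment d → Set} →
            (∀ {x y} → (∀ i → x i ≡ y i) → P x → P y) → (∀ i → Q i ≡ exists) →
            ∀ x → (∀ i → x i ∈ˢ A i) → P x → Prefixed Q A P
prefixed⇐ {zero}         A resp Q≡ x x∈ p = resp (λ ()) p
prefixed⇐ {suc k} {Q = Q} A resp Q≡ x x∈ p with Q zero | Q≡ zero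
... | exists | refl =
  x zero , x∈ zero , prefixed⇐ (A ∘ suc)
    (λ x≗y → resp λ { zero → refl ; (suc i) → x≗y i }) (Q≡ ∘ suc) (x ∘ suc) (x∈ ∘ suc)
    (resp (λ { zero → refl ; (suc i) → refl }) p)

-- Expanding the right-hand sides of the atoms

module _ {F : Set} (K : ℕ) where

  expand : List F → List Job
  expand []       = [] ∷ []
  expand (f ∷ fs) = cartesianProductWith (λ v js → (f , v) ∷ js) (applyUpTo suc K) (expand fs)

  expand⁺ : ∀ {P : F × ℕ → Set} fs → All (λ f → ∃[ v ] 1 ≤ v × v ≤ K × P (f , v)) fs →
            ∃[ js ] js ∈ expand fs × All P js
  expand⁺ []       []                               = [] , here refl , []
  expand⁺ (f ∷ fs) ((suc v , _ , v≤ , p) ∷ ps)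
    with js , js∈ , qs ← expand⁺ fs ps =
    (f , suc v) ∷ js , ∈-cartesianProductWith⁺ _ (∈-applyUpTo⁺ suc v≤) js∈ , p ∷ qs

  expand⁻ : ∀ {P : F × ℕ → Set} fs {js} → js ∈ expand fs → All P js →
            All (λ f → ∃[ v ] 1 ≤ v × v ≤ K × P (f , v)) fs
  expand⁻ []       js∈ ps = []
  expand⁻ (f ∷ fs) js∈ ps
    with v , js , v∈ , js∈′ , refl ← ∈-cartesianProductWith⁻ (λ v js → (f , v) ∷ js)
      (applyUpTo suc K) (expand fs) js∈
    with i , i<K , refl ← ∈-applyUpTo⁻ suc v∈
    with p ∷ ps′ ← ps =
    (suc i , s≤s z≤n , i<K , p) ∷ expand⁻ fs js∈′ ps′

  expand-atoms : ∀ {P : F → Set} fs {js} → js ∈ expand fs → All P fs → All (λ (f , v) → v ≤ K × P f) js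
  expand-atoms []       (here refl) []        = []
  expand-atoms (f ∷ fs) js∈        (p ∷ ps)
    with v , js , v∈ , js∈′ , refl ← ∈-cartesianProductWith⁻ (λ v js → (f , v) ∷ js)
      (applyUpTo suc K) (expand fs) js∈
    with i , i<K , refl ← ∈-applyUpTo⁻ suc v∈ =
    (i<K , p) ∷ expand-atoms fs js∈′ ps

-- Replacing repeated and missing elements by dummies

module _ (v : ℕ → ℤ) where

  Seen : ℕ → ℕ → ℤ → Set
  Seen t n z = ∃[ s ] s < n × t ≤ s × v s ≡ z

  seen? : ∀ t n z → Dec (Seen t n z)
  seen? t n z = ℕ.anyUpTo? (λ s → (t ℕ.≤? s) ×-dec (v s ℤ.≟ z)) n

  -- The last occurrence survives, since the filling loop counts down and has seen exactly the
  -- larger indices. Dummies carry their index and are thus distinct from each other.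
  distinct : ℕ → ℕ → ℕ → ℤ
  distinct D n t = if does (seen? (suc t) n (v t)) then + (D + t) else v t

  distinct-seen : ∀ {D n t} → Seen (suc t) n (v t) → distinct D n t ≡ + (D + t)
  distinct-seen {D} {n} {t} s = cong (if_then + (D + t) else v t) (dec-true (seen? (suc t) n (v t)) s)

  distinct-fresh : ∀ {D n t} → ¬ Seen (suc t) n (v t) → distinct D n t ≡ v t
  distinct-fresh {D} {n} {t} s = cong (if_then + (D + t) else v t) (dec-false (seen? (suc t) n (v t)) s)

padded : ℕ → ℕ → (ℕ → ℤ) → ℕ → ℤ
padded D c h t = if does (t ℕ.<? c) then h t else + (D + t)

padded-< : ∀ {D c h t} → t < c → padded D c h t ≡ h t
padded-< {D} {c} {h} {t} t<c = cong (if_then h t else + (D + t)) (dec-true (t ℕ.<? c) t<c)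

padded-≥ : ∀ {D c h t} → ¬ t < c → padded D c h t ≡ + (D + t)
padded-≥ {D} {c} {h} {t} t≮c = cong (if_then h t else + (D + t)) (dec-false (t ℕ.<? c) t≮c)

module _ {n D : ℕ} (c : ℕ) (h : ℕ → ℤ) (h< : ∀ {t} → t < n → ∣ h t ∣ < D) where

  private
    v : ℕ → ℤ
    v = padded D c h

    g : ℕ → ℤ
    g = distinct v D n

  dummy≢h : ∀ {s t} → t < n → + (D + s) ≢ h t
  dummy≢h {s} {t} t<n eq = ℕ.<-irrefl (cong ∣_∣ (sym eq)) (ℕ.<-≤-trans (h< t<n) (ℕ.m≤m+n D s))

  padded-cases : ∀ t → v t ≡ + (D + t) ⊎ (t < c × v t ≡ h t)
  padded-cases t = by-dec (t ℕ.<? c)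
    where
    by-dec : Dec (t < c) → v t ≡ + (D + t) ⊎ (t < c × v t ≡ h t)
    by-dec (yes t<c) = inj₂ (t<c , padded-< {D} {c} {h} t<c)
    by-dec (no t≮c)  = inj₁ (padded-≥ {D} {c} {h} t≮c)

  dummy≡padded : ∀ {s t} → t < n → + (D + s) ≡ v t → s ≡ t
  dummy≡padded {s} {t} t<n eq with padded-cases t
  ... | inj₂ (_ , vt) = contradiction (trans eq vt) (dummy≢h {s} t<n)
  ... | inj₁ vt       = ℕ.+-cancelˡ-≡ D s t (ℤ.+-injective (trans eq vt))

  fresh-or-dummy : ∀ t → g t ≡ + (D + t) ⊎ (¬ Seen v (suc t) n (v t) × g t ≡ v t)
  fresh-or-dummy t with seen? v (suc t) n (v t)
  ... | yes _   = inj₁ refl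
  ... | no ¬s   = inj₂ (¬s , refl)

  element-cases : ∀ t → g t ≡ + (D + t) ⊎ (t < c × g t ≡ h t)
  element-cases t with fresh-or-dummy t
  ... | inj₁ gt       = inj₁ gt
  ... | inj₂ (_ , gt) with padded-cases t
  ...   | inj₁ vt         = inj₁ (trans gt vt)
  ...   | inj₂ (t<c , vt) = inj₂ (t<c , trans gt vt)

  -- Equal dummies have equal indices, a dummy is too large to equal some `h t`, and of two equal
  -- surviving values the earlier one would have been seen.
  distinct-injective : ∀ {s t} → s < n → t < n → g s ≡ g t → s ≡ t
  distinct-injective {s} {t} s<n t<n eq with fresh-or-dummy s | fresh-or-dummy t
  ... | inj₁ gs       | inj₁ gt       = ℕ.+-cancelˡ-≡ D s t
    (ℤ.+-injective (trans (sym gs) (trans eq gt)))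
  ... | inj₁ gs       | inj₂ (_ , gt) = dummy≡padded t<n (trans (sym gs) (trans eq gt))
  ... | inj₂ (_ , gs) | inj₁ gt       = sym (dummy≡padded s<n (trans (sym gt) (trans (sym eq) gs)))
  ... | inj₂ (¬s , gs) | inj₂ (¬t , gt) with ℕ.<-cmp s t
  ...   | tri< s<t _ _ = contradiction (t , t<n , s<t , trans (sym gt) (trans (sym eq) gs)) ¬s
  ...   | tri≈ _ s≡t _ = s≡t
  ...   | tri> _ _ t<s = contradiction (s , s<n , t<s , trans (sym gs) (trans eq gt)) ¬t

  -- From an occurrence that was replaced one moves on to a later one; the last one is kept. The
  -- fuel bounds the distance to `n`.
  occurs : ∀ {t} → t < c → t < n → ∃[ s ] s < n × g s ≡ h t
  occurs {t} t<c t<n = go n t (ℕ.m≤n+m n t) t<n (padded-< {D} {c} {h} t<c)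
    where
    go : ∀ fuel s → n ≤ s + fuel → s < n → v s ≡ h t → ∃[ r ] r < n × g r ≡ h t
    go zero       s n≤ s<n vs = contradiction s<n (ℕ.≤⇒≯ (subst (n ≤_) (ℕ.+-identityʳ s) n≤))
    go (suc fuel) s n≤ s<n vs with seen? v (suc s) n (v s)
    ... | no ¬seen = s , s<n , trans (distinct-fresh v {D} ¬seen) vs
    ... | yes (r , r<n , s<r , vr) = go fuel r
      (ℕ.≤-trans n≤ (ℕ.≤-trans (ℕ.≤-reflexive (ℕ.+-suc s fuel)) (ℕ.+-monoˡ-≤ fuel s<r)))
      r<n (trans vr vs)

  distinct-bound : ∀ {t} → t < n → ∣ g t ∣ ≤ D + n
  distinct-bound {t} t<n with element-cases t
  ... | inj₁ gt       = subst (λ z → ∣ z ∣ ≤ D + n) (sym gt) (ℕ.+-monoʳ-≤ D (ℕ.<⇒≤ t<n))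
  ... | inj₂ (_ , gt) = subst (λ z → ∣ z ∣ ≤ D + n) (sym gt)
    (ℕ.≤-trans (ℕ.<⇒≤ (h< t<n)) (ℕ.m≤m+n D n))

sum-lower : ∀ {k} (a : Fin k → ℤ) {H} → (∀ i → ℤ.- + H ℤ.≤ a i) → ℤ.- + (k * H) ℤ.≤ sum a
sum-lower {zero}  a a≥ = ℤ.≤-refl
sum-lower {suc k} a {H} a≥ = ℤ.≤-trans
  (ℤ.≤-reflexive (trans (cong ℤ.-_ (ℤ.pos-+ H (k * H))) (ℤ.neg-distrib-+ (+ H) (+ (k * H)))))
  (ℤ.+-mono-≤ (a≥ zero) (sum-lower (a ∘ suc) (a≥ ∘ suc)))

dummy-sum : ∀ {k} (a : Fin k → ℤ) {H D} → (∀ i → ℤ.- + H ℤ.≤ a i) →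
            ∀ i → + D ℤ.≤ a i → + D ℤ.- + (k * H) ℤ.≤ sum a
dummy-sum {suc k} a {H} {D} a≥ zero D≤ = ℤ.≤-trans
  (ℤ.+-monoʳ-≤ (+ D) (ℤ.neg-mono-≤ (ℤ.+≤+ (ℕ.m≤n+m (k * H) H))))
  (ℤ.+-mono-≤ D≤ (sum-lower (a ∘ suc) (a≥ ∘ suc)))
dummy-sum {suc k} a {H} {D} a≥ (suc i) D≤ = ℤ.≤-trans
  (ℤ.≤-reflexive (trans (cong (λ z → + D ℤ.- z) (ℤ.pos-+ H (k * H))) (regroup (+ D) (+ H) (+ (k * H)))))
  (ℤ.+-mono-≤ (a≥ zero) (dummy-sum (a ∘ suc) (a≥ ∘ suc) i D≤))
  where
  regroup : ∀ d h r → d ℤ.- (h ℤ.+ r) ≡ ℤ.- h ℤ.+ (d ℤ.- r)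
  regroup = ℤ-solver.solve-∀

dummy-sum-pos : ∀ {k} (a : Fin k → ℤ) {H D} → k * H < D → (∀ i → ℤ.- + H ℤ.≤ a i) →
                ∀ i → + D ℤ.≤ a i → 0ℤ ℤ.< sum a
dummy-sum-pos a kH<D a≥ i D≤ = ℤ.<-≤-trans (i<j⇒0<j-i (ℤ.+<+ kH<D)) (dummy-sum a a≥ i D≤)

all-or-some : ∀ {k} {P Q : Fin k → Set} → (∀ i → P i ⊎ Q i) → (∀ i → P i) ⊎ ∃ Q
all-or-some {zero}  pq = inj₁ λ ()
all-or-some {suc k} pq with pq zero | all-or-some (pq ∘ suc)
... | inj₂ q | _            = inj₂ (zero , q)
... | inj₁ p | inj₂ (i , q) = inj₂ (suc i , q)
... | inj₁ p | inj₁ ps      = inj₁ λ { zero → p ; (suc i) → ps i }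

-- k-SUM on the padded families has a solution iff the families do: a dummy
-- exceeds everything the other summands can compensate.
module Padded {k n D H : ℕ} (c : Fin k → ℕ) (h : Fin k → ℕ → ℤ) (c≤n : ∀ i → c i ≤ n)
              (h≤ : ∀ i {t} → t < n → ∣ h i t ∣ ≤ H) (kH<D : k * H < D) (H<D : H < D) where

  family : Fin k → ℕ → ℤ
  family i = distinct (padded D (c i) (h i)) D n

  h<D : ∀ i {t} → t < n → ∣ h i t ∣ < D
  h<D i t<n = ℕ.≤-<-trans (h≤ i t<n) H<D

  paddedInstance : SumInstance k
  paddedInstance = sumInstance {n = n} (λ i t → family i (toℕ t)) λ i {s} {t} eq →
    toℕ-injective (distinct-injective (c i) (h i) (h<D i) (toℕ<n s) (toℕ<n t) eq)

  within : Problem.Within (kSUM k) paddedInstance (D + n)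
  within i = All.tabulate⁺ λ t → distinct-bound (c i) (h i) (h<D i) (toℕ<n t)

  Solution : Set
  Solution = Σ[ t ∈ (Fin k → ℕ) ] (∀ i → t i < c i) × sum (λ i → h i (t i)) ≡ 0ℤ

  solution⇒yes : Solution → Problem.Yes (kSUM k) paddedInstance
  solution⇒yes (t , t< , sum≡0) = (λ i → h i (t i)) , member , sum≡0
    where
    member : ∀ i → h i (t i) ∈ List.tabulate {n = n} (λ s → family i (toℕ s))
    member i with s , s<n , eq ← occurs (c i) (h i) (h<D i) (t< i) (ℕ.<-≤-trans (t< i) (c≤n i)) =
      subst (_∈ List.tabulate {n = n} (λ s → family i (toℕ s)))
        (trans (cong (family i) (toℕ-fromℕ< s<n)) eq) (∈-tabulate⁺ (fromℕ< s<n))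

  yes⇒solution : Problem.Yes (kSUM k) paddedInstance → Solution
  yes⇒solution (a , a∈ , sum≡0) = by-case (all-or-some cases)
    where
    cases : ∀ i → (∃[ t ] t < c i × a i ≡ h i t) ⊎ (+ D ℤ.≤ a i)
    cases i with s , eq ← ∈-tabulate⁻ (a∈ i) with element-cases (c i) (h i) (h<D i) (toℕ s)
    ... | inj₁ dummy        = inj₂ (subst (+ D ℤ.≤_) (sym (trans eq dummy)) (ℤ.+≤+ (ℕ.m≤m+n D (toℕ s))))
    ... | inj₂ (t<c , real) = inj₁ (toℕ s , t<c , trans eq real)
    a≥ : ∀ i → ℤ.- + H ℤ.≤ a i
    a≥ i with cases i
    ... | inj₁ (t , t<c , eq) = subst (ℤ.- + H ℤ.≤_) (sym eq)
      (lower (h i t) (h≤ i (ℕ.<-≤-trans t<c (c≤n i))))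
      where
      lower : ∀ z → ∣ z ∣ ≤ H → ℤ.- + H ℤ.≤ z
      lower (+ z)    _ = ℤ.≤-trans ℤ.neg-≤-pos (ℤ.≤-refl {+ z})
      lower -[1+ z ] p = ℤ.neg-mono-≤ (ℤ.+≤+ p)
    ... | inj₂ D≤ = ℤ.≤-trans (ℤ.neg-≤-pos {H} {D}) D≤
    by-case : (∀ i → ∃[ t ] t < c i × a i ≡ h i t) ⊎ (∃[ i ] + D ℤ.≤ a i) → Solution
    by-case (inj₁ real) = (λ i → proj₁ (real i)) , (λ i → proj₁ (proj₂ (real i))) ,
      trans (sym (sum-cong-≗ λ i → proj₂ (proj₂ (real i)))) sum≡0
    by-case (inj₂ (i , D≤)) = contradiction (dummy-sum-pos a kH<D a≥ i D≤) (ℤ.<-irrefl (sym sum≡0))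

-- The expressions computing the elements of the k-SUM instances

nth-++ˡ : ∀ {A : Set} {z : A} {m} (f : Fin m → A) ys i →
          nth z (List.tabulate f ++ ys) (toℕ i) ≡ f i
nth-++ˡ f ys zero    = refl
nth-++ˡ f ys (suc i) = nth-++ˡ (f ∘ suc) ys i

nth-++ʳ : ∀ {A : Set} {z : A} {m} (f : Fin m → A) ys n →
          nth z (List.tabulate f ++ ys) (m + n) ≡ nth z ys n
nth-++ʳ {m = zero}  f ys n = refl
nth-++ʳ {m = suc m} f ys n = nth-++ʳ (f ∘ suc) ys n

nth-toList : ∀ {A : Set} {z : A} {m} (v : Vec A m) i → nth z (toList v) (toℕ i) ≡ lookup v i
nth-toList (x ∷ v) zero    = refl
nth-toList (x ∷ v) (suc i) = nth-toList v i

nth-toList-++ˡ : ∀ {A : Set} {z : A} {m} (v : Vec A m) ys i →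
  nth z (toList v ++ ys) (toℕ i) ≡ lookup v i
nth-toList-++ˡ (x ∷ v) ys zero    = refl
nth-toList-++ˡ (x ∷ v) ys (suc i) = nth-toList-++ˡ v ys i

nth-toList-++ʳ : ∀ {A : Set} {z : A} {m} (v : Vec A m) ys n →
  nth z (toList v ++ ys) (m + n) ≡ nth z ys n
nth-toList-++ʳ []      ys n = refl
nth-toList-++ʳ (x ∷ v) ys n = nth-toList-++ʳ v ys n

nth-concat : ∀ {m} (xs : List (Vec ℤ m)) i j →
             nth 0ℤ (concatMap toList xs) (toℕ i * m + toℕ j) ≡ lookup (List.lookup xs i) j
nth-concat         (x ∷ xs) zero    j = nth-toList-++ˡ x (concatMap toList xs) j
nth-concat {m}     (x ∷ xs) (suc i) j = trans
  (cong (nth 0ℤ (toList x ++ concatMap toList xs)) (ℕ.+-assoc m (toℕ i * m) (toℕ j)))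
  (trans (nth-toList-++ʳ x (concatMap toList xs) (toℕ i * m + toℕ j)) (nth-concat xs i j))

dotAt : ∀ {m} → Vec ℤ m → (ℤ → ℤ) → ℕ → ℕ → ℤ
dotAt []       g b j = 0ℤ
dotAt (c ∷ cs) g b j = c ℤ.* g (+ (b + j)) ℤ.+ dotAt cs g b (suc j)

dotE : ∀ {m} → Vec ℤ m → ℕ → Exp → ℕ → Exp
dotE []       a e j = con 0ℤ
dotE (c ∷ cs) a e j = (con c ⟨ mul ⟩ (a [ e ⟨ add ⟩ con (+ j) ])) ⟨ add ⟩ dotE cs a e (suc j)

eval-dotE : ∀ {m σ g a b e} → (∀ j → array σ a j ≡ g j) → eval σ e ≡ + b →
            ∀ (c : Vec ℤ m) j → eval σ (dotE c a e j) ≡ dotAt c g b j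
eval-dotE                 a≗g e≡ []       j = refl
eval-dotE {σ = σ} {g} {a} a≗g e≡ (c ∷ cs) j = cong₂ ℤ._+_
  (cong (λ z → c ℤ.* z) (trans (a≗g _) (cong (λ z → g (z ℤ.+ + j)) e≡)))
  (eval-dotE {σ = σ} a≗g e≡ cs (suc j))

dotAt≡· : ∀ {m g b} (c v : Vec ℤ m) j → (∀ i → g (+ (b + (j + toℕ i))) ≡ lookup v i) →
          dotAt c g b j ≡ c · v
dotAt≡· []       []      j g≡ = refl
dotAt≡· {g = g} {b} (c ∷ cs) (x ∷ v) j g≡ = cong₂ (λ y z → c ℤ.* y ℤ.+ z)
  (trans (cong (λ i → g (+ (b + i))) (sym (ℕ.+-identityʳ j))) (g≡ zero))
  (dotAt≡· cs v (suc j) λ i → trans (cong (λ i → g (+ (b + i))) (sym (ℕ.+-suc j (toℕ i)))) (g≡ (suc i)))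

powE : ℕ → Exp
powE zero    = con 1ℤ
powE (suc x) = (reg 1 ⟨ add ⟩ con (+ 2)) ⟨ mul ⟩ powE x

eval-powE : ∀ {σ n} → register σ 1 ≡ + n → ∀ x → eval σ (powE x) ≡ + ((n + 2) ^ x)
eval-powE         1≡n zero    = refl
eval-powE {σ} {n} 1≡n (suc x) = trans (cong₂ ℤ._*_ (cong (λ z → z ℤ.+ + 2) 1≡n) (eval-powE {σ} 1≡n x))
  (sym (ℤ.pos-* (n + 2) ((n + 2) ^ x)))

-- The machine has no operation raising 2 to a variable power, so the powers are tabulated once and
-- then looked up.
powerTable : ℕ → ℤ → ℤ
powerTable B (+ b)    = if does (b ℕ.<? B) then + (2 ^ b) else 0ℤ
powerTable B -[1+ _ ] = 0ℤ

powerTable-< : ∀ {b B} → b < B → powerTable B (+ b) ≡ + (2 ^ b)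
powerTable-< {b} {B} b<B = cong (if_then + (2 ^ b) else 0ℤ) (dec-true (b ℕ.<? B) b<B)

-- Registers: 1 the size n, 2 the number B of bits, 5 the code q of the digits,
-- 6 the index of an element.  Arrays: 0, …, k - 1 the input, k the input
-- registers, k + 1 the powers of two.

module Expressions {k′ : ℕ} (φ : Formula (suc k′)) where

  open Formula φ public

  k : ℕ
  k = suc k′

  Form : Set
  Form = Linear d l

  -- Parameters and the constant term are attributed to the first set, to be counted once. The
  -- parameters follow the `k` cardinalities in the saved registers, hence the base address `k`.
  extraE : Fin k → Form → Exp
  extraE zero    f = dotE (Linear.param f) k (con (+ k)) 0 ⟨ add ⟩ con (Linear.const f)
  extraE (suc _) f = con 0ℤ

  formE : Fin k → Form → Exp
  formE i f = dotE (Linear.coeff f i) (toℕ i) (reg 6 ⟨ mul ⟩ con (+ d i)) 0 ⟨ add ⟩ extraE i f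

  module _ (x : ℕ) where

    entryE : Fin k → Exp → Job → Exp
    entryE i q []             = con 0ℤ
    entryE i q ((f , v) ∷ js) =
      -- The lowest digit of the code, `q` modulo the content of register 2, is computed as `q`
      -- minus quotient times divisor.
      ((formE i f ⟨ div ⟩ (suc k [ q ⟨ sub ⟩ ((q ⟨ div ⟩ reg 2) ⟨ mul ⟩ reg 2) ])) ⟨ sub ⟩ con
        (+ offset {F = Form} i v))
      ⟨ add ⟩ (powE x ⟨ mul ⟩ entryE i (q ⟨ div ⟩ reg 2) js)

  jobs : List Job
  jobs = concatMap (expand (2 * k)) (dnf ψ)

  module _ (x : ModelInstance φ) where

    open ModelInstance x

    size : ℕ
    size = Problem.size (FOPℤ φ) x

    inputState : State
    inputState = Problem.input (FOPℤ φ) x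

    saved : ℤ → ℤ
    saved = contents (List.tabulate (λ i → + card (A i)) ++ toList t)

    vectors : Fin k → ℤ → ℤ
    vectors i = contents (concatMap toList (elements (A i)))

    extra : Fin k → Form → ℤ
    extra zero    f = dotAt (Linear.param f) saved k 0 ℤ.+ Linear.const f
    extra (suc _) f = 0ℤ

    -- Defined through memory instead of vectors: the loop evaluates it for all `s < size`, also
    -- beyond the end of a smaller set, before padding discards the value.
    form : Fin k → ℕ → Form → ℤ
    form i s f = dotAt (Linear.coeff f i) (vectors i) (s * d i) 0 ℤ.+ extra i f

    low : ℕ → ℕ → ℤ → ℤ
    low B a j = if does (a ℕ.≟ k) then saved j else
               (if does (a ℕ.≟ suc k) then powerTable B j else array inputState a j)

    low-saved : ∀ B j → low B k j ≡ saved j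
    low-saved B j rewrite dec-true (k ℕ.≟ k) refl = refl

    low-powers : ∀ B j → low B (suc k) j ≡ powerTable B j
    low-powers B j rewrite dec-false (suc k ℕ.≟ k) ℕ.1+n≢n | dec-true (suc k ℕ.≟ suc k) refl = refl

    low-input : ∀ B {a} j → a < k → low B a j ≡ array inputState a j
    low-input B {a} j a<k
      rewrite dec-false (a ℕ.≟ k) (ℕ.<⇒≢ a<k) | dec-false (a ℕ.≟ suc k) (ℕ.<⇒≢ (ℕ.m≤n⇒m≤1+n a<k)) = refl

    low-vectors : ∀ B i j → low B (toℕ i) j ≡ vectors i j
    low-vectors B i j = trans (low-input B j (toℕ<n i))
      (cong (λ xs → contents xs j) (nth-tabulate (λ i → concatMap toList (elements (A i))) i))

    record Ready (B q s : ℕ) (σ : State) : Set where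
      constructor ready
      field
        size≡  : register σ 1 ≡ + size
        bits≡  : register σ 2 ≡ + B
        code≡  : register σ 5 ≡ + q
        index≡ : register σ 6 ≡ + s
        low≡   : ∀ a j → a < 2 + k → array σ a j ≡ low B a j

    open Ready public

    module _ {B q s σ} (rd : Ready B q s σ) where

      eval-extraE : ∀ i f → eval σ (extraE i f) ≡ extra i f
      eval-extraE zero    f = cong (λ z → z ℤ.+ Linear.const f)
        (eval-dotE {σ = σ} (λ j → trans (low≡ rd k j (s≤s (ℕ.n≤1+n k))) (low-saved B j)) refl
          (Linear.param f) 0)
      eval-extraE (suc _) f = refl

      eval-formE : ∀ i f → eval σ (formE i f) ≡ form i s f
      eval-formE i f = cong₂ ℤ._+_
        (eval-dotE {σ = σ} (λ j → trans (low≡ rd (toℕ i) j (ℕ.m≤n⇒m≤1+n (ℕ.m≤n⇒m≤1+n (toℕ<n i))))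
          (low-vectors B i j))
          (trans (cong (λ z → z ℤ.* + d i) (index≡ rd)) (sym (ℤ.pos-* s (d i)))) (Linear.coeff f i) 0)
        (eval-extraE i f)

      eval-entryE : ∀ .{{_ : NonZero B}} x i {qe c} → eval σ qe ≡ + c → ∀ js →
                    eval σ (entryE x i qe js) ≡ entry B ((size + 2) ^ x) i (form i s) c js
      eval-entryE x i qe≡ [] = refl
      eval-entryE x i {qe} {c} qe≡ ((f , v) ∷ js) = cong₂ ℤ._+_
        (cong (λ z → z ℤ.- + offset {F = Form} i v) (cong₂ quotient (eval-formE i f) power))
        (cong₂ ℤ._*_ (eval-powE {σ} (size≡ rd) x) (eval-entryE x i next js))
        where
        quotient-nat : ∀ c B .{{_ : NonZero B}} → quotient (+ c) (+ B) ≡ + (c ℕ./ B)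
        quotient-nat c (suc B) = ℤ.*-identityˡ (+ (c ℕ./ suc B))
        next : eval σ (qe ⟨ div ⟩ reg 2) ≡ + (c ℕ./ B)
        next = trans (cong₂ quotient qe≡ (bits≡ rd)) (quotient-nat c B)
        digit : eval σ (qe ⟨ sub ⟩ ((qe ⟨ div ⟩ reg 2) ⟨ mul ⟩ reg 2)) ≡ + (c ℕ.% B)
        digit = begin
          eval σ qe ℤ.- eval σ (qe ⟨ div ⟩ reg 2) ℤ.* register σ 2
            ≡⟨ cong₂ ℤ._-_ qe≡ (trans (cong₂ ℤ._*_ next (bits≡ rd)) (sym (ℤ.pos-* (c ℕ./ B) B))) ⟩
          + c ℤ.- + (c ℕ./ B * B)
            ≡⟨ cong (λ z → + z ℤ.- + (c ℕ./ B * B)) (ℕ.m≡m%n+[m/n]*n c B) ⟩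
          + (c ℕ.% B) ℤ.+ + (c ℕ./ B * B) ℤ.- + (c ℕ./ B * B)
            ≡⟨ cancel (+ (c ℕ.% B)) (+ (c ℕ./ B * B)) ⟩
          + (c ℕ.% B) ∎
          where
          open ≡-Reasoning
          cancel : ∀ a b → a ℤ.+ b ℤ.- b ≡ a
          cancel = ℤ-solver.solve-∀
        power : array σ (suc k) (eval σ (qe ⟨ sub ⟩ ((qe ⟨ div ⟩ reg 2) ⟨ mul ⟩ reg 2))) ≡ +
          (2 ^ (c ℕ.% B))
        power = trans (cong (array σ (suc k)) digit) (trans (low≡ rd (suc k) (+ (c ℕ.% B)) ℕ.≤-refl)
          (trans (low-powers B (+ (c ℕ.% B))) (powerTable-< (ℕ.m%n<n c B))))

    card≤size : ∀ i → card (A i) ≤ size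
    card≤size = ≤foldr (card ∘ A)
      where
      ≤foldr : ∀ {m} (f : Fin m → ℕ) i → f i ≤ foldr _⊔_ 0 f
      ≤foldr f zero    = ℕ.m≤m⊔n (f zero) _
      ≤foldr f (suc i) = ℕ.≤-trans (≤foldr (f ∘ suc) i) (ℕ.m≤n⊔m (f zero) _)

    saved-all : ∀ {W} → size ≤ W → Problem.Within (FOPℤ φ) x W →
                All (λ z → ∣ z ∣ ≤ W) (List.tabulate (λ i → + card (A i)) ++ toList t)
    saved-all size≤ (_ , t≤) =
      All.++⁺ (All.tabulate⁺ {f = λ i → + card (A i)} λ i → ℕ.≤-trans (card≤size i) size≤)
        (VecAll.toList⁺ t≤)

    inputState-small : ∀ {W} → size ≤ W → Problem.Within (FOPℤ φ) x W → Small W inputState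
    inputState-small size≤ within@(A≤ , _) =
      load-small (saved-all size≤ within) (All.tabulate⁺ λ i → vectors-all (A≤ i))
      where
      vectors-all : ∀ {W m} {xs : List (Vec ℤ m)} → All (VecAll.All (λ z → ∣ z ∣ ≤ W)) xs →
                    All (λ z → ∣ z ∣ ≤ W) (concatMap toList xs)
      vectors-all []         = []
      vectors-all (px ∷ pxs) = All.++⁺ (VecAll.toList⁺ px) (vectors-all pxs)

    -- Bounds on the values of the expressions are read off a state all of
    -- whose cells are bounded.
    canonical : ℕ → ℕ → ℕ → State
    canonical B q s .register 1 = + size
    canonical B q s .register 2 = + B
    canonical B q s .register 5 = + q
    canonical B q s .register 6 = + s
    canonical B q s .register _ = 0ℤ
    canonical B q s .array      = low B

    canonical-ready : ∀ B q s → Ready B q s (canonical B q s)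
    canonical-ready B q s = ready refl refl refl refl λ _ _ _ → refl

    canonical-small : ∀ {W B q s} → size ≤ W → B ≤ W → q ≤ W → s ≤ W → (∀ {b} → b < B → 2 ^ b ≤ W) →
                      Problem.Within (FOPℤ φ) x W → Small W (canonical B q s)
    canonical-small {W} {B} {q} {s} size≤ B≤ q≤ s≤ pow≤ within = regs , arrs
      where
      regs : ∀ r → ∣ register (canonical B q s) r ∣ ≤ W
      regs 1 = size≤
      regs 2 = B≤
      regs 5 = q≤
      regs 6 = s≤
      regs 0 = z≤n
      regs 3 = z≤n
      regs 4 = z≤n
      regs (suc (suc (suc (suc (suc (suc (suc _))))))) = z≤n
      powers≤ : ∀ j → ∣ powerTable B j ∣ ≤ W
      powers≤ -[1+ _ ] = z≤n
      powers≤ (+ b) with b ℕ.<? B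
      ... | yes b<B = subst (λ z → ∣ z ∣ ≤ W) (sym (powerTable-< b<B)) (pow≤ b<B)
      ... | no b≮B  = subst (λ z → ∣ z ∣ ≤ W)
        (sym (cong (if_then + (2 ^ b) else 0ℤ) (dec-false (b ℕ.<? B) b≮B))) z≤n
      arrs : ∀ a j → ∣ low B a j ∣ ≤ W
      arrs a j = if-elim (λ z → ∣ z ∣ ≤ W) (does (a ℕ.≟ k))
        (contents-all z≤n (saved-all size≤ within) j)
        (if-elim (λ z → ∣ z ∣ ≤ W) (does (a ℕ.≟ suc k)) (powers≤ j)
          (array≤ (inputState-small size≤ within) a j))

    form-value : (s : ∀ i → Fin (card (A i))) → ∀ f →
                 sum (λ i → form i (toℕ (s i)) f) ≡ value t (λ i → List.lookup (elements (A i)) (s i)) f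
    form-value s f = begin
      sum (λ i → dots i ℤ.+ extra i f)                               ≡⟨ ∑-distrib-+ dots
        (λ i → extra i f) ⟩
      sum dots ℤ.+ sum (λ i → extra i f)                             ≡⟨ cong₂ ℤ._+_
        (sum-cong-≗ dots≡) extras ⟩
      sum (λ i → coeff i · vs i) ℤ.+ (param · t ℤ.+ const)           ≡⟨ sym
        (ℤ.+-assoc (sum (λ i → coeff i · vs i)) (param · t) const) ⟩
      sum (λ i → coeff i · vs i) ℤ.+ param · t ℤ.+ const             ∎
      where
      open ≡-Reasoning
      open Linear f
      vs : Assignment d
      vs i = List.lookup (elements (A i)) (s i)
      dots : Fin k → ℤ
      dots i = dotAt (coeff i) (vectors i) (toℕ (s i) * d i) 0
      dots≡ : ∀ i → dots i ≡ coeff i · vs i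
      dots≡ i = dotAt≡· (coeff i) (vs i) 0 (nth-concat (elements (A i)) (s i))
      extras : sum (λ i → extra i f) ≡ param · t ℤ.+ const
      extras = trans (cong (λ z → extra zero f ℤ.+ z) (sum-replicate-zero k′))
        (trans (ℤ.+-identityʳ (extra zero f)) (cong (λ z → z ℤ.+ const) (dotAt≡· param t 0 λ i →
          trans (nth-++ʳ (λ i → + card (A i)) (toList t) (toℕ i)) (nth-toList t i))))

    module _ {B X Y : ℕ} .{{_ : NonZero B}} (Y<2^B : Y < 2 ^ B) (X-large : k * Y + 2 * k < X)
             (form≤ : ∀ i {c} → c ∈ dnf ψ → ∀ {f} → f ∈ c → ∀ {s} → s < size → ∣ form i s f ∣ ≤ Y) where

      CodeSolution : Job → ℕ → Set
      CodeSolution js q = Σ[ s ∈ (Fin k → ℕ) ] (∀ i → s i < card (A i)) ×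
        sum (λ i → entry B X i (form i (s i)) q js) ≡ 0ℤ

      private
        <size : ∀ {s : Fin k → ℕ} → (∀ i → s i < card (A i)) → ∀ i → s i < size
        <size s< i = ℕ.<-≤-trans (s< i) (card≤size i)

      yes⇒code : (∀ i → Q i ≡ exists) → Problem.Yes (FOPℤ φ) x →
                 ∃[ js ] js ∈ jobs × ∃[ q ] q < B ^ length js × CodeSolution js q
      yes⇒code ∃s yes-
        with y , y∈ , holds ← prefixed⇒ A ∃s yes-
        with c , c∈ , positive ← Equivalence.to (sat-dnf t y ψ) holds =
        js , ∈-concatMap⁺ (expand (2 * k)) (Any.map (λ { refl → js∈ }) c∈) , q , q< ,
        toℕ ∘ s , (λ i → toℕ<n (s i)) , matches⇒entries B X forms q js matches
        where
        s : ∀ i → Fin (card (A i))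
        s i = Any.index (y∈ i)
        forms : Fin k → Form → ℤ
        forms i = form i (toℕ (s i))
        sum≡ : ∀ f → sum (λ i → forms i f) ≡ value t y f
        sum≡ f = trans (form-value s f) (value-cong t (λ i → sym (Any.lookup-index (y∈ i))) f)
        prefixes : All (λ f → ∃[ v ] 1 ≤ v × v ≤ 2 * k × AtomHolds B X forms (f , v)) c
        prefixes = All.tabulate λ {f} f∈ →
          let b , b<B , v , 1≤v , v≤ , eq = positive⇒prefix (λ i → forms i f) B
                (λ i → ℕ.≤-<-trans (form≤ i c∈ f∈ (<size (λ i → toℕ<n (s i)) i)) Y<2^B)
                (subst (0ℤ ℤ.<_) (sym (sum≡ f)) (All.lookup positive f∈))
          in v , 1≤v , v≤ , b , b<B , eq
        expanded = expand⁺ (2 * k) {P = AtomHolds B X forms} c prefixes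
        js = proj₁ expanded
        js∈ = proj₁ (proj₂ expanded)
        coded = holds⇒matches B X forms js (proj₂ (proj₂ expanded))
        q = proj₁ coded
        q< = proj₁ (proj₂ coded)
        matches = proj₂ (proj₂ coded)

      code⇒yes : (∀ i → Q i ≡ exists) → ∀ {js q} → js ∈ jobs → CodeSolution js q →
        Problem.Yes (FOPℤ φ) x
      code⇒yes ∃s {js} {q} js∈ (s , s< , sum≡0)
        with c , c∈ , js∈c ← Any-find (∈-concatMap⁻ (expand (2 * k)) js∈) =
        prefixed⇐ A (λ x≗y → Equivalence.to (⟦⟧-cong t x≗y ψ)) ∃s y (λ i → ∈-lookup (s′ i))
          (Equivalence.from (sat-dnf t y ψ) (c , c∈ , positive))
        where
        s′ : ∀ i → Fin (card (A i))
        s′ i = fromℕ< (s< i)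
        y : Assignment d
        y i = List.lookup (elements (A i)) (s′ i)
        forms : Fin k → Form → ℤ
        forms i = form i (s i)
        matches : Matches B X forms q js
        matches = entries⇒matches B X forms X-large q js
          (expand-atoms (2 * k) c js∈c (All.tabulate λ f∈ i → form≤ i c∈ f∈ (<size s< i))) sum≡0
        positive : All (Positive t y) c
        positive = All.map (λ {f} → λ where
          (v , 1≤v , _ , b , _ , eq) → subst (0ℤ ℤ.<_)
            (trans (sum-cong-≗ λ i → cong (λ s → form i s f) (sym (toℕ-fromℕ< (s< i))))
              (form-value s′ f))
            (prefix⇒positive (λ i → forms i f) b v 1≤v eq))
          (expand⁻ (2 * k) c js∈c (matches⇒holds B X forms q js matches))

-- The program of the reduction

seqFin : ∀ {m} → (Fin m → Cmd) → Cmd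
seqFin {zero}  f = skip
seqFin {suc m} f = f zero ︔ seqFin (f ∘ suc)

-- Registers: 0 the result, 3 and 4 as in Simulation, 7–9 scratch.  Array
-- K = k + 2 marks the values already present in the set being filled; marks
-- of different rounds are told apart by the number of the round.
module Program {k′ : ℕ} (φ : Formula (suc k′)) (p : Cmd) (y x D M : ℕ) where

  open Expressions φ public
  open Simulation (2 + k) public

  K : ℕ
  K = 2 + k

  -- The input registers overlap the working registers, so their contents move to array `k`, where
  -- they can moreover be addressed uniformly.
  save : ℕ → Cmd
  save zero    = skip
  save (suc j) = save j ︔ (k [ con (+ j) ]≔ reg j)

  maximum : ℕ → ℕ → Cmd
  maximum zero    a = 1 ≔ con 0ℤ
  maximum (suc m) a = maximum m (suc a) ︔
    (if>0 ((k [ con (+ a) ]) ⟨ sub ⟩ reg 1) then (1 ≔ (k [ con (+ a) ])) else skip)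

  powersBody : Cmd
  powersBody = (suc k [ reg 2 ]≔ reg 8) ︔ (8 ≔ (reg 8 ⟨ mul ⟩ con (+ 2))) ︔ (2 ≔ (reg 2 ⟨ add ⟩ con 1ℤ))

  -- Positive as long as the power in register 8 is at most `N ^ y`, the bound on all forms. So the
  -- loop ends with register 2 holding the least `B` such that `N ^ y < 2 ^ B`.
  powersTest : Exp
  powersTest = (powE y ⟨ add ⟩ con 1ℤ) ⟨ sub ⟩ reg 8

  powers : Cmd
  powers = (8 ≔ con 1ℤ) ︔ (2 ≔ con 0ℤ) ︔ (while>0 powersTest loop powersBody)

  clear : Cmd
  clear = (3 ≔ powE M) ︔ (4 ≔ con 0ℤ) ︔ (5 ≔ con 0ℤ) ︔ (0 ≔ con 0ℤ)

  setup : Cmd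
  setup = save (k + l) ︔ maximum k 0 ︔ powers ︔ clear

  stampE : Fin k → Exp
  stampE i = (reg 4 ⟨ mul ⟩ con (+ k)) ⟨ add ⟩ con (+ suc (toℕ i))

  dummyE : Exp
  dummyE = powE D ⟨ add ⟩ reg 6

  padC : Fin k → Cmd
  padC i = if>0 ((k [ con (+ toℕ i) ]) ⟨ sub ⟩ reg 6) then (8 ≔ reg 7) else (8 ≔ dummyE)

  -- No mark exceeds the stamp of the current round, so a smaller mark means that the value has not
  -- been seen in this round; marks need no erasing.
  distinctC : Fin k → Cmd
  distinctC i = if>0 (stampE i ⟨ sub ⟩ (K [ reg 8 ])) then (9 ≔ reg 8) else (9 ≔ dummyE)

  fillBody : Fin k → Job → Cmd
  fillBody i js =
    (6 ≔ (reg 6 ⟨ sub ⟩ con 1ℤ)) ︔ (7 ≔ entryE x i (reg 5) js) ︔ padC i ︔ distinctC i ︔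
    (K [ reg 8 ]≔ stampE i) ︔ (arrAt (toℕ i) [ place (reg 6) ]≔ reg 9)

  fill : Job → Fin k → Cmd
  fill js i = (6 ≔ reg 1) ︔ (while>0 reg 6 loop fillBody i js)

  collect : Cmd
  collect = if>0 (regAt 0 [ reg 4 ]) then (0 ≔ con 1ℤ) else skip

  call : Job → Cmd
  -- A k-SUM program expects the size in register 0, which is simulated by array `regAt 0`.
  call js = seqFin (fill js) ︔ (regAt 0 [ reg 4 ]≔ reg 1) ︔ simC p ︔ collect ︔
    (4 ≔ (reg 4 ⟨ add ⟩ con 1ℤ))

  powB : ℕ → Exp
  powB zero    = con 1ℤ
  powB (suc m) = reg 2 ⟨ mul ⟩ powB m

  jobC : Job → Cmd
  jobC js = (5 ≔ powB (length js)) ︔ (while>0 reg 5 loop ((5 ≔ (reg 5 ⟨ sub ⟩ con 1ℤ)) ︔ call js))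

  jobsC : List Job → Cmd
  jobsC []         = skip
  jobsC (js ∷ jss) = jobC js ︔ jobsC jss

  program : Cmd
  program = setup ︔ jobsC jobs

-- Correctness of the setup

saveTime : ℕ → ℕ
saveTime zero    = 1
saveTime (suc j) = saveTime j + 3

maxTime : ℕ → ℕ
maxTime zero    = 2
maxTime (suc m) = maxTime m + 8

nth-≥ : ∀ {A : Set} {z : A} xs {n} → length xs ≤ n → nth z xs n ≡ z
nth-≥ []       _                   = refl
nth-≥ (x ∷ xs) {suc n} (s≤s len≤) = nth-≥ xs len≤

module Setup {k′ : ℕ} (φ : Formula (suc k′)) (p : Cmd) (y x D M : ℕ) (I : ModelInstance φ)
             (Timed : Set) (v w : ℕ) where

  open Program φ p y x D M
  open ModelInstance I

  n N : ℕ
  n = size I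
  N = n + 2

  open Logic (2≤n+2 n) Timed v w

  input-zero : ∀ {a} j → k ≤ a → array (inputState I) a j ≡ 0ℤ
  input-zero {a} j k≤a = trans
    (cong (λ xs → contents xs j) (nth-≥ (List.tabulate λ i → concatMap toList (elements (A i)))
    (subst (_≤ a) (sym (List.length-tabulate λ i → concatMap toList (elements (A i)))) k≤a))) (empty j)
    where
    empty : ∀ j → contents [] j ≡ 0ℤ
    empty (+ _)    = refl
    empty -[1+ _ ] = refl

  record Saved (j : ℕ) (σ τ : State) : Set where
    constructor saved-state
    field
      others  : ∀ a i → a ≢ k → array τ a i ≡ array σ a i
      written : ∀ {i} → i < j → array τ k (+ i) ≡ register σ i
      unwritten : ∀ i → (∀ {m} → m < j → i ≢ + m) → array τ k i ≡ array σ k i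
      same-registers : ∀ r → register τ r ≡ register σ r

  run-save : ∀ j {σ} → degreeC v (save j) ≤ w → Small (N ^ v) σ →
    Run (save j) σ (saveTime j) (Saved j σ)
  run-save zero    deg sm = run-skip sm (saved-state (λ _ _ _ → refl) (λ ()) (λ _ _ → refl) λ _ → refl)
  run-save (suc j) {σ} deg sm = run-︔ (run-save j (ℕ.m+n≤o⇒m≤o dj deg) sm) λ {τ} smτ s →
    run-[]≔ (+ j) (register σ j) (ℕ.m+n≤o⇒n≤o dj deg) smτ refl (Saved.same-registers s j)
      (register≤ sm j)
      (saved-state
        (λ a i a≢k → trans (setArray-miss k (+ j) _ τ (inj₁ a≢k)) (Saved.others s a i a≢k))
        (λ {i} i<1+j → write s i (ℕ.m<1+n⇒m<n∨m≡n i<1+j))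
        (λ i out → trans (setArray-miss k (+ j) _ τ (inj₂ (out ℕ.≤-refl)))
                         (Saved.unwritten s i λ m<j → out (ℕ.m≤n⇒m≤1+n m<j)))
        (Saved.same-registers s))
    where
    dj = degreeC v (save j)
    write : ∀ {τ} → Saved j σ τ → ∀ i → i < j ⊎ i ≡ j →
            array (setArray k (+ j) (register σ j) τ) k (+ i) ≡ register σ i
    write {τ} s i (inj₁ i<j)  =
      trans (setArray-miss k (+ j) _ τ (inj₂ λ eq → ℕ.<⇒≢ i<j (ℤ.+-injective eq)))
      (Saved.written s i<j)
    write {τ} s i (inj₂ refl) = setArray-hit k (+ j) _ τ

  saved-input : ∀ {τ} → Saved (k + l) (inputState I) τ → ∀ i → array τ k i ≡ saved I i
  saved-input s i@(-[1+ _ ]) = trans (Saved.unwritten s i λ _ ()) (input-zero i ℕ.≤-refl)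
  saved-input s (+ i) with i ℕ.<? k + l
  ... | yes i< = Saved.written s i<
  ... | no i≮  = trans
    (trans (Saved.unwritten s (+ i) λ m< eq → i≮ (subst (_< k + l) (sym (ℤ.+-injective eq)) m<))
      (input-zero (+ i) ℕ.≤-refl))
    (sym (nth-≥ (List.tabulate (λ i → + card (A i)) ++ toList t) (subst (_≤ i) (sym len) (ℕ.≮⇒≥ i≮))))
    where
    len : length (List.tabulate (λ i → + card (A i)) ++ toList t) ≡ k + l
    len = trans (List.length-++ (List.tabulate (λ i → + card (A i))))
      (cong₂ _+_ (List.length-tabulate (λ i → + card (A i))) (VecProp.length-toList t))

  run-maximum : ∀ m a {σ} (f : Fin m → ℕ) → (∀ i → array σ k (+ (a + toℕ i)) ≡ + f i) →
                degreeC v (maximum m a) ≤ w → Small (N ^ v) σ →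
                Run (maximum m a) σ (maxTime m)
                  (λ τ → register τ 1 ≡ + foldr _⊔_ 0 f × array τ ≡ array σ)
  run-maximum zero    a f cells deg sm = run-≔ 0ℤ deg sm refl z≤n (refl , refl)
  run-maximum (suc m) a {σ} f cells deg sm =
    run-︔ (run-maximum m (suc a) (f ∘ suc)
      (λ i → trans (cong (λ b → array σ k (+ b)) (sym (ℕ.+-suc a (toℕ i)))) (cells (suc i)))
      (ℕ.m+n≤o⇒m≤o dm deg) sm) step
    where
    dm = degreeC v (maximum m (suc a))
    test = (k [ con (+ a) ]) ⟨ sub ⟩ reg 1
    here-cell : array σ k (+ a) ≡ + f zero
    here-cell = trans (cong (λ b → array σ k (+ b)) (sym (ℕ.+-identityʳ a))) (cells zero)
    deg-if = ℕ.m+n≤o⇒n≤o dm deg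
    step : ∀ {τ} → Small (N ^ v) τ → register τ 1 ≡ + foldr _⊔_ 0 (f ∘ suc) × array τ ≡ array σ →
           Run (if>0 test then (1 ≔ (k [ con (+ a) ])) else skip) τ 8
             (λ τ → register τ 1 ≡ + foldr _⊔_ 0 f × array τ ≡ array σ)
    step {τ} smτ (1≡ , arr≡) = run-if (ℕ.m+n≤o⇒m≤o (degree v test) deg-if) smτ
      (λ pos → run-≔ (+ f zero) (ℕ.m+n≤o⇒m≤o _ (ℕ.m+n≤o⇒n≤o (degree v test) deg-if)) smτ cell
        (subst (λ z → ∣ z ∣ ≤ N ^ v) cell (array≤ smτ k (+ a)))
        (cong +_ (sym (ℕ.m≥n⇒m⊔n≡m (ℕ.<⇒≤ (ℤ.drop‿+<+ (0<j-i⇒i<j (subst (0ℤ ℤ.<_) test≡ pos)))))) ,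
          arr≡))
      (λ neg → run-mono (s≤s z≤n) id (run-skip smτ
        (trans 1≡ (cong +_ (sym (ℕ.m≤n⇒m⊔n≡n
          (ℤ.drop‿+≤+ (ℤ.i-j≤0⇒i≤j (subst (ℤ._≤ 0ℤ) test≡ neg)))))) , arr≡)))
      where
      cell : array τ k (+ a) ≡ + f zero
      cell = trans (cong (λ ar → ar k (+ a)) arr≡) here-cell
      test≡ : eval τ test ≡ + f zero ℤ.- + foldr _⊔_ 0 (f ∘ suc)
      test≡ = cong₂ ℤ._-_ cell 1≡

  module _ {B : ℕ} (Y<2^B : N ^ y < 2 ^ B) (minimal : ∀ {b} → b < B → 2 ^ b ≤ N ^ y)
           (2^B≤ : 2 ^ B ≤ N ^ v) (B≤ : B ≤ N ^ v) where

    record Powering (ar : ℕ → ℤ → ℤ) (j : ℕ) (σ : State) : Set where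
      constructor powering
      field
        b : ℕ
        b+j≡B : b + j ≡ B
        size-kept : register σ 1 ≡ + n
        count≡ : register σ 2 ≡ + b
        power≡ : register σ 8 ≡ + (2 ^ b)
        table≡ : ∀ i → array σ (suc k) i ≡ powerTable b i
        others≡ : ∀ a i → a ≢ suc k → array σ a i ≡ ar a i

    powerTable-suc : ∀ b i → i ≢ + b → powerTable (suc b) i ≡ powerTable b i
    powerTable-suc b -[1+ _ ] i≢b = refl
    powerTable-suc b (+ i)    i≢b = cong (if_then + (2 ^ i) else 0ℤ) (same (i ℕ.<? b))
      where
      same : Dec (i < b) → does (i ℕ.<? suc b) ≡ does (i ℕ.<? b)
      same (yes i<b) = trans (dec-true (i ℕ.<? suc b) (ℕ.m≤n⇒m≤1+n i<b)) (sym (dec-true (i ℕ.<? b) i<b))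
      same (no i≮b)  = trans
        (dec-false (i ℕ.<? suc b) λ { (s≤s i≤b) → i≮b (ℕ.≤∧≢⇒< i≤b λ { refl → i≢b refl }) })
        (sym (dec-false (i ℕ.<? b) i≮b))

    bodyTime testTime : ℕ
    bodyTime = 3 + (4 + 4)
    testTime = 1 + cost powersTest

    run-powers-step : ∀ {ar j σ} → degreeC v powersBody ≤ w → Small (N ^ v) σ → Powering ar (suc j) σ →
                      Run powersBody σ bodyTime (Powering ar j)
    run-powers-step {ar} {j} {σ} deg sm (powering b b+j≡B size-kept count≡ power≡ table≡ others≡) =
      run-︔ (run-[]≔ {Q = _≡ σ₁} (+ b) (+ (2 ^ b)) (ℕ.m+n≤o⇒m≤o _ deg) sm count≡ power≡
        (ℕ.≤-trans (minimal b<B) (ℕ.≤-trans (ℕ.<⇒≤ Y<2^B) 2^B≤)) refl)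
      λ { sm₁ refl → run-︔ (run-≔ {Q = _≡ σ₂} (+ (2 ^ suc b))
        (ℕ.m+n≤o⇒m≤o _ (ℕ.m+n≤o⇒n≤o (v + v) deg)) sm₁ double
            (ℕ.≤-trans (ℕ.^-monoʳ-≤ 2 b<B) 2^B≤) refl)
      λ { sm₂ refl → run-≔ (+ suc b)
        (ℕ.m+n≤o⇒n≤o (degree v (reg 8 ⟨ mul ⟩ con (+ 2))) (ℕ.m+n≤o⇒n≤o (v + v) deg)) sm₂
            (trans (cong (λ z → z ℤ.+ 1ℤ) count≡) (cong +_ (ℕ.+-comm b 1))) (ℕ.≤-trans b<B B≤)
            (powering (suc b) (trans (sym (ℕ.+-suc b j)) b+j≡B) size-kept refl refl table′
              λ a i a≢ → trans (setArray-miss (suc k) (+ b) _ σ (inj₁ a≢)) (others≡ a i a≢)) } }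
      where
      σ₁ = setArray (suc k) (+ b) (+ (2 ^ b)) σ
      σ₂ = setRegister 8 (+ (2 ^ suc b)) σ₁
      b<B : b < B
      b<B = subst (b <_) b+j≡B (subst (b <_) (sym (ℕ.+-suc b j)) (s≤s (ℕ.m≤m+n b j)))
      double : register σ 8 ℤ.* + 2 ≡ + (2 ^ suc b)
      double = trans (cong (λ z → z ℤ.* + 2) power≡)
        (trans (sym (ℤ.pos-* (2 ^ b) 2)) (cong +_ (ℕ.*-comm (2 ^ b) 2)))
      table′ : ∀ i → array σ₁ (suc k) i ≡ powerTable (suc b) i
      table′ i = by-dec (i ℤ.≟ + b)
        where
        by-dec : Dec (i ≡ + b) → array σ₁ (suc k) i ≡ powerTable (suc b) i
        by-dec (yes refl) = trans (setArray-hit (suc k) (+ b) (+ (2 ^ b)) σ)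
          (sym (powerTable-< (ℕ.n<1+n b)))
        by-dec (no i≢b)   = trans (setArray-miss (suc k) (+ b) (+ (2 ^ b)) σ (inj₂ i≢b))
          (trans (table≡ i) (sym (powerTable-suc b i i≢b)))

    eval-powersTest : ∀ {ar j σ} (pw : Powering ar j σ) →
                      eval σ powersTest ≡ + suc (N ^ y) ℤ.- + (2 ^ Powering.b pw)
    eval-powersTest {σ = σ} pw = cong₂ ℤ._-_
      (trans (cong (λ z → z ℤ.+ 1ℤ) (eval-powE {σ} (Powering.size-kept pw) y))
        (cong +_ (ℕ.+-comm (N ^ y) 1)))
      (Powering.power≡ pw)

    powersTime : ℕ
    powersTime = 2 + (2 + (testTime + B * (testTime + bodyTime)))

    run-powers : ∀ {σ} → degreeC v powers ≤ w → Small (N ^ v) σ → register σ 1 ≡ + n →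
                 (∀ i → array σ (suc k) i ≡ 0ℤ) → Run powers σ powersTime (Powering (array σ) 0)
    run-powers {σ} deg sm 1≡n zeros =
      run-︔ (run-≔ {Q = _≡ setRegister 8 1ℤ σ} 1ℤ (ℕ.m+n≤o⇒m≤o 1 deg) sm refl 1≤N^v refl) λ { sm₁ refl →
      run-︔ (run-≔ {Q = _≡ setRegister 2 0ℤ (setRegister 8 1ℤ σ)} 0ℤ z≤n sm₁ refl z≤n refl)
        λ { sm₂ refl →
      run-while (Powering (array σ)) (ℕ.m+n≤o⇒m≤o (degree v powersTest) deg₂)
        (λ sm pw → subst (0ℤ ℤ.<_) (sym (eval-powersTest pw))
             (i<j⇒0<j-i (ℤ.+<+ (s≤s (minimal (b< pw))))) ,
           run-powers-step (ℕ.m+n≤o⇒n≤o (degree v powersTest) deg₂) sm pw)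
        (λ pw → subst (ℤ._≤ 0ℤ) (sym (eval-powersTest pw))
             (ℤ.i≤j⇒i-j≤0 (ℤ.+≤+ (subst (λ b → N ^ y < 2 ^ b)
               (sym (trans (sym (ℕ.+-identityʳ _)) (Powering.b+j≡B pw))) Y<2^B))))
        B sm₂ (powering 0 refl 1≡n refl refl (λ i → trans (zeros i) (sym (empty i))) λ _ _ _ → refl) } }
      where
      deg₂ = ℕ.m+n≤o⇒n≤o 1 deg
      1≤N^v : 1 ≤ N ^ v
      1≤N^v = ℕ.≤-trans (ℕ.m^n>0 2 B) 2^B≤
      empty : ∀ i → powerTable 0 i ≡ 0ℤ
      empty (+ _)    = refl
      empty -[1+ _ ] = refl
      b< : ∀ {ar j σ} (pw : Powering ar (suc j) σ) → Powering.b pw < B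
      b< {j = j} pw = subst (Powering.b pw <_)
        (trans (sym (ℕ.+-suc (Powering.b pw) j)) (Powering.b+j≡B pw)) (s≤s (ℕ.m≤m+n (Powering.b pw) j))

    record SetUp (σ : State) : Set where
      constructor set-up
      field
        result≡ : register σ 0 ≡ 0ℤ
        size≡   : register σ 1 ≡ + n
        bits≡   : register σ 2 ≡ + B
        M≡      : register σ 3 ≡ + (N ^ M)
        m≡      : register σ 4 ≡ 0ℤ
        code≡   : register σ 5 ≡ 0ℤ
        low≡    : ∀ a i → a < K → array σ a i ≡ low I B a i
        high≡   : ∀ a i → K ≤ a → array σ a i ≡ 0ℤ

    setupTime : ℕ
    setupTime = saveTime (k + l) + (maxTime k + (powersTime + (1 + cost (powE M) + 6)))

    run-setup : degreeC v setup ≤ w → N ^ M ≤ N ^ v → n ≤ N ^ v → Problem.Within (FOPℤ φ) I (N ^ v) →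
                Run setup (inputState I) setupTime SetUp
    run-setup deg M≤ n≤ within =
      run-︔ (run-save (k + l) (ℕ.m+n≤o⇒m≤o _ deg) (inputState-small I n≤ within)) λ {σ₁} sm₁ s →
      run-︔ (run-maximum k 0 (λ i → card (A i))
        (λ i → trans (saved-input s (+ toℕ i)) (nth-++ˡ (λ i → + card (A i)) (toList t) i))
        (ℕ.m+n≤o⇒m≤o _ deg₁) sm₁) λ { {σ₂} sm₂ (1≡ , arr≡) →
      run-︔ (run-powers (ℕ.m+n≤o⇒m≤o _ deg₂) sm₂ 1≡ λ i → trans (cong (λ ar → ar (suc k) i) arr≡)
        (trans (Saved.others s (suc k) i ℕ.1+n≢n) (input-zero i (ℕ.n≤1+n k)))) λ {σ₃} sm₃ pw →
      run-︔ (run-≔ {Q = _≡ setRegister 3 (+ (N ^ M)) σ₃} (+ (N ^ M)) (ℕ.m+n≤o⇒m≤o _ deg₃) sm₃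
        (eval-powE {σ₃} (Powering.size-kept pw) M) M≤ refl) λ { sm₄ refl →
      run-︔ (run-≔ {Q = _≡ setRegister 4 0ℤ (setRegister 3 (+ (N ^ M)) σ₃)} 0ℤ z≤n sm₄ refl z≤n
        refl) λ { sm₅ refl →
      run-︔ (run-≔ {Q = _≡ setRegister 5 0ℤ (setRegister 4 0ℤ (setRegister 3 (+ (N ^ M)) σ₃))} 0ℤ
        z≤n sm₅ refl z≤n refl) λ { sm₆ refl →
      run-≔ 0ℤ z≤n sm₆ refl z≤n (set-up refl (Powering.size-kept pw)
        (trans (Powering.count≡ pw) (cong +_ (b≡B pw))) refl refl refl
        (λ a i a<K → lows {σ₁} {σ₂} {σ₃} s arr≡ pw a i a<K (a ℕ.≟ k) (a ℕ.≟ suc k))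
        λ a i K≤a → trans (Powering.others≡ pw a i λ { refl → ℕ.1+n≰n K≤a })
          (trans (cong (λ ar → ar a i) arr≡)
            (trans (Saved.others s a i λ { refl → ℕ.1+n≰n (ℕ.≤-trans (ℕ.n≤1+n _) K≤a) })
            (input-zero i (ℕ.≤-trans (ℕ.m≤n+m k 2) K≤a))))) } } } }
      where
      deg₁ = ℕ.m+n≤o⇒n≤o (degreeC v (save (k + l))) deg
      deg₂ = ℕ.m+n≤o⇒n≤o (degreeC v (maximum k 0)) deg₁
      deg₃ = ℕ.m+n≤o⇒n≤o (degreeC v powers) deg₂
      b≡B : ∀ {ar σ} (pw : Powering ar 0 σ) → Powering.b pw ≡ B
      b≡B pw = trans (sym (ℕ.+-identityʳ _)) (Powering.b+j≡B pw)
      lows : ∀ {σ₁ σ₂ σ₃} → Saved (k + l) (inputState I) σ₁ → array σ₂ ≡ array σ₁ →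
        Powering (array σ₂) 0 σ₃ →
             ∀ a i → a < K → Dec (a ≡ k) → Dec (a ≡ suc k) → array σ₃ a i ≡ low I B a i
      lows s arr≡ pw a i a<K (yes refl) _ = trans (Powering.others≡ pw k i (ℕ.1+n≢n ∘ sym))
        (trans (cong (λ ar → ar k i) arr≡) (trans (saved-input s i) (sym (low-saved I B i))))
      lows s arr≡ pw a i a<K (no _) (yes refl) = trans (Powering.table≡ pw i)
        (trans (cong (λ b → powerTable b i) (b≡B pw)) (sym (low-powers I B i)))
      lows s arr≡ pw a i a<K (no a≢k) (no a≢k+1) = trans (Powering.others≡ pw a i a≢k+1)
        (trans (cong (λ ar → ar a i) arr≡) (trans (Saved.others s a i a≢k) (sym (low-input I B i
          (ℕ.≤∧≢⇒< (ℕ.<⇒≤pred (ℕ.≤∧≢⇒< (ℕ.<⇒≤pred a<K) a≢k+1)) a≢k)))))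

-- One call: filling the sets and running the k-SUM program

-- Meant for loop-free commands. The two branches of a conditional are added, which bounds either of
-- them.
straightTime : Cmd → ℕ
straightTime skip                   = 1
straightTime (r ≔ e)                = 1 + cost e
straightTime (a [ i ]≔ e)           = 1 + cost i + cost e
straightTime (p ︔ q)                = straightTime p + straightTime q
straightTime (if>0 e then p else q) = 1 + cost e + (straightTime p + straightTime q)
straightTime (while>0 e loop p)     = 0

-- The base value 1 is the cost of the `skip` that ends `seqFin`.
total : ∀ {m} → (Fin m → ℕ) → ℕ
total {zero}  f = 1
total {suc m} f = f zero + total (f ∘ suc)

module Calls {k′ : ℕ} (φ : Formula (suc k′)) (p : Cmd) (y x D M : ℕ) (I : ModelInstance φ)
             (Timed : Set) (v w : ℕ) where

  open Program φ p y x D M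
  open Setup φ p y x D M I Timed v w public using (n; N)
  open ModelInstance I
  open Logic (2≤n+2 n) Timed v w

  run-seqFin : ∀ {m} {f : Fin m → Cmd} {time : Fin m → ℕ} (J : ℕ → State → Set) →
    (∀ i {σ} → Small (N ^ v) σ → J (toℕ i) σ → Run (f i) σ (time i) (J (suc (toℕ i)))) →
    ∀ {σ} → Small (N ^ v) σ → J 0 σ → Run (seqFin f) σ (total time) (J m)
  run-seqFin {zero}  J step sm j = run-skip sm j
  run-seqFin {suc m} J step sm j =
    run-︔ (step zero sm j) λ sm′ j′ → run-seqFin (J ∘ suc) (step ∘ suc) sm′ j′

  run-branch : ∀ {p q e σ Q} → degree v e ≤ w → Small (N ^ v) σ →
               (0ℤ ℤ.< eval σ e → Run p σ (straightTime p) Q) →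
               (eval σ e ℤ.≤ 0ℤ → Run q σ (straightTime q) Q) →
               Run (if>0 e then p else q) σ (straightTime (if>0 e then p else q)) Q
  run-branch deg sm f g = run-if deg sm (λ pos → run-mono (ℕ.m≤m+n _ _) id (f pos))
                                        (λ neg → run-mono (ℕ.m≤n+m _ _) id (g neg))

  module Bounded {B H : ℕ} .{{_ : NonZero B}} (kH<D : k * H < N ^ D) (D+n≤ : N ^ D + n ≤ N ^ v)
           (Mk≤ : N ^ M * k ≤ N ^ v) where

    record Frozen (m q : ℕ) (r : ℤ) (σ : State) : Set where
      constructor frozen
      field
        result≡ : register σ 0 ≡ r
        size≡   : register σ 1 ≡ + n
        bits≡   : register σ 2 ≡ + B
        M≡      : register σ 3 ≡ + (N ^ M)
        m≡      : register σ 4 ≡ + m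
        code≡   : register σ 5 ≡ + q
        low≡    : ∀ a j → a < K → array σ a j ≡ low I B a j

    -- For a register of the form `6 + e` the lookups of registers 0 to 5 reduce, so all fields can
    -- be reused as they are.
    frozen-scratch : ∀ {m q r σ} e u → Frozen m q r σ → Frozen m q r (setRegister (6 + e) u σ)
    frozen-scratch e u (frozen a b c d f g l) = frozen a b c d f g l

    frozen-array : ∀ {m q r σ} b j u → K ≤ b → Frozen m q r σ → Frozen m q r (setArray b j u σ)
    frozen-array {σ = σ} b j u K≤b (frozen a c d f g h l) = frozen a c d f g h λ a′ i a′<K →
      trans (setArray-miss b j u σ (inj₁ λ { refl → ℕ.1+n≰n (ℕ.≤-trans a′<K K≤b) })) (l a′ i a′<K)

    frozen-ready : ∀ {m q r s σ} → Frozen m q r σ → register σ 6 ≡ + s → Ready I B q s σ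
    frozen-ready (frozen a b c d f g l) 6≡s = ready b c g 6≡s l

    FreshFrom : ℕ → State → Set
    FreshFrom m σ = ∀ b j m′ → K < b → m ≤ m′ → m′ < N ^ M → array σ b (j ℤ.* + (N ^ M) ℤ.+ + m′) ≡ 0ℤ

    -- The state between calls. Each call consumes `k` stamps and one residue class, so after `m`
    -- calls the marks are at most `m * k` and the classes from `m` on are still zero.
    record Idle (m q : ℕ) (r : ℤ) (σ : State) : Set where
      constructor idle
      field
        idle-frozen : Frozen m q r σ
        marks≤      : ∀ z → array σ K z ℤ.≤ + (m * k)
        unused      : FreshFrom m σ

    SolutionOf : Job → ℕ → Set
    SolutionOf js q = Σ[ s ∈ (Fin k → ℕ) ] (∀ i → s i < card (A i)) ×
      sum (λ i → entry B (N ^ x) i (form I i (s i)) q js) ≡ 0ℤ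

    fillTime : Job → Fin k → ℕ
    fillTime js i = 2 + (2 + n * (2 + straightTime (fillBody i js)))

    callTime : ℕ → Job → ℕ
    callTime T js = total (fillTime js) + (3 + (5 * T + (6 + 4)))

    module Call {js : Job} {q m : ℕ} {r : ℤ} (m<M : m < N ^ M)
                (h≤ : ∀ i {s} → s < n → ∣ entry B (N ^ x) i (form I i s) q js ∣ ≤ H) where

      h : Fin k → ℕ → ℤ
      h i s = entry B (N ^ x) i (form I i s) q js

      H<D : H < N ^ D
      H<D = ℕ.≤-<-trans (ℕ.m≤m+n H (k′ * H)) kH<D

      open Padded {k} {n} {N ^ D} {H} (λ i → card (A i)) h (card≤size I) h≤ kH<D H<D public

      input : State
      input = Problem.input (kSUM k) paddedInstance

      at : ℤ → ℤ
      at j = j ℤ.* + (N ^ M) ℤ.+ + m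

      input-family : ∀ i {s} → s < n → array input (toℕ i) (+ s) ≡ family i s
      input-family i {s} s<n = trans (input-array paddedInstance i (+ s))
        (trans (cong (nth 0ℤ (List.tabulate {n = n} (λ t → family i (toℕ t)))) (sym (toℕ-fromℕ< s<n)))
          (trans (nth-tabulate (λ t → family i (toℕ t)) (fromℕ< s<n))
            (cong (family i) (toℕ-fromℕ< s<n))))

      input-outside : ∀ i {j} → ¬ (∃[ s ] s < n × j ≡ + s) → array input (toℕ i) j ≡ 0ℤ
      input-outside i {j@(-[1+ _ ])} out = input-array paddedInstance i j
      input-outside i {+ s} out = trans (input-array paddedInstance i (+ s))
        (nth-≥ (List.tabulate {n = n} (λ t → family i (toℕ t)))
          (subst (_≤ s) (sym (List.length-tabulate {n = n} (λ t → family i (toℕ t))))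
            (ℕ.≮⇒≥ λ s<n → out (s , s<n , refl))))

      input-high : ∀ {a} j → k ≤ a → array input a j ≡ 0ℤ
      input-high {a} j k≤a = trans
        (cong (λ xs → contents xs j)
          (nth-≥ (List.tabulate λ i → elements (SumInstance.A paddedInstance i))
        (subst (_≤ a) (sym (List.length-tabulate λ i → elements (SumInstance.A paddedInstance i)))
          k≤a))) (empty j)
        where
        empty : ∀ j → contents [] j ≡ 0ℤ
        empty (+ _)    = refl
        empty -[1+ _ ] = refl

      -- The sets are filled one after the other, each from its highest index downwards. Cells from
      -- `n` on count as done from the start, being zero in the k-SUM input too.
      Done : ℕ → ℕ → ℕ → ℤ → Set
      Done i s a j = a < i ⊎ (a ≡ i × + s ℤ.≤ j)

      done? : ∀ i s a j → Dec (Done i s a j)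
      done? i s a j = (a ℕ.<? i) ⊎-dec ((a ℕ.≟ i) ×-dec (+ s ℤ.≤? j))

      record Filling (i s : ℕ) (σ : State) : Set where
        constructor filling
        field
          frozen-part    : Frozen m q r σ
          fresh          : FreshFrom (suc m) σ
          view-registers : ∀ a → array σ (regAt a) (+ m) ≡ 0ℤ
          done           : ∀ a j → Done i s a j → array σ (arrAt a) (at j) ≡ array input a j
          todo           : ∀ a j → ¬ Done i s a j → array σ (arrAt a) (at j) ≡ 0ℤ

      open Filling

      filling-scratch : ∀ {i s σ} e u → Filling i s σ → Filling i s (setRegister (6 + e) u σ)
      filling-scratch e u (filling a b c d f) = filling (frozen-scratch e u a) b c d f

      filling-mark : ∀ {i s σ} z u → Filling i s σ → Filling i s (setArray K z u σ)
      filling-mark {σ = σ} z u (filling a b c d f) = filling (frozen-array K z u ℕ.≤-refl a)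
        (λ b′ j m′ K<b m<m′ m′<M →
          trans (setArray-miss K z u σ (inj₁ λ { refl → ℕ.<-irrefl refl K<b }))
            (b b′ j m′ K<b m<m′ m′<M))
        (λ r → trans (setArray-miss K z u σ (inj₁ (≤K⇒≢regAt {r = r} ℕ.≤-refl ∘ sym))) (c r))
        (λ a′ j dn → trans (setArray-miss K z u σ (inj₁ (≤K⇒≢arrAt {a = a′} ℕ.≤-refl ∘ sym)))
          (d a′ j dn))
        (λ a′ j td → trans (setArray-miss K z u σ (inj₁ (≤K⇒≢arrAt {a = a′} ℕ.≤-refl ∘ sym)))
          (f a′ j td))

      K≤arrAt : ∀ a → K ≤ arrAt a
      K≤arrAt a = ℕ.≤-trans (ℕ.n≤1+n K) (ℕ.m≤m+n (suc K) (suc (2 * a)))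

      filling-write : ∀ {i s σ} → s < n → Filling (toℕ {k} i) (suc s) σ →
                      Filling (toℕ i) s (setArray (arrAt (toℕ i)) (at (+ s)) (family i s) σ)
      filling-write {i} {s} {σ} s<n (filling fz fr vr dn td) =
        filling (frozen-array a₀ j₀ u (K≤arrAt (toℕ i)) fz)
        (λ b j m′ K<b m<m′ m′<M → trans (setArray-miss a₀ j₀ u σ
          (inj₂ λ eq → ℕ.<⇒≢ m<m′ (sym (proj₂ (residue-unique j (+ s) m′<M m<M eq)))))
            (fr b j m′ K<b m<m′ m′<M))
        (λ r → trans (setArray-miss a₀ j₀ u σ (inj₁ (regAt≢arrAt {r} {toℕ i}))) (vr r))
        (λ a j d → done′ a j d (a ℕ.≟ toℕ i) (j ℤ.≟ + s))
        (λ a j ¬d → trans (setArray-miss a₀ j₀ u σ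
          (miss a j λ { (refl , refl) → ¬d (inj₂ (refl , ℤ.≤-refl)) }))
          (td a j λ { (inj₁ a<i) → ¬d (inj₁ a<i) ; (inj₂ (a≡i , s<j)) →
            ¬d (inj₂ (a≡i , ℤ.<⇒≤ (ℤ.<-≤-trans (ℤ.+<+ (ℕ.n<1+n s)) s<j))) }))
        where
        a₀ = arrAt (toℕ i)
        j₀ = at (+ s)
        u  = family i s
        miss : ∀ a j → ¬ (a ≡ toℕ i × j ≡ + s) → arrAt a ≢ a₀ ⊎ at j ≢ j₀
        miss a j ne with a ℕ.≟ toℕ i
        ... | no a≢i   = inj₁ (a≢i ∘ arrAt-injective)
        ... | yes refl = inj₂ λ eq → ne (refl , proj₁ (residue-unique j (+ s) m<M m<M eq))
        done′ : ∀ a j → Done (toℕ i) s a j → Dec (a ≡ toℕ i) → Dec (j ≡ + s) →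
                array (setArray a₀ j₀ u σ) (arrAt a) (at j) ≡ array input a j
        done′ a j d (yes refl) (yes refl) = trans (setArray-hit a₀ j₀ u σ) (sym (input-family i s<n))
        done′ a j d (no a≢i) _ = trans (setArray-miss a₀ j₀ u σ (miss a j (a≢i ∘ proj₁)))
          (dn a j (earlier d))
          where
          earlier : Done (toℕ i) s a j → Done (toℕ i) (suc s) a j
          earlier (inj₁ a<i)       = inj₁ a<i
          earlier (inj₂ (a≡i , _)) = contradiction a≡i a≢i
        done′ a j d (yes a≡i) (no j≢s) = trans (setArray-miss a₀ j₀ u σ (miss a j (j≢s ∘ proj₂)))
          (dn a j (earlier d))
          where
          earlier : Done (toℕ i) s a j → Done (toℕ i) (suc s) a j
          earlier (inj₁ a<i)       = inj₁ a<i
          earlier (inj₂ (a≡i , s≤j)) = inj₂ (a≡i , ℤ.i<j⇒suc[i]≤j (ℤ.≤∧≢⇒< s≤j (j≢s ∘ sym)))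

      module Round (i : Fin k) where

        stamp : ℕ
        stamp = m * k + suc (toℕ i)

        pad : ℕ → ℤ
        pad = padded (N ^ D) (card (A i)) (h i)

        record Loop (s : ℕ) (σ : State) : Set where
          constructor loop
          field
            filled   : Filling (toℕ i) s σ
            index≡   : register σ 6 ≡ + s
            s≤n      : s ≤ n
            seen-in  : ∀ z → Seen pad s n z → array σ K z ≡ + stamp
            seen-out : ∀ z → ¬ Seen pad s n z → array σ K z ℤ.< + stamp

        stamp≤ : stamp ≤ N ^ v
        stamp≤ = ℕ.≤-trans (ℕ.+-monoʳ-≤ (m * k) (toℕ<n i))
          (ℕ.≤-trans (ℕ.≤-reflexive (ℕ.+-comm (m * k) k)) (ℕ.≤-trans (ℕ.*-monoˡ-≤ k m<M) Mk≤))

        dummy≤ : ∀ {s} → s ≤ n → N ^ D + s ≤ N ^ v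
        dummy≤ s≤n = ℕ.≤-trans (ℕ.+-monoʳ-≤ (N ^ D) s≤n) D+n≤

        H≤ : ∀ {z} → ∣ z ∣ ≤ H → ∣ z ∣ ≤ N ^ v
        H≤ z≤ = ℕ.≤-trans z≤ (ℕ.≤-trans (ℕ.<⇒≤ H<D) (ℕ.≤-trans (ℕ.m≤m+n (N ^ D) n) D+n≤))

        pad≤ : ∀ {s} → s < n → ∣ pad s ∣ ≤ N ^ v
        pad≤ {s} s<n with padded-cases (card (A i)) (h i) (h<D i) s
        ... | inj₁ eq       = subst (λ z → ∣ z ∣ ≤ N ^ v) (sym eq) (dummy≤ (ℕ.<⇒≤ s<n))
        ... | inj₂ (_ , eq) = subst (λ z → ∣ z ∣ ≤ N ^ v) (sym eq) (H≤ {h i s} (h≤ i s<n))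

        eval-dummyE : ∀ {σ s} → register σ 1 ≡ + n → register σ 6 ≡ + s → eval σ dummyE ≡ + (N ^ D + s)
        eval-dummyE {σ} 1≡ 6≡ = cong₂ ℤ._+_ (eval-powE {σ} 1≡ D) 6≡

        eval-stampE : ∀ {σ} → Frozen m q r σ → eval σ (stampE i) ≡ + stamp
        eval-stampE fz = cong (λ z → z ℤ.+ + suc (toℕ i))
          (trans (cong (λ z → z ℤ.* + k) (Frozen.m≡ fz)) (sym (ℤ.pos-* m k)))

        run-padC : ∀ {σ s} → degreeC v (padC i) ≤ w → Small (N ^ v) σ → Frozen m q r σ →
          register σ 6 ≡ + s → s < n →
                   register σ 7 ≡ h i s → Run (padC i) σ (straightTime (padC i))
                     (_≡ setRegister 8 (pad s) σ)
        run-padC {σ} {s} deg sm fz 6≡ s<n 7≡ = run-branch (ℕ.m+n≤o⇒m≤o dt deg) sm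
          (λ pos → run-≔ (pad s) (ℕ.m+n≤o⇒m≤o v (ℕ.m+n≤o⇒n≤o dt deg)) sm
            (trans 7≡ (sym (padded-< {N ^ D} {card (A i)} {h i}
              (ℤ.drop‿+<+ (0<j-i⇒i<j (subst (0ℤ ℤ.<_) test≡ pos)))))) (pad≤ s<n) refl)
          (λ neg → run-≔ (pad s) (ℕ.m+n≤o⇒n≤o v (ℕ.m+n≤o⇒n≤o dt deg)) sm
            (trans (eval-dummyE {σ} (Frozen.size≡ fz) 6≡) (sym (padded-≥ {N ^ D} {card (A i)} {h i}
              (ℕ.≤⇒≯ (ℤ.drop‿+≤+ (ℤ.i-j≤0⇒i≤j (subst (ℤ._≤ 0ℤ) test≡ neg))))))) (pad≤ s<n) refl)
          where
          test = (k [ con (+ toℕ i) ]) ⟨ sub ⟩ reg 6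
          dt = degree v test
          test≡ : eval σ test ≡ + card (A i) ℤ.- + s
          test≡ = cong₂ ℤ._-_ (trans (Frozen.low≡ fz k (+ toℕ i) (ℕ.≤-trans (ℕ.n≤1+n _) ℕ.≤-refl))
            (trans (low-saved I B (+ toℕ i)) (nth-++ˡ (λ i → + card (A i)) (toList t) i))) 6≡

        run-distinctC : ∀ {σ s} → degreeC v (distinctC i) ≤ w → Small (N ^ v) σ → Frozen m q r σ →
                        register σ 6 ≡ + s → s < n → register σ 8 ≡ pad s →
                        (∀ z → Seen pad (suc s) n z → array σ K z ≡ + stamp) →
                        (∀ z → ¬ Seen pad (suc s) n z → array σ K z ℤ.< + stamp) →
                        Run (distinctC i) σ (straightTime (distinctC i))
                          (_≡ setRegister 9 (family i s) σ)
        run-distinctC {σ} {s} deg sm fz 6≡ s<n 8≡ seen-in seen-out = run-branch (ℕ.m+n≤o⇒m≤o dt deg) sm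
          (λ pos → run-≔ (family i s) (ℕ.m+n≤o⇒m≤o v (ℕ.m+n≤o⇒n≤o dt deg)) sm
            (trans 8≡ (sym (distinct-fresh pad λ seen →
              ℤ.<-irrefl (seen-in (pad s) seen) (marked pos)))) family≤ refl)
          (λ neg → run-≔ (family i s) (ℕ.m+n≤o⇒n≤o v (ℕ.m+n≤o⇒n≤o dt deg)) sm
            (trans (eval-dummyE {σ} (Frozen.size≡ fz) 6≡) (sym (distinct-seen pad
              (decidable-stable (seen? pad (suc s) n (pad s)) λ ¬seen →
                ℤ.<⇒≱ (seen-out (pad s) ¬seen) (unmarked neg))))) family≤ refl)
          where
          test = stampE i ⟨ sub ⟩ (K [ reg 8 ])
          dt = degree v test
          test≡ : eval σ test ≡ + stamp ℤ.- array σ K (pad s)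
          test≡ = cong₂ ℤ._-_ (eval-stampE fz) (cong (array σ K) 8≡)
          marked : 0ℤ ℤ.< eval σ test → array σ K (pad s) ℤ.< + stamp
          marked pos = 0<j-i⇒i<j (subst (0ℤ ℤ.<_) test≡ pos)
          unmarked : eval σ test ℤ.≤ 0ℤ → + stamp ℤ.≤ array σ K (pad s)
          unmarked neg = ℤ.i-j≤0⇒i≤j (subst (ℤ._≤ 0ℤ) test≡ neg)
          family≤ : ∣ family i s ∣ ≤ N ^ v
          family≤ = ℕ.≤-trans (distinct-bound (card (A i)) (h i) (h<D i) s<n) D+n≤

        run-body : ∀ {σ s} → degreeC v (fillBody i js) ≤ w → Small (N ^ v) σ → Loop (suc s) σ →
                   Run (fillBody i js) σ (straightTime (fillBody i js)) (Loop s)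
        run-body {σ} {s} deg sm (loop fl 6≡ s<n seen-in seen-out) =
          run-︔ (run-≔ {Q = _≡ σ₁} (+ s) (ℕ.m+n≤o⇒m≤o _ deg) sm
            (trans (cong (λ z → z ℤ.- 1ℤ) 6≡) refl) s≤N refl) λ { sm₁ refl →
          run-︔ (run-≔ {Q = _≡ σ₂} (h i s) (ℕ.m+n≤o⇒m≤o _ deg₁) sm₁
            (eval-entryE I (frozen-ready (frozen-scratch 0 (+ s) fz) refl) x i (Frozen.code≡ fz) js)
              (H≤ {h i s} (h≤ i s<n)) refl) λ { sm₂ refl →
          run-︔ (run-padC (ℕ.m+n≤o⇒m≤o _ deg₂) sm₂
            (frozen-scratch 1 (h i s) (frozen-scratch 0 (+ s) fz)) refl s<n refl) λ { sm₃ refl →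
          run-︔ (run-distinctC (ℕ.m+n≤o⇒m≤o _ deg₃) sm₃ fz₃ refl s<n refl seen-in seen-out)
            λ { sm₄ refl →
          run-︔ (run-[]≔ {Q = _≡ σ₅} (pad s) (+ stamp) (ℕ.m+n≤o⇒m≤o _ deg₄) sm₄ refl
            (eval-stampE fz₃) stamp≤ refl) λ { sm₅ refl →
          run-[]≔ (at (+ s)) (family i s) (ℕ.m+n≤o⇒n≤o (degreeC v (K [ reg 8 ]≔ stampE i)) deg₄) sm₅
            (eval-place m<M {σ₅} (reg 6) (Frozen.M≡ fz) (Frozen.m≡ fz) refl) refl
            (ℕ.≤-trans (distinct-bound (card (A i)) (h i) (h<D i) s<n) D+n≤)
            (loop (filling-write s<n (filling-mark (pad s) (+ stamp)
              (filling-scratch 3 (family i s)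
                (filling-scratch 2 (pad s) (filling-scratch 1 (h i s) (filling-scratch 0 (+ s) fl))))))
                  refl (ℕ.<⇒≤ s<n) (λ z → in′ z) λ z → out′ z) } } } } }
          where
          fz = frozen-part fl
          σ₁ = setRegister 6 (+ s) σ
          σ₂ = setRegister 7 (h i s) σ₁
          σ₃ = setRegister 8 (pad s) σ₂
          σ₄ = setRegister 9 (family i s) σ₃
          σ₅ = setArray K (pad s) (+ stamp) σ₄
          σ₆ = setArray (arrAt (toℕ i)) (at (+ s)) (family i s) σ₅
          fz₃ = frozen-scratch 2 (pad s) (frozen-scratch 1 (h i s) (frozen-scratch 0 (+ s) fz))
          s≤N : s ≤ N ^ v
          s≤N = ℕ.≤-trans (ℕ.<⇒≤ s<n) (ℕ.≤-trans (ℕ.m≤n+m n (N ^ D)) D+n≤)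
          deg₁ = ℕ.m+n≤o⇒n≤o (degreeC v (6 ≔ (reg 6 ⟨ sub ⟩ con 1ℤ))) deg
          deg₂ = ℕ.m+n≤o⇒n≤o (degreeC v (7 ≔ entryE x i (reg 5) js)) deg₁
          deg₃ = ℕ.m+n≤o⇒n≤o (degreeC v (padC i)) deg₂
          deg₄ = ℕ.m+n≤o⇒n≤o (degreeC v (distinctC i)) deg₃
          seen-cell : ∀ z → array σ₆ K z ≡ array σ₅ K z
          seen-cell z = setArray-miss (arrAt (toℕ i)) (at (+ s)) (family i s) σ₅
            (inj₁ (≤K⇒≢arrAt {a = toℕ i} ℕ.≤-refl))
          hit : ∀ {z} → z ≡ pad s → array σ₆ K z ≡ + stamp
          hit refl = trans (seen-cell (pad s)) (setArray-hit K (pad s) (+ stamp) σ₄)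
          miss : ∀ {z} → z ≢ pad s → array σ₆ K z ≡ array σ K z
          miss {z} ne = trans (seen-cell z) (setArray-miss K (pad s) (+ stamp) σ₄ (inj₂ ne))
          in′ : ∀ z → Seen pad s n z → array σ₆ K z ≡ + stamp
          in′ z (t , t<n , s≤t , eq) = by-dec (z ℤ.≟ pad s)
            where
            by-dec : Dec (z ≡ pad s) → array σ₆ K z ≡ + stamp
            by-dec (yes z≡) = hit z≡
            by-dec (no z≢)  = trans (miss z≢) (seen-in z
              (t , t<n , ℕ.≤∧≢⇒< s≤t (λ { refl → z≢ (sym eq) }) , eq))
          out′ : ∀ z → ¬ Seen pad s n z → array σ₆ K z ℤ.< + stamp
          out′ z ¬seen = subst (ℤ._< + stamp) (sym (miss λ z≡ → ¬seen (s , s<n , ℕ.≤-refl , sym z≡)))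
            (seen-out z λ { (t , t<n , s<t , eq) → ¬seen (t , t<n , ℕ.<⇒≤ s<t , eq) })

      Rounds : ℕ → State → Set
      Rounds i σ = Filling i n σ × (∀ z → array σ K z ℤ.≤ + (m * k + i))

      input-beyond : ∀ a {j} → + n ℤ.≤ j → array input a j ≡ 0ℤ
      input-beyond a {j} n≤j with a ℕ.<? k
      ... | no a≮k  = input-high j (ℕ.≮⇒≥ a≮k)
      ... | yes a<k = subst (λ b → array input b j ≡ 0ℤ) (toℕ-fromℕ< a<k)
        (input-outside (fromℕ< a<k) {j} λ { (s , s<n , refl) → ℕ.<⇒≱ s<n (ℤ.drop‿+≤+ n≤j) })

      -- Once index 0 is reached, array `i` agrees with the k-SUM input everywhere: its cells at
      -- negative addresses are zero on both sides. The same holds for the cells from `n` on in the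
      -- next array.
      next-round : ∀ {i σ} → Filling (toℕ {k} i) 0 σ → Filling (suc (toℕ i)) n σ
      next-round {i} {σ} (filling fz fr vr dn td) = filling fz fr vr dn′
        λ a j ¬d → td a j λ { (inj₁ a<i) → ¬d (inj₁ (ℕ.m≤n⇒m≤1+n a<i)) ; (inj₂ (refl , _)) →
          ¬d (inj₁ ℕ.≤-refl) }
        where
        last : ∀ j → array σ (arrAt (toℕ i)) (at j) ≡ array input (toℕ i) j
        last (+ s)    = dn (toℕ i) (+ s) (inj₂ (refl , ℤ.+≤+ z≤n))
        last j@(-[1+ _ ]) = trans (td
          (toℕ i) j λ { (inj₁ i<i) → ℕ.<-irrefl refl i<i ; (inj₂ (_ , ())) })
          (sym (input-outside i {j} λ { (_ , _ , ()) }))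
        dn′ : ∀ a j → Done (suc (toℕ i)) n a j → array σ (arrAt a) (at j) ≡ array input a j
        dn′ a j (inj₁ a<1+i) with ℕ.m<1+n⇒m<n∨m≡n a<1+i
        ... | inj₁ a<i  = dn a j (inj₁ a<i)
        ... | inj₂ refl = last j
        dn′ a j (inj₂ (refl , n≤j)) = trans
          (td a j λ { (inj₁ a<i) → ℕ.<-irrefl refl (ℕ.<-trans a<i (ℕ.n<1+n (toℕ i))) ;
            (inj₂ (eq , _)) → ℕ.1+n≢n eq })
          (sym (input-beyond a n≤j))

      n≤N^v : n ≤ N ^ v
      n≤N^v = ℕ.≤-trans (ℕ.m≤n+m n (N ^ D)) D+n≤

      run-fill : ∀ i {σ} → degreeC v (fill js i) ≤ w → Small (N ^ v) σ → Rounds (toℕ i) σ →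
                 Run (fill js i) σ (fillTime js i) (Rounds (suc (toℕ i)))
      run-fill i {σ} deg sm (fl , marks) =
        run-︔ (run-≔ {Q = _≡ setRegister 6 (+ n) σ} (+ n) (ℕ.m+n≤o⇒m≤o v deg) sm
          (Frozen.size≡ (frozen-part fl)) n≤N^v refl) λ { sm₁ refl →
        run-mono ℕ.≤-refl finish (run-while Loop (ℕ.m+n≤o⇒m≤o v (ℕ.m+n≤o⇒n≤o v deg))
          (λ smσ lp → subst (0ℤ ℤ.<_) (sym (Loop.index≡ lp)) (ℤ.+<+ (s≤s z≤n)) ,
                      run-body (ℕ.m+n≤o⇒n≤o v (ℕ.m+n≤o⇒n≤o v deg)) smσ lp)
          (λ lp → ℤ.≤-reflexive (Loop.index≡ lp))
          n sm₁ (loop (filling-scratch 0 (+ n) fl) refl ℕ.≤-refl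
            (λ { z (t , t<n , n≤t , _) → contradiction n≤t (ℕ.<⇒≱ t<n) })
            λ z _ → ℤ.≤-<-trans (marks z) (ℤ.+<+ (ℕ.+-monoʳ-< (m * k) (ℕ.n<1+n (toℕ i)))))) }
        where
        open Round i
        finish : ∀ {τ} → Loop 0 τ → Rounds (suc (toℕ i)) τ
        finish {τ} (loop fl′ _ _ seen-in seen-out) = next-round fl′ , λ z → by-dec z (seen? pad 0 n z)
          where
          by-dec : ∀ z → Dec (Seen pad 0 n z) → array τ K z ℤ.≤ + stamp
          by-dec z (yes seen) = ℤ.≤-reflexive (seen-in z seen)
          by-dec z (no ¬seen) = ℤ.<⇒≤ (seen-out z ¬seen)

      view-input : ∀ {σ} → Filling k n σ →
                   view (N ^ M) m (setArray (regAt 0) (+ m) (+ n) σ) ≋ input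
      view-input {σ} (filling fz fr vr dn td) = regs , arrs
        where
        τ = setArray (regAt 0) (+ m) (+ n) σ
        regs : ∀ r → array τ (regAt r) (+ m) ≡ register input r
        regs zero    = setArray-hit (regAt 0) (+ m) (+ n) σ
        regs (suc r) = trans (setArray-miss (regAt 0) (+ m) (+ n) σ
          (inj₁ λ eq → ℕ.1+n≢0 (regAt-injective {suc r} {0} eq))) (vr (suc r))
        arrs : ∀ a j → array τ (arrAt a) (at j) ≡ array input a j
        arrs a j = trans (setArray-miss (regAt 0) (+ m) (+ n) σ (inj₁ (regAt≢arrAt {0} {a} ∘ sym)))
          (by-dec (done? k n a j))
          where
          by-dec : Dec (Done k n a j) → array σ (arrAt a) (at j) ≡ array input a j
          by-dec (yes d) = dn a j d
          by-dec (no ¬d) = trans (td a j ¬d) (sym (input-high j (ℕ.≮⇒≥ λ a<k → ¬d (inj₁ a<k))))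

      Updated : ℤ → Set
      Updated r′ = (r′ ≡ 1ℤ × SolutionOf js q) ⊎ (r′ ≡ r × ¬ SolutionOf js q)

      module _ {W T : ℕ} (W≤ : W * N ^ M + N ^ M ≤ N ^ w) (W≤N^v : W ≤ N ^ v)
               (solve : ∃[ σ ] ∃[ t ] W ⊢ p , input ⇓ σ after t
                        × Answers (Problem.Yes (kSUM k) paddedInstance) σ × (Timed → t ≤ T)) where

        Called : State → Set
        Called τ = ∃[ r′ ] Idle (suc m) q r′ τ × Updated r′

        Collected : State → Set
        Collected τ = ∃[ r′ ] Frozen m q r′ τ × Updated r′ ×
          (∀ z → array τ K z ℤ.≤ + (m * k + k)) × FreshFrom (suc m) τ

        1≤N^v : 1 ≤ N ^ v
        1≤N^v = ℕ.≤-trans (ℕ.≤-trans (s≤s z≤n) H<D) (ℕ.≤-trans (ℕ.m≤m+n (N ^ D) n) D+n≤)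

        run-collect : ∀ {τ σ} → Simulates (N ^ M) m τ σ →
          Answers (Problem.Yes (kSUM k) paddedInstance) σ →
                      degreeC v collect ≤ w → Small (N ^ v) τ → Frozen m q r τ →
                      (∀ z → array τ K z ℤ.≤ + (m * k + k)) →
                      FreshFrom (suc m) τ →
                      Run collect τ 6 Collected
        run-collect {τ} {σ} s answer deg sm fz@(frozen a b c d f g l) marks fr =
          run-branch (ℕ.m+n≤o⇒m≤o dt deg) sm (on-pos answer) (on-neg answer)
          where
          dt = degree v (regAt 0 [ reg 4 ])
          result : array τ (regAt 0) (register τ 4) ≡ register σ 0
          result = trans (cong (array τ (regAt 0)) (m≡ s)) (register≡ (view≋ s) 0)
          on-pos : Answers (Problem.Yes (kSUM k) paddedInstance) σ →
            0ℤ ℤ.< array τ (regAt 0) (register τ 4) → Run (0 ≔ con 1ℤ) τ 2 Collected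
          on-pos (inj₁ (_ , yes-)) pos = run-≔ 1ℤ (ℕ.m+n≤o⇒m≤o 1 (ℕ.m+n≤o⇒n≤o dt deg)) sm refl 1≤N^v
            (1ℤ , frozen refl b c d f g l , inj₁ (refl , yes⇒solution yes-) , marks , fr)
          on-pos (inj₂ (0≡ , _)) pos = contradiction (trans result 0≡) (λ eq → ℤ.<-irrefl (sym eq) pos)
          on-neg : Answers (Problem.Yes (kSUM k) paddedInstance) σ →
            array τ (regAt 0) (register τ 4) ℤ.≤ 0ℤ → Run skip τ 1 Collected
          on-neg (inj₁ (1≡ , _)) neg = contradiction
            (subst (ℤ._≤ 0ℤ) (trans result 1≡) neg) λ { (ℤ.+≤+ ()) }
          on-neg (inj₂ (_ , no-)) neg = run-skip sm
            (r , fz , inj₂ (refl , no- ∘ solution⇒yes) , marks , fr)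

        run-sim : ∀ {σ} → Small (N ^ v) σ → Simulates (N ^ M) m σ input →
                  Run (simC p) σ (5 * T) (λ τ → Frame (N ^ M) m σ τ ×
                    ∃[ σ′ ] Simulates (N ^ M) m τ σ′ × Answers (Problem.Yes (kSUM k) paddedInstance) σ′)
        run-sim sm s =
          let σ′ , t , d , answer , time         = solve
              τ , t′ , d′ , t′≤ , s′ , f , sm′   = simulate m<M W≤ W≤N^v d s sm
          in ran d′ (λ timed → ℕ.≤-trans t′≤ (ℕ.*-monoʳ-≤ 5 (time timed))) sm′ (f , σ′ , s′ , answer)

        run-call : ∀ {σ} → degreeC v (call js) ≤ w → Small (N ^ v) σ → Idle m q r σ →
          Run (call js) σ (callTime T js) Called
        run-call {σ} deg sm (idle fz marks fr) =
          run-︔ (run-seqFin Rounds (λ i → run-fill i (degree-seqFin (fill js) i (ℕ.m+n≤o⇒m≤o _ deg))) sm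
            (filling fz (λ b j m′ K<b m<m′ → fr b j m′ K<b (ℕ.<⇒≤ m<m′))
              (λ a → trans (cong (array σ (regAt a)) (sym (ℤ.+-identityˡ (+ m))))
                (fr (regAt a) 0ℤ m (s≤s (ℕ.m≤m+n K (2 * a))) ℕ.≤-refl m<M))
              (λ { a j (inj₂ (refl , n≤j)) →
                trans (fr (arrAt 0) j m (s≤s (ℕ.m≤m+n K 1)) ℕ.≤-refl m<M) (sym (input-beyond 0 n≤j)) })
              (λ a j _ → fr (arrAt a) j m (s≤s (ℕ.m≤m+n K (suc (2 * a)))) ℕ.≤-refl m<M) ,
             λ z → subst (λ b → array σ K z ℤ.≤ + b) (sym (ℕ.+-identityʳ (m * k))) (marks z)))
          λ {σ₁} sm₁ (fl , marks₁) →
          run-︔ (run-[]≔ {Q = _≡ setArray (regAt 0) (+ m) (+ n) σ₁} (+ m) (+ n) (ℕ.m+n≤o⇒m≤o _ deg₁) sm₁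
            (Frozen.m≡ (frozen-part fl)) (Frozen.size≡ (frozen-part fl)) n≤N^v refl) λ { sm₂ refl →
          run-︔ (run-sim sm₂ (simulates (Frozen.M≡ (frozen-part fl)) (Frozen.m≡ (frozen-part fl))
            (view-input fl)))
          λ { {τ} sm₃ (f , σ′ , s′ , answer) →
          run-︔ (run-collect s′ answer (ℕ.m+n≤o⇒m≤o _ deg₃) sm₃
            (frozen-frame (frozen-array (regAt 0) (+ m) (+ n)
              (ℕ.≤-trans (ℕ.n≤1+n K) (ℕ.m≤m+n (suc K) 0)) (frozen-part fl)) f)
            (λ z → subst (ℤ._≤ + (m * k + k)) (sym (trans (cells f K z (inj₁ ℕ.≤-refl))
              (setArray-miss (regAt 0) (+ m) (+ n) σ₁ (inj₁ (≤K⇒≢regAt {r = 0} ℕ.≤-refl))))) (marks₁ z))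
            λ b j m′ K<b m<m′ m′<M → trans
              (cells f b _ (inj₂ λ j′ eq → ℕ.<⇒≢ m<m′ (sym (proj₂ (residue-unique j j′ m′<M m<M eq)))))
              (trans (setArray-miss (regAt 0) (+ m) (+ n) σ₁
                (inj₂ λ eq → ℕ.<⇒≢ m<m′ (sym (proj₂ (residue-unique j 0ℤ m′<M m<M
                (trans eq (sym (ℤ.+-identityˡ (+ m)))))))))
                (fresh fl b j m′ K<b m<m′ m′<M)))
          λ { {τ₂} sm₄ (r′ , fz₄@(frozen a b c d g e l) , upd , marks₄ , fr₄) →
          run-≔ (+ suc m) (ℕ.m+n≤o⇒n≤o (degreeC v collect) deg₃) sm₄
            (trans (cong (λ z → z ℤ.+ 1ℤ) (Frozen.m≡ fz₄)) (cong +_ (ℕ.+-comm m 1)))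
            (ℕ.≤-trans m<M (ℕ.≤-trans (ℕ.m≤m*n (N ^ M) k) Mk≤))
            (r′ , idle (frozen a b c d refl e l)
              (λ z → subst (λ u → array τ₂ K z ℤ.≤ + u) (ℕ.+-comm (m * k) k) (marks₄ z))
              fr₄ , upd) } } }
          where
          deg₁ = ℕ.m+n≤o⇒n≤o (degreeC v (seqFin (fill js))) deg
          deg₂ = ℕ.m+n≤o⇒n≤o (degreeC v (regAt 0 [ reg 4 ]≔ reg 1)) deg₁
          deg₃ = ℕ.m+n≤o⇒n≤o (degreeC v (simC p)) deg₂
          degree-seqFin : ∀ {m} (f : Fin m → Cmd) i → degreeC v (seqFin f) ≤ w → degreeC v (f i) ≤ w
          degree-seqFin f zero    deg = ℕ.m+n≤o⇒m≤o _ deg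
          degree-seqFin f (suc i) deg = degree-seqFin (f ∘ suc) i (ℕ.m+n≤o⇒n≤o (degreeC v (f zero)) deg)
          frozen-frame : ∀ {τ τ′} → Frozen m q r τ → Frame (N ^ M) m τ τ′ → Frozen m q r τ′
          frozen-frame (frozen a b c d g h l) f = frozen (trans (registers f 0) a)
            (trans (registers f 1) b)
            (trans (registers f 2) c) (trans (registers f 3) d) (trans (registers f 4) g)
              (trans (registers f 5) h)
            λ a i a<K → trans (cells f a i (inj₁ (ℕ.<⇒≤ a<K))) (l a i a<K)

    eval-powB : ∀ {σ} → register σ 2 ≡ + B → ∀ m → eval σ (powB m) ≡ + (B ^ m)
    eval-powB     2≡B zero    = refl
    eval-powB {σ} 2≡B (suc m) = trans (cong₂ ℤ._*_ 2≡B (eval-powB {σ} 2≡B m)) (sym (ℤ.pos-* B (B ^ m)))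

    record JobOK (js : Job) : Set where
      constructor job-ok
      field
        member   : js ∈ jobs
        codes≤   : B ^ length js ≤ N ^ v
        entries≤ : ∀ {q} → q < B ^ length js → ∀ i {s} → s < n →
          ∣ entry B (N ^ x) i (form I i s) q js ∣ ≤ H

    open JobOK

    Found : Set
    Found = ∃[ js ] js ∈ jobs × ∃[ q ] SolutionOf js q

    -- `P` accumulates what has been ruled out so far. It matters only while the result is 0; once
    -- found, a solution makes the result final.
    Outcome : Set → ℤ → Set
    Outcome P r = (r ≡ 1ℤ × Found) ⊎ (r ≡ 0ℤ × P)

    -- Codes are tried in descending order, so those already ruled out are the codes from `j` on.
    Excluded : ℕ → Job → Set
    Excluded j js = ∀ q → j ≤ q → q < B ^ length js → ¬ SolutionOf js q

    jobTime : ℕ → Job → ℕ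
    jobTime T js = (1 + cost (powB (length js))) + (2 + B ^ length js * (2 + (4 + callTime T js)))

    jobsTime : ℕ → List Job → ℕ
    jobsTime T []         = 1
    jobsTime T (js ∷ jss) = jobTime T js + jobsTime T jss

    calls : List (Job {F = Form}) → ℕ
    calls []         = 0
    calls (js ∷ jss) = B ^ length js + calls jss

    module _ {W T : ℕ} (W≤ : W * N ^ M + N ^ M ≤ N ^ w) (W≤N^v : W ≤ N ^ v)
             (solve : ∀ (inst : SumInstance k) → SumInstance.n inst ≡ n →
                      Problem.Within (kSUM k) inst (N ^ D + n) →
                      ∃[ σ ] ∃[ t ] W ⊢ p , Problem.input (kSUM k) inst ⇓ σ after t
                        × Answers (Problem.Yes (kSUM k) inst) σ × (Timed → t ≤ T)) where

      -- The call number rises as the code falls; the invariant sum `m + j` tells how many residue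
      -- classes the job uses up.
      record AtCode (P : Set) (js : Job) (m₀ j : ℕ) (σ : State) : Set where
        constructor at-code
        field
          {m}       : ℕ
          {r}       : ℤ
          idle-part : Idle m j r σ
          count     : m + j ≡ m₀ + B ^ length js
          j≤        : j ≤ B ^ length js
          outcome   : Outcome (P × Excluded j js) r

      idle-code : ∀ {m q r σ} q′ → Idle m q r σ → Idle m q′ r (setRegister 5 (+ q′) σ)
      idle-code q′ (idle (frozen a b c d f _ l) marks fr) = idle (frozen a b c d f refl l) marks fr

      update : ∀ {P js j r r′} → Outcome (P × Excluded (suc j) js) r →
               (r′ ≡ 1ℤ × SolutionOf js j) ⊎ (r′ ≡ r × ¬ SolutionOf js j) → js ∈ jobs →
               Outcome (P × Excluded j js) r′
      update                  _                (inj₁ (r′≡1 , sol))  js∈ =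
        inj₁ (r′≡1 , _ , js∈ , _ , sol)
      update                  (inj₁ (r≡1 , f)) (inj₂ (refl , ¬sol)) js∈ = inj₁ (r≡1 , f)
      update {js = js} {j = j} (inj₂ (r≡0 , p′ , excluded)) (inj₂ (refl , ¬sol)) js∈ =
        inj₂ (r≡0 , p′ , excluded′)
        where
        excluded′ : Excluded j js
        excluded′ q j≤q q< with ℕ.m≤n⇒m<n∨m≡n j≤q
        ... | inj₁ j<q  = excluded q j<q q<
        ... | inj₂ refl = ¬sol

      run-code : ∀ {P js m₀ j σ} → JobOK js → m₀ + B ^ length js ≤ N ^ M →
                 degreeC v ((5 ≔ (reg 5 ⟨ sub ⟩ con 1ℤ)) ︔ call js) ≤ w → Small (N ^ v) σ →
                   AtCode P js m₀ (suc j) σ →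
                 Run ((5 ≔ (reg 5 ⟨ sub ⟩ con 1ℤ)) ︔ call js) σ (4 + callTime T js) (AtCode P js m₀ j)
      run-code {js = js} {m₀} {j} {σ} ok m₀≤ deg sm (at-code {m} idl count j<Q outcome) =
        run-︔ (run-≔ {Q = _≡ setRegister 5 (+ j) σ} (+ j) (ℕ.m+n≤o⇒m≤o dc deg) sm
          (cong (λ z → z ℤ.- 1ℤ) (Frozen.code≡ (Idle.idle-frozen idl)))
            (ℕ.≤-trans (ℕ.<⇒≤ j<Q) (codes≤ ok)) refl)
        λ { sm₁ refl → run-mono ℕ.≤-refl
          (λ { (r′ , idl′ , upd) → at-code idl′ (trans (sym (ℕ.+-suc m j)) count) (ℕ.<⇒≤ j<Q)
            (update outcome upd (member ok)) })
          (run-call W≤ W≤N^v (solve paddedInstance refl within) (ℕ.m+n≤o⇒n≤o dc deg) sm₁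
            (idle-code j idl)) }
        where
        dc = degreeC v (5 ≔ (reg 5 ⟨ sub ⟩ con 1ℤ))
        m<M : m < N ^ M
        m<M = ℕ.≤-trans (subst (suc m ≤_) (trans (sym (ℕ.+-suc m j)) count) (s≤s (ℕ.m≤m+n m j))) m₀≤
        open Call {js} {j} {m} m<M (entries≤ ok j<Q)

      run-job : ∀ {P js m q r σ} → JobOK js → m + B ^ length js ≤ N ^ M → degreeC v (jobC js) ≤ w →
                Small (N ^ v) σ → Idle m q r σ → Outcome P r →
                Run (jobC js) σ (jobTime T js)
                  (λ τ → ∃[ r′ ] Idle (m + B ^ length js) 0 r′ τ × Outcome (P × Excluded 0 js) r′)
      run-job {P} {js} {m} {r = r} {σ} ok m≤ deg sm idl outcome =
        run-︔ (run-≔ {Q = _≡ setRegister 5 (+ codes) σ} (+ codes) (ℕ.m+n≤o⇒m≤o dp deg) sm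
          (eval-powB {σ} (Frozen.bits≡ (Idle.idle-frozen idl)) (length js)) (codes≤ ok) refl)
        λ { sm₁ refl → run-mono ℕ.≤-refl finish
          (run-while (AtCode P js m) (ℕ.m+n≤o⇒m≤o v (ℕ.m+n≤o⇒n≤o dp deg))
          (λ sm ac → subst (0ℤ ℤ.<_) (sym (Frozen.code≡ (Idle.idle-frozen (AtCode.idle-part ac))))
            (ℤ.+<+ (s≤s z≤n)) ,
            run-code ok m≤ (ℕ.m+n≤o⇒n≤o v (ℕ.m+n≤o⇒n≤o dp deg)) sm ac)
          (λ ac → ℤ.≤-reflexive (Frozen.code≡ (Idle.idle-frozen (AtCode.idle-part ac))))
          codes sm₁ (at-code (idle-code codes idl) refl ℕ.≤-refl (start outcome))) }
        where
        codes = B ^ length js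
        dp = degreeC v (5 ≔ powB (length js))
        start : Outcome P r → Outcome (P × Excluded codes js) r
        start (inj₁ f)         = inj₁ f
        start (inj₂ (r≡0 , p′)) = inj₂ (r≡0 , p′ , λ q c≤q q<c → contradiction c≤q (ℕ.<⇒≱ q<c))
        finish : ∀ {τ} → AtCode P js m 0 τ → ∃[ r′ ] Idle (m + codes) 0 r′ τ × Outcome
          (P × Excluded 0 js) r′
        finish {τ} (at-code {m′} {r′} idl′ count _ outcome′) =
          r′ , subst (λ m → Idle m 0 r′ τ) (trans (sym (ℕ.+-identityʳ m′)) count) idl′ , outcome′

      run-jobs : ∀ jss {P m q r σ} → All JobOK jss → m + calls jss ≤ N ^ M → degreeC v (jobsC jss) ≤ w →
                 Small (N ^ v) σ → Idle m q r σ → Outcome P r →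
                 Run (jobsC jss) σ (jobsTime T jss)
                   (λ τ → Outcome (P × All (Excluded 0) jss) (register τ 0))
      run-jobs [] {P} {r = r} [] m≤ deg sm (idle fz _ _) outcome = run-skip sm
        (subst (Outcome (P × All (Excluded 0) [])) (sym (Frozen.result≡ fz)) (finish outcome))
        where
        finish : Outcome P r → Outcome (P × All (Excluded 0) []) r
        finish (inj₁ f)         = inj₁ f
        finish (inj₂ (r≡0 , p′)) = inj₂ (r≡0 , p′ , [])
      run-jobs (js ∷ jss) {P} {m} (ok ∷ oks) m≤ deg sm idl outcome =
        run-︔ (run-job ok (ℕ.m+n≤o⇒m≤o (m + B ^ length js) m≤′) (ℕ.m+n≤o⇒m≤o dj deg) sm idl outcome)
        λ { sm₁ (r′ , idl′ , outcome′) → run-mono ℕ.≤-refl reassoc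
          (run-jobs jss oks m≤′ (ℕ.m+n≤o⇒n≤o dj deg) sm₁ idl′ outcome′) }
        where
        dj = degreeC v (jobC js)
        m≤′ : m + B ^ length js + calls jss ≤ N ^ M
        m≤′ = subst (_≤ N ^ M) (sym (ℕ.+-assoc m (B ^ length js) (calls jss))) m≤
        reassoc : ∀ {r} → Outcome ((P × Excluded 0 js) × All (Excluded 0) jss) r →
          Outcome (P × All (Excluded 0) (js ∷ jss)) r
        reassoc (inj₁ f)                          = inj₁ f
        reassoc (inj₂ (r≡0 , (p′ , e) , es)) = inj₂ (r≡0 , p′ , e ∷ es)

-- The running time

module _ {X : Set} where

  -- Serves as a convenient upper bound for a maximum.
  sumOver : (X → ℕ) → List X → ℕ
  sumOver f []       = 0
  sumOver f (x ∷ xs) = f x + sumOver f xs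

  ∈⇒≤sumOver : ∀ (f : X → ℕ) {x xs} → x ∈ xs → f x ≤ sumOver f xs
  ∈⇒≤sumOver f {xs = x ∷ xs} (here refl)  = ℕ.m≤m+n (f x) (sumOver f xs)
  ∈⇒≤sumOver f {xs = y ∷ xs} (there x∈)   = ℕ.≤-trans (∈⇒≤sumOver f x∈) (ℕ.m≤n+m (sumOver f xs) (f y))

total-≤ : ∀ {m z} (f g : Fin m → ℕ) → 1 ≤ z → (∀ i → f i ≤ g i * z) → total f ≤ total g * z
total-≤ {zero}  {z} f g 1≤z f≤ = ℕ.≤-trans 1≤z (ℕ.≤-reflexive (sym (ℕ.+-identityʳ z)))
total-≤ {suc m} {z} f g 1≤z f≤ = ℕ.≤-trans
  (ℕ.+-mono-≤ (f≤ zero) (total-≤ (f ∘ suc) (g ∘ suc) 1≤z (f≤ ∘ suc)))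
  (ℕ.≤-reflexive (sym (ℕ.*-distribʳ-+ z (g zero) (total (g ∘ suc)))))

2^-cancel-≤ : ∀ {a b} → 2 ^ a ≤ 2 ^ b → a ≤ b
2^-cancel-≤ {a} {b} le = ℕ.≮⇒≥ λ b<a → ℕ.<⇒≱ (ℕ.^-monoʳ-< 2 (s≤s (s≤s z≤n)) b<a) le

n<2^1+log : ∀ n → n < 2 ^ suc ⌊log₂ n ⌋
n<2^1+log n = ℕ.≰⇒> λ le →
  ℕ.1+n≰n (subst (_≤ ⌊log₂ n ⌋) (⌊log₂[2^n]⌋≡n (suc ⌊log₂ n ⌋)) (⌊log₂⌋-mono-≤ le))

1≤log : ∀ {n} → 2 ≤ n → 1 ≤ ⌊log₂ n ⌋
1≤log {n} 2≤n = subst (_≤ ⌊log₂ n ⌋) (⌊log₂[2^n]⌋≡n 1) (⌊log₂⌋-mono-≤ 2≤n)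

bitLength : ∀ Y → ∃[ B ] Y < 2 ^ B × (∀ {b} → b < B → 2 ^ b ≤ Y)
bitLength Y = search Y (ℕ.≤-trans (ℕ.n<1+n Y) (n<2^n Y))
  where
  search : ∀ B → Y < 2 ^ B → ∃[ B ] Y < 2 ^ B × (∀ {b} → b < B → 2 ^ b ≤ Y)
  search zero    Y< = 0 , Y< , λ ()
  search (suc B) Y< with Y ℕ.<? 2 ^ B
  ... | yes Y<′ = search B Y<′
  ... | no Y≮   = suc B , Y< , λ { (s≤s b≤B) → ℕ.≤-trans (ℕ.^-monoʳ-≤ 2 b≤B) (ℕ.≮⇒≥ Y≮) }

-- By minimality `2 ^ (B - 1)` is at most `(n + 2) ^ y`, so at most `n ^ (2 * y)`, and
-- `n < 2 ^ (1 + L)`. Replacing each 1 by `L ≥ 1` gives `L + 2 * L * (2 * y)`.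
bits≤log : ∀ {n y B} → 2 ≤ n → (∀ {b} → b < B → 2 ^ b ≤ (n + 2) ^ y) → B ≤ (1 + 4 * y) * ⌊log₂ n ⌋
bits≤log {n} {y} {zero}  2≤n minimal = z≤n
bits≤log {n} {y} {suc B} 2≤n minimal = begin
  1 + B                     ≤⟨ ℕ.+-mono-≤ (1≤log 2≤n)
    (2^-cancel-≤ (ℕ.≤-trans (minimal ℕ.≤-refl) wide)) ⟩
  L + suc L * (2 * y)       ≤⟨ ℕ.+-monoʳ-≤ L (ℕ.*-monoˡ-≤ (2 * y) (ℕ.+-monoˡ-≤ L (1≤log 2≤n))) ⟩
  L + (L + L) * (2 * y)     ≡⟨ count L y ⟩
  (1 + 4 * y) * L           ∎
  where
  open ℕ.≤-Reasoning
  L = ⌊log₂ n ⌋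
  wide : (n + 2) ^ y ≤ 2 ^ (suc L * (2 * y))
  wide = ℕ.≤-trans ([n+2]^c≤n^2c y 2≤n)
    (ℕ.≤-trans (ℕ.^-monoˡ-≤ (2 * y) (ℕ.<⇒≤ (n<2^1+log n)))
      (ℕ.≤-reflexive (ℕ.^-*-assoc 2 (suc L) (2 * y))))
  count : ∀ L y → L + (L + L) * (2 * y) ≡ (1 + 4 * y) * L
  count = ℕ-solver.solve-∀

[m*n]^c : ∀ m n c → (m * n) ^ c ≡ m ^ c * n ^ c
[m*n]^c m n zero    = refl
[m*n]^c m n (suc c) = trans (cong (λ z → m * n * z) ([m*n]^c m n c)) (regroup m n (m ^ c) (n ^ c))
  where
  regroup : ∀ a b c d → a * b * (c * d) ≡ a * c * (b * d)
  regroup = ℕ-solver.solve-∀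

-- Depends on `φ` alone, as the exponent is chosen before `c′`. A job needs one factor `B` per atom,
-- and the sum dominates every length. The successor makes the exponent positive, which covers the
-- logarithmic loop of the setup even without any atoms.
logExponent : ∀ {k′} → Formula (suc k′) → ℕ
logExponent φ = suc (sumOver length (Expressions.jobs φ))

-- Choice of the exponents and assembly

module Reduction {k′ : ℕ} (φ : Formula (suc k′)) (T : ℕ → ℕ) (c′ : ℕ) where

  open Expressions φ

  -- Exponents of `N = n + 2`, none of which refers to the k-SUM program: `v₀` bounds the input, `y`
  -- the forms, `x` is the base of the digits, `β` bounds `B` and `2 ^ B`, `v₁` also the codes, `e`
  -- the entries, and `D` is where dummies start. Since `N ^ D + n ≤ 2 * N ^ D`, one more factor `N`
  -- gives the universe `c″` for which the k-SUM program is requested.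
  v₀ y x β v₁ e D c″ : ℕ
  v₀ = suc c′
  y  = sumOver (λ i → sumOver (sumOver λ f → degree v₀ (formE i f)) (dnf ψ)) (List.allFin k)
  x  = 3 * k + y
  β  = suc y
  v₁ = v₀ + (β + sumOver (λ js → β * length js) jobs)
  e  = sumOver (λ i → sumOver (λ js → degree v₁ (entryE x i (reg 5) js)) jobs) (List.allFin k)
  D  = k + e
  c″ = suc D

  -- A job has at most `N ^ (β * length js)` codes; the successor pays for adding up the jobs.
  callsDegree : List (Job {F = Form}) → ℕ
  callsDegree []         = 0
  callsDegree (js ∷ jss) = suc (β * length js + callsDegree jss)

  M : ℕ
  M = callsDegree jobs

  module _ (p : Cmd) (wₚ C n₀ : ℕ) (solveWide : SolvesWide k T c″ p wₚ C n₀)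
           (C₁ n₁ : ℕ) (linear : ∀ n → n₁ ≤ n → n ≤ C₁ * T n) where

    open Program φ p y x D M using (program; setup; fillBody; powB; powersTest)

    -- In `v`, the summand `wₚ` covers values stored by the simulated program, `v₁` the input,
    -- powers and codes, `c″` the set elements, and `M + k` the call numbers and stamps. In `w`, the
    -- last summand covers relocated addresses, up to `N ^ wₚ * N ^ M + N ^ M`.
    v w : ℕ
    v = wₚ + (v₁ + (c″ + (M + k)))
    w = degreeC v program + suc (wₚ + M + M)

    -- `n₀` is for the time of k-SUM, `n₁` for its linear lower bound, and 2 makes the logarithm
    -- positive.
    threshold : ℕ
    threshold = n₀ + (n₁ + 2)

    b₁ : ℕ
    b₁ = 1 + 4 * y

    testCost setupConstant : ℕ
    testCost      = 1 + cost powersTest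
    setupConstant = saveTime (k + l) + (maxTime k +
      ((2 + (2 + (testCost + b₁ * (testCost + 11)))) + (1 + cost (powE M) + 6)))

    -- The factor `2 * C₁` comes from `suc n ≤ 2 * n ≤ 2 * C₁ * T n`, the factor 5 in `5 * C` from
    -- the simulation, and the leading 6 is the overhead of the loop over codes.
    fillConstant callConstant jobConstant : Job → ℕ
    fillConstant js = total λ i → 4 + (2 + straightTime (fillBody i js))
    callConstant js = 6 + (fillConstant js * (2 * C₁) + (3 + (5 * C + 10)))
    jobConstant js  = 1 + cost (powB (length js)) + (2 + callConstant js * b₁ ^ length js)

    jobsConstant : List Job → ℕ
    jobsConstant []         = 1
    jobsConstant (js ∷ jss) = jobConstant js + jobsConstant jss

    module _ (I : ModelInstance φ) (within-c′ : Problem.Within (FOPℤ φ) I (size I ^ c′)) where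

      open ModelInstance I

      Timed : Set
      Timed = threshold ≤ size I

      open Setup φ p y x D M I Timed v w using (n; N; setupTime; run-setup; set-up)
      open Logic (2≤n+2 n) Timed v w using (Run; run-︔; run-mono)

      2≤N : 2 ≤ N
      2≤N = 2≤n+2 n

      N^-mono : ∀ {a b} → a ≤ b → N ^ a ≤ N ^ b
      N^-mono = ^-mono 2≤N

      n≤N : n ≤ N
      n≤N = ℕ.m≤m+n n 2

      within-mono : ∀ {U U′} → U ≤ U′ → Problem.Within (FOPℤ φ) I U → Problem.Within (FOPℤ φ) I U′
      within-mono U≤ (A≤ , t≤) =
        (λ i → All.map (VecAll.map (λ a≤ → ℕ.≤-trans a≤ U≤)) (A≤ i)) , VecAll.map
          (λ s≤ → ℕ.≤-trans s≤ U≤) t≤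

      within-v₀ : Problem.Within (FOPℤ φ) I (N ^ v₀)
      within-v₀ = within-mono (ℕ.≤-trans (ℕ.^-monoˡ-≤ c′ n≤N) (N^-mono (ℕ.n≤1+n c′))) within-c′

      v₀≤v₁ : v₀ ≤ v₁
      v₀≤v₁ = ℕ.m≤m+n v₀ _

      v₁≤v : v₁ ≤ v
      v₁≤v = ℕ.≤-trans (ℕ.m≤m+n v₁ _) (ℕ.m≤n+m _ wₚ)

      β≤v₁ : β ≤ v₁
      β≤v₁ = ℕ.≤-trans (ℕ.m≤m+n β _) (ℕ.m≤n+m _ v₀)

      n≤N^v₀ : n ≤ N ^ v₀
      n≤N^v₀ = n≤[n+2]^1+c n c′

      B : ℕ
      B = proj₁ (bitLength (N ^ y))

      Y<2^B : N ^ y < 2 ^ B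
      Y<2^B = proj₁ (proj₂ (bitLength (N ^ y)))

      minimal : ∀ {b} → b < B → 2 ^ b ≤ N ^ y
      minimal = proj₂ (proj₂ (bitLength (N ^ y)))

      1≤N^ : ∀ a → 1 ≤ N ^ a
      1≤N^ a = N^-mono {0} {a} z≤n

      -- By minimality of `B`, the power before `2 ^ B` is at most `N ^ y`; doubling costs one more
      -- factor `N`.
      2^B≤N^β : 2 ^ B ≤ N ^ β
      2^B≤N^β with B | minimal
      ... | zero   | _        = 1≤N^ β
      ... | suc B′ | minimal′ = ℕ.*-mono-≤ 2≤N (minimal′ ℕ.≤-refl)

      instance
        B≢0 : NonZero B
        B≢0 = ≢-nonZero λ B≡0 → ℕ.<⇒≱ (subst (λ B → N ^ y < 2 ^ B) B≡0 Y<2^B) (1≤N^ y)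

      B≤N^β : B ≤ N ^ β
      B≤N^β = ℕ.≤-trans (ℕ.<⇒≤ (n<2^n B)) 2^B≤N^β

      2^B≤N^v : 2 ^ B ≤ N ^ v
      2^B≤N^v = ℕ.≤-trans 2^B≤N^β (N^-mono (ℕ.≤-trans β≤v₁ v₁≤v))

      B≤N^v : B ≤ N ^ v
      B≤N^v = ℕ.≤-trans B≤N^β (N^-mono (ℕ.≤-trans β≤v₁ v₁≤v))

      codes≤ : ∀ (js : Job {F = Form}) → B ^ length js ≤ N ^ (β * length js)
      codes≤ js = ℕ.≤-trans (ℕ.^-monoˡ-≤ (length js) B≤N^β)
        (ℕ.≤-reflexive (ℕ.^-*-assoc N β (length js)))

      codes≤v₁ : ∀ {js} → js ∈ jobs → B ^ length js ≤ N ^ v₁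
      codes≤v₁ {js} js∈ = ℕ.≤-trans (codes≤ js)
        (N^-mono {β * length js} {v₁} (ℕ.≤-trans (∈⇒≤sumOver (λ js → β * length js) js∈)
        (ℕ.≤-trans (ℕ.m≤n+m _ β) (ℕ.m≤n+m _ v₀))))

      form≤ : ∀ i {c} → c ∈ dnf ψ → ∀ {f} → f ∈ c → ∀ {s} → s < n → ∣ form I i s f ∣ ≤ N ^ y
      form≤ i {c} c∈ {f} f∈ {s} s<n = ℕ.≤-trans
        -- Forms consult neither the power table nor the code, so both are left empty. A table of
        -- `B` powers would require a bound in terms of `y`, which is only being justified here.
        (subst (λ z → ∣ z ∣ ≤ N ^ degree v₀ (formE i f)) (eval-formE I (canonical-ready I 0 0 s) i f)
          (eval-bound 2≤N {v₀} {canonical I 0 0 s} (formE i f) (small⇒leaves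
            (canonical-small I n≤N^v₀ z≤n z≤n (ℕ.≤-trans (ℕ.<⇒≤ s<n) n≤N^v₀) (λ ()) within-v₀)
              (formE i f))))
        (N^-mono (ℕ.≤-trans (∈⇒≤sumOver (λ f → degree v₀ (formE i f)) f∈)
          (ℕ.≤-trans (∈⇒≤sumOver (sumOver λ f → degree v₀ (formE i f)) c∈)
            (∈⇒≤sumOver (λ i → sumOver (sumOver λ f → degree v₀ (formE i f)) (dnf ψ)) (∈-allFin i)))))

      entries≤ : ∀ {js} → js ∈ jobs → ∀ {q} → q < B ^ length js → ∀ i {s} → s < n →
                 ∣ entry B (N ^ x) i (form I i s) q js ∣ ≤ N ^ e
      entries≤ {js} js∈ {q} q< i {s} s<n = ℕ.≤-trans
        (subst (λ z → ∣ z ∣ ≤ N ^ degree v₁ (entryE x i (reg 5) js))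
          (eval-entryE I (canonical-ready I B q s) x i refl js)
          (eval-bound 2≤N {v₁} {canonical I B q s} (entryE x i (reg 5) js) (small⇒leaves
            (canonical-small I n≤N^v₁ (ℕ.≤-trans B≤N^β (N^-mono β≤v₁))
              (ℕ.≤-trans (ℕ.<⇒≤ q<) (codes≤v₁ js∈)) (ℕ.≤-trans (ℕ.<⇒≤ s<n) n≤N^v₁)
              (λ b<B → ℕ.≤-trans (minimal b<B) (N^-mono (ℕ.≤-trans (ℕ.n≤1+n y) β≤v₁)))
              (within-mono (N^-mono v₀≤v₁) within-v₀)) (entryE x i (reg 5) js))))
        (N^-mono (ℕ.≤-trans (∈⇒≤sumOver (λ js → degree v₁ (entryE x i (reg 5) js)) js∈)
          (∈⇒≤sumOver (λ i → sumOver (λ js → degree v₁ (entryE x i (reg 5) js)) jobs) (∈-allFin i))))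
        where
        n≤N^v₁ : n ≤ N ^ v₁
        n≤N^v₁ = ℕ.≤-trans n≤N^v₀ (N^-mono v₀≤v₁)

      X-large : k * N ^ y + 2 * k < N ^ x
      X-large = begin-strict
        k * N ^ y + 2 * k            ≤⟨ ℕ.+-monoʳ-≤ (k * N ^ y)
          (ℕ.m≤m*n (2 * k) (N ^ y) {{>-nonZero (1≤N^ y)}}) ⟩
        k * N ^ y + 2 * k * N ^ y    ≡⟨ count k (N ^ y) ⟩
        3 * k * N ^ y                <⟨ ℕ.*-monoˡ-< (N ^ y) {{>-nonZero (1≤N^ y)}} (n<N^n 2≤N (3 * k)) ⟩
        N ^ (3 * k) * N ^ y          ≡⟨ sym (ℕ.^-distribˡ-+-* N (3 * k) y) ⟩
        N ^ x                        ∎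
        where
        open ℕ.≤-Reasoning
        count : ∀ k Y → k * Y + 2 * k * Y ≡ 3 * k * Y
        count = ℕ-solver.solve-∀

      kH<D : k * N ^ e < N ^ D
      kH<D = ℕ.<-≤-trans (ℕ.*-monoˡ-< (N ^ e) {{>-nonZero (1≤N^ e)}} (n<N^n 2≤N k))
        (ℕ.≤-reflexive (sym (ℕ.^-distribˡ-+-* N k e)))

      D+n≤N^c″ : N ^ D + n ≤ N ^ c″
      D+n≤N^c″ = ℕ.≤-trans (ℕ.+-monoʳ-≤ (N ^ D) (ℕ.≤-trans (n≤[n+2]^1+c n (k′ + e)) ℕ.≤-refl))
        (ℕ.≤-trans (ℕ.≤-reflexive (cong (λ z → N ^ D + z) (sym (ℕ.+-identityʳ (N ^ D)))))
          (ℕ.*-monoˡ-≤ (N ^ D) 2≤N))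

      c″+M+k≤v : c″ + (M + k) ≤ v
      c″+M+k≤v = ℕ.≤-trans (ℕ.m≤n+m _ v₁) (ℕ.m≤n+m _ wₚ)

      D+n≤N^v : N ^ D + n ≤ N ^ v
      D+n≤N^v = ℕ.≤-trans D+n≤N^c″ (N^-mono (ℕ.≤-trans (ℕ.m≤m+n c″ _) c″+M+k≤v))

      Mk≤N^v : N ^ M * k ≤ N ^ v
      Mk≤N^v = ℕ.≤-trans (^-*-bound 2≤N M k ℕ.≤-refl (ℕ.<⇒≤ (n<N^n 2≤N k)))
        (N^-mono (ℕ.≤-trans (ℕ.m≤n+m (M + k) c″) c″+M+k≤v))

      open Calls.Bounded φ p y x D M I Timed v w {B} {N ^ e} kH<D D+n≤N^v Mk≤N^v

      calls≤ : calls jobs ≤ N ^ M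
      calls≤ = go jobs
        where
        go : ∀ jss → calls jss ≤ N ^ callsDegree jss
        go []         = z≤n
        go (js ∷ jss) = ^-+-bound 2≤N (β * length js) (callsDegree jss) (codes≤ js) (go jss)

      solve : ∀ (inst : SumInstance k) → SumInstance.n inst ≡ n →
        Problem.Within (kSUM k) inst (N ^ D + n) →
              ∃[ σ ] ∃[ t ] N ^ wₚ ⊢ p , Problem.input (kSUM k) inst ⇓ σ after t
                × Answers (Problem.Yes (kSUM k) inst) σ × (Timed → t ≤ C * T n)
      solve inst n≡ within = at-size n n≡ λ i → All.map (λ a≤ → ℕ.≤-trans a≤ D+n≤N^c″) (within i)
        where
        -- Generalised over the size, so that the equation can be matched with `refl`.
        at-size : ∀ m → SumInstance.n inst ≡ m → Problem.Within (kSUM k) inst ((m + 2) ^ c″) →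
                  ∃[ σ ] ∃[ t ] (m + 2) ^ wₚ ⊢ p , Problem.input (kSUM k) inst ⇓ σ after t
                    × Answers (Problem.Yes (kSUM k) inst) σ × (threshold ≤ m → t ≤ C * T m)
        at-size _ refl within =
          let σ , t , d , answer , time = solveWide inst within
          in σ , t , d , answer , λ th≤ → time (ℕ.m+n≤o⇒m≤o n₀ th≤)

      all-ok : All (JobOK) jobs
      all-ok = All.tabulate λ {js} js∈ → job-ok js∈ (ℕ.≤-trans (codes≤v₁ {js} js∈) (N^-mono v₁≤v))
        (entries≤ {js} js∈)

      programTime : ℕ
      programTime = setupTime Y<2^B minimal 2^B≤N^v B≤N^v + jobsTime (C * T n) jobs

      run-program : (∀ i → Q i ≡ exists) → Run program (inputState I) programTime
        (Answers (Problem.Yes (FOPℤ φ) I))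
      run-program ∃s = run-︔ (run-setup Y<2^B minimal 2^B≤N^v B≤N^v (ℕ.m+n≤o⇒m≤o _ deg) M≤
        (ℕ.≤-trans n≤N^v₀ (N^-mono (ℕ.≤-trans v₀≤v₁ v₁≤v)))
          (within-mono (N^-mono (ℕ.≤-trans v₀≤v₁ v₁≤v)) within-v₀))
        λ {σ} sm (set-up r≡ n≡ b≡ M≡ m≡ q≡ low high) → run-mono ℕ.≤-refl (λ {τ} → answer {τ})
          (run-jobs W≤ (N^-mono (ℕ.m≤m+n wₚ _)) solve jobs {P = ⊤} {m = 0} {q = 0} {r = 0ℤ} all-ok
            calls≤
            (ℕ.m+n≤o⇒n≤o (degreeC v setup) deg) sm
            (idle (frozen r≡ n≡ b≡ M≡ m≡ q≡ low) (λ z → ℤ.≤-reflexive (high _ z ℕ.≤-refl))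
              λ b j m′ K<b _ _ → high b _ (ℕ.<⇒≤ K<b))
            (inj₂ (refl , tt)))
        where
        deg : degreeC v program ≤ w
        deg = ℕ.m≤m+n _ _
        M≤ : N ^ M ≤ N ^ v
        M≤ = N^-mono (ℕ.≤-trans (ℕ.m≤m+n M k) (ℕ.≤-trans (ℕ.m≤n+m (M + k) c″) c″+M+k≤v))
        W≤ : N ^ wₚ * N ^ M + N ^ M ≤ N ^ w
        W≤ = ℕ.≤-trans (^-+-bound 2≤N (wₚ + M) M (^-*-bound 2≤N wₚ M ℕ.≤-refl ℕ.≤-refl) ℕ.≤-refl)
          (N^-mono (ℕ.m≤n+m _ (degreeC v program)))
        answer : ∀ {τ} → Outcome (⊤ × All (Excluded 0) jobs) (register τ 0) →
                 Answers (Problem.Yes (FOPℤ φ) I) τ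
        answer (inj₁ (r≡1 , js , js∈ , q , sol)) =
          inj₁ (r≡1 , code⇒yes I Y<2^B X-large form≤ ∃s js∈ sol)
        answer (inj₂ (r≡0 , _ , excluded)) = inj₂ (r≡0 , λ yes- →
          let js , js∈ , q , q< , sol = yes⇒code I Y<2^B X-large form≤ ∃s yes-
          in All.lookup excluded js∈ q z≤n q< sol)

      L Z : ℕ
      L = ⌊log₂ n ⌋
      Z = T n * L ^ logExponent φ

      module _ (timed : Timed) where

        2≤n : 2 ≤ n
        2≤n = ℕ.m+n≤o⇒n≤o n₁ (ℕ.m+n≤o⇒n≤o n₀ timed)

        n≤C₁T : n ≤ C₁ * T n
        n≤C₁T = linear n (ℕ.m+n≤o⇒m≤o n₁ (ℕ.m+n≤o⇒n≤o n₀ timed))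

        -- The linear lower bound also excludes `T n = 0`, so constant overheads can be charged to
        -- `T n`.
        1≤T : 1 ≤ T n
        1≤T = ℕ.n≢0⇒n>0 λ T≡0 → ℕ.<⇒≱ (ℕ.≤-trans (s≤s z≤n) 2≤n)
          (subst (n ≤_) (trans (cong (C₁ *_) T≡0) (ℕ.*-zeroʳ C₁)) n≤C₁T)

        1≤L : 1 ≤ L
        1≤L = 1≤log 2≤n

        instance
          L≢0 : NonZero L
          L≢0 = >-nonZero 1≤L
          T≢0 : NonZero (T n)
          T≢0 = >-nonZero 1≤T

        L≤Z : L ≤ Z
        L≤Z = ℕ.≤-trans (ℕ.≤-trans (ℕ.≤-reflexive (sym (ℕ.*-identityʳ L)))
          (ℕ.^-monoʳ-≤ L (s≤s (z≤n {sumOver length jobs}))))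
          (ℕ.m≤n*m (L ^ logExponent φ) (T n))

        1≤Z : 1 ≤ Z
        1≤Z = ℕ.≤-trans 1≤L L≤Z

        constant : ∀ {z} → 1 ≤ z → ∀ a → a ≤ a * z
        constant 1≤z a = ℕ.≤-trans (ℕ.≤-reflexive (sym (ℕ.*-identityʳ a))) (ℕ.*-monoʳ-≤ a 1≤z)

        plus : ∀ {z a b} a′ b′ → a ≤ a′ * z → b ≤ b′ * z → a + b ≤ (a′ + b′) * z
        plus {z} a′ b′ a≤ b≤ = ℕ.≤-trans (ℕ.+-mono-≤ a≤ b≤)
          (ℕ.≤-reflexive (sym (ℕ.*-distribʳ-+ z a′ b′)))

        B≤ : B ≤ b₁ * L
        B≤ = bits≤log {n} {y} {B} 2≤n minimal

        setup-time : setupTime Y<2^B minimal 2^B≤N^v B≤N^v ≤ setupConstant * Z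
        setup-time = plus {Z} s₁ (s₂ + ((2 + (2 + (testCost + b₁ * u))) + s₃)) (constant 1≤Z s₁)
          (plus {Z} s₂ ((2 + (2 + (testCost + b₁ * u))) + s₃) (constant 1≤Z s₂)
            (plus {Z} (2 + (2 + (testCost + b₁ * u))) s₃
              (plus {Z} 2 (2 + (testCost + b₁ * u)) (constant 1≤Z 2)
                (plus {Z} 2 (testCost + b₁ * u) (constant 1≤Z 2)
                  (plus {Z} testCost (b₁ * u) (constant 1≤Z testCost) loop-time)))
              (constant 1≤Z s₃)))
          where
          s₁ = saveTime (k + l)
          s₂ = maxTime k
          s₃ = 1 + cost (powE M) + 6
          u  = testCost + 11
          loop-time : B * u ≤ b₁ * u * Z
          loop-time = ℕ.≤-trans (ℕ.*-monoˡ-≤ u (ℕ.≤-trans B≤ (ℕ.*-monoʳ-≤ b₁ L≤Z)))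
            (ℕ.≤-reflexive (swap b₁ Z u))
            where
            swap : ∀ a b c → a * b * c ≡ a * c * b
            swap = ℕ-solver.solve-∀

        fill-time : ∀ js → total (fillTime js) ≤ fillConstant js * (2 * C₁) * T n
        fill-time js = begin
          total (λ i → 2 + (2 + n * (2 + st i)))     ≤⟨ total-≤ _ (λ i → 4 + (2 + st i))
            (s≤s z≤n) each ⟩
          fillConstant js * suc n                    ≤⟨ ℕ.*-monoʳ-≤ (fillConstant js)
            (ℕ.+-monoˡ-≤ n (ℕ.≤-trans (s≤s z≤n) 2≤n)) ⟩
          fillConstant js * (n + n)                  ≤⟨ ℕ.*-monoʳ-≤ (fillConstant js)
            (ℕ.+-mono-≤ n≤C₁T n≤C₁T) ⟩
          fillConstant js * (C₁ * T n + C₁ * T n)    ≡⟨ count (fillConstant js) C₁ (T n) ⟩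
          fillConstant js * (2 * C₁) * T n           ∎
          where
          open ℕ.≤-Reasoning
          st : Fin k → ℕ
          st i = straightTime (fillBody i js)
          each : ∀ i → 2 + (2 + n * (2 + st i)) ≤ (4 + (2 + st i)) * suc n
          each i = ℕ.≤-trans (ℕ.+-mono-≤ (constant {suc n} (s≤s z≤n) 4)
              (ℕ.≤-trans (ℕ.≤-reflexive (ℕ.*-comm n (2 + st i))) (ℕ.*-monoʳ-≤ (2 + st i) (ℕ.n≤1+n n))))
            (ℕ.≤-reflexive (sym (ℕ.*-distribʳ-+ (suc n) 4 (2 + st i))))
          count : ∀ f c t → f * (c * t + c * t) ≡ f * (2 * c) * t
          count = ℕ-solver.solve-∀

        call-time : ∀ js → 6 + callTime (C * T n) js ≤ callConstant js * T n
        call-time js = plus {T n} 6 (f + (3 + (5 * C + 10))) (constant 1≤T 6)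
          (plus {T n} f (3 + (5 * C + 10)) (fill-time js)
            (plus {T n} 3 (5 * C + 10) (constant 1≤T 3)
              (plus {T n} (5 * C) 10 (ℕ.≤-reflexive (sym (ℕ.*-assoc 5 C (T n)))) (constant 1≤T 10))))
          where
          f = fillConstant js * (2 * C₁)

        job-time : ∀ {js} → length js ≤ logExponent φ →
                   jobTime (C * T n) js ≤ jobConstant js * Z
        job-time {js} len≤ = plus {Z} (1 + cost (powB (length js))) (2 + c * b₁ ^ length js)
          (constant 1≤Z _)
          (plus {Z} 2 (c * b₁ ^ length js) (constant 1≤Z 2) (begin
            B ^ len * (6 + callTime (C * T n) js)
              ≤⟨ ℕ.*-mono-≤ (ℕ.^-monoˡ-≤ len B≤) (call-time js) ⟩
            (b₁ * L) ^ len * (c * T n)            ≡⟨ cong (_* (c * T n)) ([m*n]^c b₁ L len) ⟩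
            b₁ ^ len * L ^ len * (c * T n)        ≤⟨ ℕ.*-monoˡ-≤ (c * T n)
              (ℕ.*-monoʳ-≤ (b₁ ^ len) (ℕ.^-monoʳ-≤ L len≤)) ⟩
            b₁ ^ len * L ^ logExponent φ * (c * T n)  ≡⟨ regroup (b₁ ^ len) (L ^ logExponent φ) c
              (T n) ⟩
            c * b₁ ^ len * Z                      ∎))
          where
          open ℕ.≤-Reasoning
          c = callConstant js
          len = length js
          regroup : ∀ a b c t → a * b * (c * t) ≡ c * a * (t * b)
          regroup = ℕ-solver.solve-∀

        jobs-time : ∀ jss → All (λ js → length js ≤ logExponent φ) jss →
                    jobsTime (C * T n) jss ≤ jobsConstant jss * Z
        jobs-time []         []          = constant 1≤Z 1
        jobs-time (js ∷ jss) (len≤ ∷ ls) = plus {Z} (jobConstant js) (jobsConstant jss)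
          (job-time {js} len≤) (jobs-time jss ls)

        program-time : programTime ≤ (setupConstant + jobsConstant jobs) * Z
        program-time = plus {Z} setupConstant (jobsConstant jobs) setup-time
          (jobs-time jobs (All.tabulate λ {js} js∈ → ℕ.m≤n⇒m≤1+n (∈⇒≤sumOver length {js} js∈)))

theorem1 : ∀ (k : ℕ) → 3 ≤ k →
    ∀ (T-kSUM : ℕ → ℕ) → SolvableIn (kSUM k) T-kSUM →
    ∀ (P : Problem) → FOPℤ∃^ k P →
    ∃[ c ] SolvableIn P (λ n → T-kSUM n * ⌊log₂ n ⌋ ^ c)
theorem1 (suc (suc (suc k))) (s≤s (s≤s (s≤s z≤n))) T solvable _ (fop φ ∃s) = logExponent φ , λ c′ →
  let open Reduction φ T c′
      p , w₀ , C , n₀ , solveWide = kSUM-wide (2 + k) T solvable c″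
      C₁ , n₁ , linear            = kSUM-linear (suc k) T solvable
  in Program.program φ p y x D M , w p w₀ C n₀ solveWide C₁ n₁ linear ,
     setupConstant p w₀ C n₀ solveWide C₁ n₁ linear + jobsConstant p w₀ C n₀ solveWide C₁ n₁ linear
       (Expressions.jobs φ) ,
     threshold p w₀ C n₀ solveWide C₁ n₁ linear , λ I within →
     let Logic.ran d time _ answer = run-program p w₀ C n₀ solveWide C₁ n₁ linear I within ∃s
     in _ , _ , d , answer , λ timed → ℕ.≤-trans (time timed)
          (program-time p w₀ C n₀ solveWide C₁ n₁ linear I within timed)
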